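{- Let $\Gamma=(V,E)$ be a finite layered graph with $V=\bigcup_{i=0}^n V_i$, $V_0=\{*\}$ (so $*$ is the unique minimal element, of level $0$), such that every vertex $v\in V_+=\bigcup_{i=1}^nV_i$ is the tail of at least one edge, and let $h(t)$ denote the Hilbert series of $A(\Gamma)$. Then $$\frac{1-t}{h(t)}=1+\sum_{v_1>v_2>\dots>v_\ell\ge *}(-1)^{\ell}\,t^{|v_1|-|v_\ell|+1},$$ where the sum runs over all $\ell\ge1$ and all chains $v_1>v_2>\dots>v_\ell$ of vertices of $V$.
   Context: A directed graph $\Gamma=(V,E)$ consists of a set $V$ of vertices, a set $E$ of edges, and maps $\mathbf t,\mathbf h:E\to V$ (tail and head). It is layered if $V=\bigcup_{i=0}^n V_i$, $E=\bigcup_{i=1}^n E_i$ with $\mathbf t(E_i)\subseteq V_i$ and $\mathbf h(E_i)\subseteq V_{i-1}$; for $v\in V_i$ write $|v|=i$ (the level of $v$). A path from $v$ to $w$ is a sequence of edges $\pi=(e_1,\dots,e_m)$ with $\mathbf t(e_1)=v$, $\mathbf h(e_m)=w$, $\mathbf t(e_{i+1})=\mathbf h(e_i)$; its length is $m$. Write $v>w$ if there is a path of positive length from $v$ to $w$, and $v\ge w$ if $v>w$ or $v=w$. Fix a field $F$ and let $T(E)$ be the free associative $F$-algebra on $E$. For a path $\pi=(e_1,\dots,e_m)$ put $P_\pi(\tau)=(\tau-e_1)\cdots(\tau-e_m)\in T(E)[\tau]$ ($\tau$ a central indeterminate) and write $P_\pi(\tau)=\sum_{j=0}^m e(\pi,j)\tau^{m-j}$.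 Let $R$ be the two-sided ideal of $T(E)$ generated by all $e(\pi_1,k)-e(\pi_2,k)$ where $\pi_1,\pi_2$ are paths with the same tail and the same head and $1\le k\le$ length of $\pi_1$. Then $A(\Gamma)=T(E)/R$, graded by giving each edge degree $1$; its Hilbert series is $\sum_i\dim A(\Gamma)_i\,t^i$. -}

module Defs where

open import Level using (Level; _⊔_) renaming (suc to lsuc)
open import Algebra.Bundles using (CommutativeRing)
open import Data.Nat as ℕ using (ℕ; zero; suc; _≤_; _∸_)
open import Data.Integer as ℤ using (ℤ)
open import Data.Fin using (Fin)
open import Data.Fin.Properties using () renaming (_≟_ to _≟F_)
open import Data.List using (List; []; _∷_; _++_; map; concatMap; length; foldr; allFin)
open import Data.Unit using (⊤)
open import Data.Empty using (⊥)
import Data.List.Properties as LP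
open import Data.Vec using (Vec; toList)
open import Data.Product using (Σ; _×_; _,_; ∃)
open import Relation.Nullary using (¬_; yes; no)
open import Relation.Binary.PropositionalEquality using (_≡_)

record Field (c ℓ : Level) : Set (lsuc (c ⊔ ℓ)) where
  field
    commutativeRing : CommutativeRing c ℓ
  open CommutativeRing commutativeRing public
  field
    0≉1     : ¬ (0# ≈ 1#)
    inverse : ∀ x → ¬ (x ≈ 0#) → Σ Carrier λ y → (x * y) ≈ 1#

-- Finite layered directed graphs.  Vertices are Fin nV, edges Fin nE,
-- tail/head maps, and level : V → ℕ (v ∈ V_i iff level v ≡ i).
-- Layered: every edge goes from level i to level i-1 (i ≥ 1).

record Graph : Set where
  field
    nV nE  : ℕ
    tl hd  : Fin nE → Fin nV
    level  : Fin nV → ℕ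
    layered : ∀ e → level (tl e) ≡ suc (level (hd e))

module GraphNotions (Γ : Graph) where
  open Graph Γ public

  Vert : Set
  Vert = Fin nV

  Edge : Set
  Edge = Fin nE

  IsPath : Vert → Vert → List Edge → Set
  IsPath v w []      = v ≡ w
  IsPath v w (e ∷ π) = (tl e ≡ v) × IsPath (hd e) w π

  _>V_ : Vert → Vert → Set
  v >V w = Σ (List Edge) λ π → (1 ≤ length π) × IsPath v w π

  IsChainFrom : Vert → List Vert → Set
  IsChainFrom v []       = ⊤
  IsChainFrom v (w ∷ ws) = (v >V w) × IsChainFrom w ws

  IsChain : List Vert → Set
  IsChain []       = ⊥
  IsChain (v ∷ vs) = IsChainFrom v vs

  lastOr : Vert → List Vert → Vert
  lastOr d []       = d
  lastOr d (x ∷ xs) = lastOr x xs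

  -- contribution of a chain to the coefficient of t^j in
  -- (-1)^ℓ t^{|v₁|-|v_ℓ|+1}
  chainTerm : List Vert → ℕ → ℤ
  chainTerm []       j = ℤ.0ℤ
  chainTerm (v ∷ vs) j with (level v ∸ level (lastOr v vs)) ℕ.+ 1 ℕ.≟ j
  ... | yes _ = (ℤ.-1ℤ) ℤ.^ length (v ∷ vs)
  ... | no  _ = ℤ.0ℤ

  sumℤ : List ℤ → ℤ
  sumℤ = foldr ℤ._+_ ℤ.0ℤ

  chainPolyCoeff : List (List Vert) → ℕ → ℤ
  chainPolyCoeff C j = δ0 j ℤ.+ sumℤ (map (λ ch → chainTerm ch j) C)
    where
    δ0 : ℕ → ℤ
    δ0 zero    = ℤ.1ℤ
    δ0 (suc _) = ℤ.0ℤ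

  oneMinusT : ℕ → ℤ
  oneMinusT zero          = ℤ.1ℤ
  oneMinusT (suc zero)    = ℤ.-1ℤ
  oneMinusT (suc (suc _)) = ℤ.0ℤ

module Alg {c ℓ} (F : Field c ℓ) (Γ : Graph) where
  open Field F
  open GraphNotions Γ

  Word : Set
  Word = List Edge

  -- an element of T(E): a formal finite linear combination of words
  TE : Set c
  TE = List (Carrier × Word)

  _≟W_ : (u w : Word) → Relation.Nullary.Dec (u ≡ w)
  _≟W_ = LP.≡-dec _≟F_

  coeff : TE → Word → Carrier
  coeff []             w = 0#
  coeff ((a , u) ∷ xs) w with u ≟W w
  ... | yes _ = a + coeff xs w
  ... | no  _ = coeff xs w

  _≈T_ : TE → TE → Set ℓ
  x ≈T y = ∀ w → coeff x w ≈ coeff y w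

  _+T_ : TE → TE → TE
  _+T_ = _++_

  scaleT : Carrier → TE → TE
  scaleT k = map (λ { (a , u) → (k * a , u) })

  negT : TE → TE
  negT = scaleT (- 1#)

  _*T_ : TE → TE → TE
  x *T y = concatMap (λ { (a , u) → map (λ { (b , w) → (a * b , u ++ w) }) y }) x

  0T 1T : TE
  0T = []
  1T = (1# , []) ∷ []

  wordT : Word → TE
  wordT u = (1# , u) ∷ []

  edgeT : Edge → TE
  edgeT e = wordT (e ∷ [])

  -- T(E)[τ]: coefficient lists, index = power of τ
  PolyT : Set c
  PolyT = List TE

  _+P_ : PolyT → PolyT → PolyT
  []       +P q        = q
  (a ∷ p)  +P []       = a ∷ p
  (a ∷ p)  +P (b ∷ q)  = (a +T b) ∷ (p +P q)

  _*P_ : PolyT → PolyT → PolyT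
  []      *P q = []
  (a ∷ p) *P q = map (a *T_) q +P (0T ∷ (p *P q))

  τ-minus : Edge → PolyT
  τ-minus e = negT (edgeT e) ∷ 1T ∷ []

  Pπ : List Edge → PolyT
  Pπ = foldr (λ e acc → τ-minus e *P acc) (1T ∷ [])

  coeffP : PolyT → ℕ → TE
  coeffP []      _       = 0T
  coeffP (a ∷ p) zero    = a
  coeffP (a ∷ p) (suc i) = coeffP p i

  eπ : List Edge → ℕ → TE
  eπ π j = coeffP (Pπ π) (length π ∸ j)

  record Gen : Set where
    field
      v w    : Vert
      π₁ π₂  : List Edge
      path₁  : IsPath v w π₁
      path₂  : IsPath v w π₂
      k      : ℕ
      1≤k    : 1 ≤ k
      k≤len  : k ≤ length π₁

  genT : Gen → TE
  genT g = eπ π₁ k +T negT (eπ π₂ k)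
    where open Gen g

  -- membership in the two-sided ideal R generated by the genT g:
  -- x is (coefficientwise) a finite sum  Σ c · a · g · b  (a, b words)
  InR : TE → Set (c ⊔ ℓ)
  InR x = Σ (List (Carrier × Word × Gen × Word)) λ L →
            x ≈T concatMap (λ { (k , a , g , b) → scaleT k (wordT a *T (genT g *T wordT b)) }) L

  HomT : ℕ → Set c
  HomT i = List (Carrier × Vec Edge i)

  homToT : ∀ {i} → HomT i → TE
  homToT = map (λ { (a , u) → (a , toList u) })

  linComb : ∀ {i d} → (Fin d → Carrier) → (Fin d → HomT i) → TE
  linComb {d = d} κ b = concatMap (λ j → scaleT (κ j) (homToT (b j))) (allFin d)

  -- dim_F A(Γ)_i = d : there are d homogeneous degree-i elements whose
  -- images in A(Γ) = T(E)/R are linearly independent and span A(Γ)_i.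
  IsDimA : ℕ → ℕ → Set (c ⊔ ℓ)
  IsDimA i d = Σ (Fin d → HomT i) λ b →
      (∀ (κ : Fin d → Carrier) → InR (linComb κ b) → ∀ j → κ j ≈ 0#)
    × (∀ (x : HomT i) → Σ (Fin d → Carrier) λ κ → InR (homToT x +T negT (linComb κ b)))

{-# OPTIONS --safe #-}

-- Let P_v(τ) = P_π(τ) for a path π from v to *; in A(Γ)[τ] it does not depend on π, and P_v = P_π P_w for a
-- path π from v to w.  Letting τ act on sequences in a module X as the shift, P_v becomes a linear recurrence
-- of order |v|, and right divisibility becomes inclusion of solution spaces.  So a representation of A(Γ) on X
-- amounts to a recurrence for every vertex such that the solutions for w are solutions for v whenever v > w.
--
-- Such recurrences are built on the functions on words in the letters (v , i), i < |v|.  Given the terms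
-- f 0 , … , f (|v| - 1), subtract solutions belonging to vertices below v until no word in f i begins with a
-- vertex u < v of level i; the next term of what remains is declared to be the sum of the (v , i) f i.  Acting
-- on the empty word identifies A(Γ) with the span of the normal words, those in which (v , i) is never
-- followed by a letter of a vertex u < v of level i; here (v , i) has degree |v| - i.
--
-- If c_v counts the normal words beginning with v by degree, then removing the first letter gives
-- c_v + Σ_{u < v} t^(|v| - |u|) c_u = (t + ⋯ + t^|v|) h, and this triangular system is solved by a signed sum
-- over the chains starting at v.
module Submission where

open import Level using (Level; _⊔_; 0ℓ)
open import Algebra.Bundles using (Ring; AbelianGroup)
open import Algebra.Module.Bundles using (LeftModule)
import Algebra.Construct.Pointwise as Pointwise
import Algebra.Module.Construct.TensorUnit as TensorUnit
import Algebra.Properties.AbelianGroup as AbelianGroupₚ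
import Algebra.Properties.CommutativeSemigroup as CommSemigroupₚ
import Algebra.Properties.Ring as Ringₚ
open import Data.Empty using (⊥-elim)
open import Data.Fin as Fin using (Fin)
open import Data.Fin.Properties using () renaming (_≟_ to _≟F_)
open import Data.List using (List; []; _∷_; _++_; map; concatMap; filter; length; allFin; deduplicate; upTo; lookup)
import Data.List.Properties as Listₚ
open import Data.List.Membership.Propositional using (_∈_; find; lose)
import Data.List.Membership.Propositional.Properties as ∈ₚ
import Data.List.Membership.DecPropositional as DecMembership
open import Data.List.Relation.Unary.All as All using (All; []; _∷_)
import Data.List.Relation.Unary.All.Properties as Allₚ
open import Data.List.Relation.Unary.AllPairs as AllPairs using (AllPairs; []; _∷_)
import Data.List.Relation.Unary.AllPairs.Properties as AllPairsₚ
open import Data.List.Relation.Unary.Any as Any using (here; there)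
open import Data.List.Relation.Unary.Unique.DecPropositional.Properties using (deduplicate-!)
open import Data.List.Relation.Unary.Unique.Propositional using (Unique)
import Data.List.Relation.Unary.Unique.Propositional.Properties as Uniqueₚ
open import Data.Bool using (if_then_else_)
open import Data.Integer as ℤ using (ℤ; 0ℤ; 1ℤ; -1ℤ)
import Data.Integer.Properties as ℤₚ
import Data.Integer.Solver as ℤSolver
open import Data.List.Relation.Binary.Permutation.Propositional as ↭ using (_↭_)
open import Data.List.Relation.Binary.BagAndSetEquality using (∼bag⇒↭)
open import Data.List.Membership.Propositional.Properties.WithK using (unique∧set⇒bag)
open import Function.Bundles using (mk⇔)
open import Data.Nat as ℕ using (ℕ; zero; suc; _≤_; _<_; z≤n; s≤s; _∸_)
import Data.Nat.Properties as ℕₚ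
open import Data.Product using (_,_; _×_; proj₁; proj₂; Σ)
import Data.Product.Properties as ×ₚ
open import Data.Sum using (_⊎_; inj₁; inj₂)
open import Data.Unit using (⊤; tt)
import Data.Vec as Vec
import Data.Vec.Properties as Vecₚ
open import Relation.Nullary using (¬_; yes; no; Dec; does)
open import Relation.Nullary.Decidable using (_×-dec_; ¬?; map′)
open import Relation.Unary using (Decidable)
open import Relation.Binary.Definitions using () renaming (Decidable to Decidable₂)
open import Relation.Binary.PropositionalEquality as ≡ using (_≡_; _≢_; refl; sym; trans; cong; cong₂; subst)
import Relation.Binary.Reasoning.Setoid as ≈-Reasoning
open import Defs

-- The action on the empty word must be shown to lose nothing and to reach every normal word. A
-- function on words may have infinite support, so it has no image in A(Γ) itself. The map back
-- therefore lands in power series over A(Γ), each edge carrying a factor t: only finitely many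
-- words contribute to a given degree. That map sends the empty word to 1 and commutes with the
-- edges, hence it writes a homogeneous element as a combination of monomials of normal words.
-- Conversely, the monomial of a normal word, applied to the empty word, yields exactly that word.
--
-- The delicate point is the inclusion of solution spaces, since the recurrences are themselves
-- defined by subtracting solutions. The proof is an induction on the level and rests on the order
-- of subtraction: from term |u| on, a solution for u contains no word beginning with another vertex
-- of level at least |u|. With higher levels cleared first, no step spoils an earlier one.
--
-- Equality in F is not assumed decidable, so dimensions are compared through negated inequalities
-- of natural numbers.

module ModuleLemmas {r ℓr a ℓa : Level} {R : Ring r ℓr} (X : LeftModule R a ℓa) where
  open LeftModule X public
  open AbelianGroupₚ +ᴹ-abelianGroup
    using (//-rightDividesˡ; //-rightDividesʳ; ⁻¹-∙-comm; xyx⁻¹≈y; x∙y⁻¹≈ε⇒x≈y; x≈y⇒x∙y⁻¹≈ε; ε⁻¹≈ε; ⁻¹-anti-homo-//; inverseʳ-unique)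
  open AbelianGroup +ᴹ-abelianGroup using (commutativeSemigroup)
  open CommSemigroupₚ commutativeSemigroup using (interchange)
  open Ring R using () renaming (Carrier to K)
  module ≈ᴹ-Reasoning = ≈-Reasoning ≈ᴹ-setoid
  open ≈ᴹ-Reasoning

  infixl 6 _-ᴹ_
  _-ᴹ_ : Carrierᴹ → Carrierᴹ → Carrierᴹ
  x -ᴹ y = x +ᴹ (-ᴹ y)

  -ᴹ-cong : ∀ {x y u v} → x ≈ᴹ y → u ≈ᴹ v → x -ᴹ u ≈ᴹ y -ᴹ v
  -ᴹ-cong p q = +ᴹ-cong p (-ᴹ‿cong q)

  x-x≈0 : ∀ x → x -ᴹ x ≈ᴹ 0ᴹ
  x-x≈0 = -ᴹ‿inverseʳ

  x-0≈x : ∀ x → x -ᴹ 0ᴹ ≈ᴹ x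
  x-0≈x x = ≈ᴹ-trans (+ᴹ-congˡ ε⁻¹≈ε) (+ᴹ-identityʳ x)

  x-y≈0⇒x≈y : ∀ {x y} → x -ᴹ y ≈ᴹ 0ᴹ → x ≈ᴹ y
  x-y≈0⇒x≈y {x} {y} = x∙y⁻¹≈ε⇒x≈y x y

  x≈y⇒x-y≈0 : ∀ {x y} → x ≈ᴹ y → x -ᴹ y ≈ᴹ 0ᴹ
  x≈y⇒x-y≈0 = x≈y⇒x∙y⁻¹≈ε

  x-y+y≈x : ∀ x y → (x -ᴹ y) +ᴹ y ≈ᴹ x
  x-y+y≈x x y = //-rightDividesˡ y x

  x+y-y≈x : ∀ x y → (x +ᴹ y) -ᴹ y ≈ᴹ x
  x+y-y≈x x y = //-rightDividesʳ y x

  x-[x-y]≈y : ∀ x y → x -ᴹ (x -ᴹ y) ≈ᴹ y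
  x-[x-y]≈y x y = begin
    x -ᴹ (x -ᴹ y)     ≈⟨ +ᴹ-congˡ (⁻¹-anti-homo-// x y) ⟩
    x +ᴹ (y -ᴹ x)     ≈⟨ +ᴹ-assoc x y (-ᴹ x) ⟨
    x +ᴹ y -ᴹ x       ≈⟨ xyx⁻¹≈y x y ⟩
    y                 ∎

  +-interchange : ∀ x y u v → (x +ᴹ y) +ᴹ (u +ᴹ v) ≈ᴹ (x +ᴹ u) +ᴹ (y +ᴹ v)
  +-interchange = interchange

  -‿interchange : ∀ x y u v → (x +ᴹ y) -ᴹ (u +ᴹ v) ≈ᴹ (x -ᴹ u) +ᴹ (y -ᴹ v)
  -‿interchange x y u v = begin
    (x +ᴹ y) -ᴹ (u +ᴹ v)               ≈⟨ +ᴹ-congˡ (⁻¹-∙-comm u v) ⟨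
    (x +ᴹ y) +ᴹ ((-ᴹ u) +ᴹ (-ᴹ v)) ≈⟨ interchange x y (-ᴹ u) (-ᴹ v) ⟩
    (x -ᴹ u) +ᴹ (y -ᴹ v)               ∎

  *ₗ-neg : ∀ k x → k *ₗ (-ᴹ x) ≈ᴹ -ᴹ (k *ₗ x)
  *ₗ-neg k x = inverseʳ-unique (k *ₗ x) (k *ₗ (-ᴹ x)) (begin
    k *ₗ x +ᴹ k *ₗ (-ᴹ x)  ≈⟨ *ₗ-distribˡ k x (-ᴹ x) ⟨
    k *ₗ (x -ᴹ x)          ≈⟨ *ₗ-congˡ (x-x≈0 x) ⟩
    k *ₗ 0ᴹ                ≈⟨ *ₗ-zeroʳ k ⟩
    0ᴹ                     ∎)

  *ₗ-distribˡ-- : ∀ k x y → k *ₗ (x -ᴹ y) ≈ᴹ k *ₗ x -ᴹ k *ₗ y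
  *ₗ-distribˡ-- k x y = ≈ᴹ-trans (*ₗ-distribˡ k x (-ᴹ y)) (+ᴹ-congˡ (*ₗ-neg k y))

  +0≈ : ∀ {x y} → y ≈ᴹ 0ᴹ → x +ᴹ y ≈ᴹ x
  +0≈ p = ≈ᴹ-trans (+ᴹ-congˡ p) (+ᴹ-identityʳ _)

  0+≈ : ∀ {x y} → x ≈ᴹ 0ᴹ → x +ᴹ y ≈ᴹ y
  0+≈ p = ≈ᴹ-trans (+ᴹ-congʳ p) (+ᴹ-identityˡ _)

  -0≈ : ∀ {x y} → y ≈ᴹ 0ᴹ → x -ᴹ y ≈ᴹ x
  -0≈ p = ≈ᴹ-trans (-ᴹ-cong ≈ᴹ-refl p) (x-0≈x _)

  0+0≈0 : ∀ {x y} → x ≈ᴹ 0ᴹ → y ≈ᴹ 0ᴹ → x +ᴹ y ≈ᴹ 0ᴹ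
  0+0≈0 p q = ≈ᴹ-trans (+0≈ q) p

  0-0≈0 : ∀ {x y} → x ≈ᴹ 0ᴹ → y ≈ᴹ 0ᴹ → x -ᴹ y ≈ᴹ 0ᴹ
  0-0≈0 p q = ≈ᴹ-trans (-0≈ q) p

  *0≈0 : ∀ {k x} → x ≈ᴹ 0ᴹ → k *ₗ x ≈ᴹ 0ᴹ
  *0≈0 {k} p = ≈ᴹ-trans (*ₗ-congˡ p) (*ₗ-zeroʳ k)

  ∑ : ∀ {i} {I : Set i} → List I → (I → Carrierᴹ) → Carrierᴹ
  ∑ []       f = 0ᴹ
  ∑ (i ∷ is) f = f i +ᴹ ∑ is f

  ∑-cong : ∀ {i} {I : Set i} (is : List I) {f g : I → Carrierᴹ} → (∀ j → f j ≈ᴹ g j) → ∑ is f ≈ᴹ ∑ is g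
  ∑-cong []       p = ≈ᴹ-refl
  ∑-cong (i ∷ is) p = +ᴹ-cong (p i) (∑-cong is p)

  ∑-cong-∈ : ∀ {i} {I : Set i} (is : List I) {f g : I → Carrierᴹ} → (∀ {j} → j ∈ is → f j ≈ᴹ g j) → ∑ is f ≈ᴹ ∑ is g
  ∑-cong-∈ []       p = ≈ᴹ-refl
  ∑-cong-∈ (i ∷ is) p = +ᴹ-cong (p (here refl)) (∑-cong-∈ is (λ j∈ → p (there j∈)))

  ∑-↭ : ∀ {i} {I : Set i} {is js : List I} → is ↭ js → (f : I → Carrierᴹ) → ∑ is f ≈ᴹ ∑ js f
  ∑-↭ ↭.refl         f = ≈ᴹ-refl
  ∑-↭ (↭.prep x p)   f = +ᴹ-congˡ (∑-↭ p f)
  ∑-↭ (↭.swap x y p) f = ≈ᴹ-trans (≈ᴹ-sym (+ᴹ-assoc _ _ _))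
    (≈ᴹ-trans (+ᴹ-cong (+ᴹ-comm (f x) (f y)) (∑-↭ p f)) (+ᴹ-assoc _ _ _))
  ∑-↭ (↭.trans p q)  f = ≈ᴹ-trans (∑-↭ p f) (∑-↭ q f)

  ∑-zero : ∀ {i} {I : Set i} (is : List I) {f : I → Carrierᴹ} → (∀ j → f j ≈ᴹ 0ᴹ) → ∑ is f ≈ᴹ 0ᴹ
  ∑-zero []       p = ≈ᴹ-refl
  ∑-zero (i ∷ is) p = 0+0≈0 (p i) (∑-zero is p)

  ∑-+ : ∀ {i} {I : Set i} (is : List I) (f g : I → Carrierᴹ) → ∑ is (λ j → f j +ᴹ g j) ≈ᴹ ∑ is f +ᴹ ∑ is g
  ∑-+ []       f g = ≈ᴹ-sym (+ᴹ-identityˡ 0ᴹ)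
  ∑-+ (i ∷ is) f g = ≈ᴹ-trans (+ᴹ-congˡ (∑-+ is f g)) (interchange _ _ _ _)

  ∑-* : ∀ {i} {I : Set i} (is : List I) (k : K) (f : I → Carrierᴹ) → ∑ is (λ j → k *ₗ f j) ≈ᴹ k *ₗ ∑ is f
  ∑-* []       k f = ≈ᴹ-sym (*ₗ-zeroʳ k)
  ∑-* (i ∷ is) k f = ≈ᴹ-trans (+ᴹ-congˡ (∑-* is k f)) (≈ᴹ-sym (*ₗ-distribˡ k _ _))

  ∑-sub : ∀ {i} {I : Set i} (is : List I) (f g : I → Carrierᴹ) → ∑ is (λ j → f j -ᴹ g j) ≈ᴹ ∑ is f -ᴹ ∑ is g
  ∑-sub []       f g = ≈ᴹ-sym (x-x≈0 0ᴹ)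
  ∑-sub (i ∷ is) f g = ≈ᴹ-trans (+ᴹ-congˡ (∑-sub is f g)) (≈ᴹ-sym (-‿interchange _ _ _ _))

  ∑-zero-∈ : ∀ {i} {I : Set i} (is : List I) {f : I → Carrierᴹ} → (∀ {j} → j ∈ is → f j ≈ᴹ 0ᴹ) → ∑ is f ≈ᴹ 0ᴹ
  ∑-zero-∈ []       p = ≈ᴹ-refl
  ∑-zero-∈ (i ∷ is) p = 0+0≈0 (p (here refl)) (∑-zero-∈ is (λ j∈ → p (there j∈)))

  ∑-++ : ∀ {i} {I : Set i} (is js : List I) (f : I → Carrierᴹ) → ∑ (is ++ js) f ≈ᴹ ∑ is f +ᴹ ∑ js f
  ∑-++ []       js f = ≈ᴹ-sym (+ᴹ-identityˡ _)
  ∑-++ (i ∷ is) js f = ≈ᴹ-trans (+ᴹ-congˡ (∑-++ is js f)) (≈ᴹ-sym (+ᴹ-assoc _ _ _))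

  ∑-map : ∀ {i j} {I : Set i} {J : Set j} (g : J → I) (js : List J) (f : I → Carrierᴹ) →
    ∑ (map g js) f ≈ᴹ ∑ js (λ j → f (g j))
  ∑-map g []       f = ≈ᴹ-refl
  ∑-map g (j ∷ js) f = +ᴹ-congˡ (∑-map g js f)

  ∑-concatMap : ∀ {i j} {I : Set i} {J : Set j} (g : J → List I) (js : List J) (f : I → Carrierᴹ) →
    ∑ (concatMap g js) f ≈ᴹ ∑ js (λ j → ∑ (g j) f)
  ∑-concatMap g []       f = ≈ᴹ-refl
  ∑-concatMap g (j ∷ js) f = ≈ᴹ-trans (∑-++ (g j) (concatMap g js) f) (+ᴹ-congˡ (∑-concatMap g js f))

  ∑-swap : ∀ {i j} {I : Set i} {J : Set j} (is : List I) (js : List J) (f : I → J → Carrierᴹ) →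
    ∑ is (λ i → ∑ js (f i)) ≈ᴹ ∑ js (λ j → ∑ is (λ i → f i j))
  ∑-swap []       js f = ≈ᴹ-sym (∑-zero js (λ _ → ≈ᴹ-refl))
  ∑-swap (i ∷ is) js f = ≈ᴹ-trans (+ᴹ-congˡ (∑-swap is js f)) (≈ᴹ-sym (∑-+ js (f i) _))

  ∑-filter : ∀ {i p} {I : Set i} {P : I → Set p} (P? : Decidable P) (is : List I) (f : I → Carrierᴹ) →
    (∀ j → ¬ P j → f j ≈ᴹ 0ᴹ) → ∑ is f ≈ᴹ ∑ (filter P? is) f
  ∑-filter P? []       f z = ≈ᴹ-refl
  ∑-filter P? (i ∷ is) f z with P? i
  ... | yes _  = +ᴹ-congˡ (∑-filter P? is f z)
  ... | no  ¬p = ≈ᴹ-trans (0+≈ (z i ¬p)) (∑-filter P? is f z)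

  ∑-single : ∀ {i} {I : Set i} (is : List I) → Unique is → ∀ {j} → j ∈ is → (f : I → Carrierᴹ) →
    (∀ k → k ≢ j → f k ≈ᴹ 0ᴹ) → ∑ is f ≈ᴹ f j
  ∑-single (i ∷ is) (i∉ ∷ u) {j} (here refl) f z = +0≈ (off is i∉)
    where
    off : ∀ is → All (j ≢_) is → ∑ is f ≈ᴹ 0ᴹ
    off []       []       = ≈ᴹ-refl
    off (i ∷ is) (p ∷ ps) = 0+0≈0 (z i (λ q → p (sym q))) (off is ps)
  ∑-single (i ∷ is) (i∉ ∷ u) {j} (there j∈) f z =
    ≈ᴹ-trans (0+≈ (z i (All.lookup i∉ j∈))) (∑-single is u j∈ f z)

-- Modules of functions and linear maps

module _ {r ℓr : Level} (R : Ring r ℓr) where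
  open Ring R using () renaming (Carrier to K)

  power : ∀ {i a ℓa} (I : Set i) → LeftModule R a ℓa → LeftModule R (i ⊔ a) (i ⊔ ℓa)
  power I X = record
    { Carrierᴹ     = I → Carrierᴹ
    ; _≈ᴹ_         = λ f g → ∀ i → f i ≈ᴹ g i
    ; _+ᴹ_         = λ f g i → f i +ᴹ g i
    ; _*ₗ_         = λ k f i → k *ₗ f i
    ; 0ᴹ           = λ _ → 0ᴹ
    ; -ᴹ_          = λ f i → -ᴹ f i
    ; isLeftModule = record
      { isLeftSemimodule = record
        { +ᴹ-isCommutativeMonoid = Pointwise.isCommutativeMonoid I +ᴹ-isCommutativeMonoid
        ; isPreleftSemimodule    = record
          { *ₗ-cong      = λ p q i → *ₗ-cong p (q i)
          ; *ₗ-zeroˡ     = λ f i → *ₗ-zeroˡ (f i)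
          ; *ₗ-distribʳ  = λ f k l i → *ₗ-distribʳ (f i) k l
          ; *ₗ-identityˡ = λ f i → *ₗ-identityˡ (f i)
          ; *ₗ-assoc     = λ k l f i → *ₗ-assoc k l (f i)
          ; *ₗ-zeroʳ     = λ k i → *ₗ-zeroʳ k
          ; *ₗ-distribˡ  = λ k f g i → *ₗ-distribˡ k (f i) (g i)
          }
        }
      ; -ᴹ‿cong    = λ p i → -ᴹ‿cong (p i)
      ; -ᴹ‿inverse = (λ f i → -ᴹ‿inverseˡ (f i)) , (λ f i → -ᴹ‿inverseʳ (f i))
      }
    }
    where open LeftModule X

  module _ {a ℓa b ℓb : Level} (X : LeftModule R a ℓa) (Y : LeftModule R b ℓb) where
    private
      module X = ModuleLemmas X
      module Y = ModuleLemmas Y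

    record IsLinear (f : X.Carrierᴹ → Y.Carrierᴹ) : Set (r ⊔ a ⊔ ℓa ⊔ ℓb) where
      field
        resp   : ∀ {x y} → x X.≈ᴹ y → f x Y.≈ᴹ f y
        +-homo : ∀ x y → f (x X.+ᴹ y) Y.≈ᴹ f x Y.+ᴹ f y
        *-homo : ∀ k x → f (k X.*ₗ x) Y.≈ᴹ k Y.*ₗ f x

      0-homo : f X.0ᴹ Y.≈ᴹ Y.0ᴹ
      0-homo = begin
        f X.0ᴹ             ≈⟨ resp (X.*ₗ-zeroˡ X.0ᴹ) ⟨
        f (0# X.*ₗ X.0ᴹ)   ≈⟨ *-homo 0# X.0ᴹ ⟩
        0# Y.*ₗ f X.0ᴹ     ≈⟨ Y.*ₗ-zeroˡ (f X.0ᴹ) ⟩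
        Y.0ᴹ               ∎
        where
        open Y.≈ᴹ-Reasoning
        open Ring R using (0#)

      ≈0-homo : ∀ {x} → x X.≈ᴹ X.0ᴹ → f x Y.≈ᴹ Y.0ᴹ
      ≈0-homo p = Y.≈ᴹ-trans (resp p) 0-homo

      -‿homo : ∀ x y → f (x X.-ᴹ y) Y.≈ᴹ f x Y.-ᴹ f y
      -‿homo x y = begin
        f (x X.-ᴹ y)                      ≈⟨ Y.x+y-y≈x _ (f y) ⟨
        (f (x X.-ᴹ y) Y.+ᴹ f y) Y.-ᴹ f y ≈⟨ Y.-ᴹ-cong (+-homo (x X.-ᴹ y) y) Y.≈ᴹ-refl ⟨
        f ((x X.-ᴹ y) X.+ᴹ y) Y.-ᴹ f y ≈⟨ Y.-ᴹ-cong (resp (X.x-y+y≈x x y)) Y.≈ᴹ-refl ⟩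
        f x Y.-ᴹ f y                      ∎
        where open Y.≈ᴹ-Reasoning

      ∑-homo : ∀ {i} {I : Set i} (is : List I) (g : I → X.Carrierᴹ) → f (X.∑ is g) Y.≈ᴹ Y.∑ is (λ j → f (g j))
      ∑-homo []       g = 0-homo
      ∑-homo (i ∷ is) g = Y.≈ᴹ-trans (+-homo (g i) _) (Y.+ᴹ-congˡ (∑-homo is g))

  module _ {a ℓa b ℓb : Level} (X : LeftModule R a ℓa) (Y : LeftModule R b ℓb) where
    private
      module X = ModuleLemmas X
      module Y = ModuleLemmas Y

    zero-linear : IsLinear X Y (λ _ → Y.0ᴹ)
    zero-linear = record
      { resp   = λ _ → Y.≈ᴹ-refl
      ; +-homo = λ _ _ → Y.≈ᴹ-sym (Y.+ᴹ-identityˡ Y.0ᴹ)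
      ; *-homo = λ k _ → Y.≈ᴹ-sym (Y.*ₗ-zeroʳ k)
      }

    add-linear : ∀ {f g} → IsLinear X Y f → IsLinear X Y g → IsLinear X Y (λ x → f x Y.+ᴹ g x)
    add-linear F G = record
      { resp   = λ p → Y.+ᴹ-cong (F.resp p) (G.resp p)
      ; +-homo = λ x y → Y.≈ᴹ-trans (Y.+ᴹ-cong (F.+-homo x y) (G.+-homo x y)) (Y.+-interchange _ _ _ _)
      ; *-homo = λ k x → Y.≈ᴹ-trans (Y.+ᴹ-cong (F.*-homo k x) (G.*-homo k x)) (Y.≈ᴹ-sym (Y.*ₗ-distribˡ k _ _))
      }
      where
      module F = IsLinear F
      module G = IsLinear G

    sub-linear : ∀ {f g} → IsLinear X Y f → IsLinear X Y g → IsLinear X Y (λ x → f x Y.-ᴹ g x)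
    sub-linear F G = record
      { resp   = λ p → Y.-ᴹ-cong (F.resp p) (G.resp p)
      ; +-homo = λ x y → Y.≈ᴹ-trans (Y.-ᴹ-cong (F.+-homo x y) (G.+-homo x y)) (Y.-‿interchange _ _ _ _)
      ; *-homo = λ k x → Y.≈ᴹ-trans (Y.-ᴹ-cong (F.*-homo k x) (G.*-homo k x)) (Y.≈ᴹ-sym (Y.*ₗ-distribˡ-- k _ _))
      }
      where
      module F = IsLinear F
      module G = IsLinear G

    ∑-linear : ∀ {i} {I : Set i} (is : List I) {f : I → X.Carrierᴹ → Y.Carrierᴹ} →
      (∀ j → IsLinear X Y (f j)) → IsLinear X Y (λ x → Y.∑ is (λ j → f j x))
    ∑-linear []       F = zero-linear
    ∑-linear (i ∷ is) F = add-linear (F i) (∑-linear is F)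

  module _ {a ℓa : Level} (X : LeftModule R a ℓa) where
    private module X = ModuleLemmas X

    id-linear : IsLinear X X (λ x → x)
    id-linear = record
      { resp = λ p → p ; +-homo = λ _ _ → X.≈ᴹ-refl ; *-homo = λ _ _ → X.≈ᴹ-refl }

    module _ {i : Level} {I : Set i} where
      eval-linear : (j : I) → IsLinear (power I X) X (λ f → f j)
      eval-linear j = record
        { resp = λ p → p j ; +-homo = λ _ _ → X.≈ᴹ-refl ; *-homo = λ _ _ → X.≈ᴹ-refl }

      reindex-linear : ∀ {k} {J : Set k} (g : J → I) → IsLinear (power I X) (power J X) (λ f j → f (g j))
      reindex-linear g = record
        { resp = λ p j → p (g j) ; +-homo = λ _ _ _ → X.≈ᴹ-refl ; *-homo = λ _ _ _ → X.≈ᴹ-refl }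

  module _ {a ℓa b ℓb : Level} (X : LeftModule R a ℓa) (Y : LeftModule R b ℓb) where
    private
      module X = ModuleLemmas X
      module Y = ModuleLemmas Y

    pointwise-linear : ∀ {i} {I : Set i} {f : I → X.Carrierᴹ → Y.Carrierᴹ} →
      (∀ j → IsLinear X Y (f j)) → IsLinear X (power I Y) (λ x j → f j x)
    pointwise-linear F = record
      { resp   = λ p j → IsLinear.resp (F j) p
      ; +-homo = λ x y j → IsLinear.+-homo (F j) x y
      ; *-homo = λ k x j → IsLinear.*-homo (F j) k x
      }

    ∘-linear : ∀ {c ℓc} (Z : LeftModule R c ℓc) {g : Y.Carrierᴹ → LeftModule.Carrierᴹ Z} {f : X.Carrierᴹ → Y.Carrierᴹ} →
      IsLinear Y Z g → IsLinear X Y f → IsLinear X Z (λ x → g (f x))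
    ∘-linear Z G F = record
      { resp   = λ p → G.resp (F.resp p)
      ; +-homo = λ x y → Z.≈ᴹ-trans (G.resp (F.+-homo x y)) (G.+-homo _ _)
      ; *-homo = λ k x → Z.≈ᴹ-trans (G.resp (F.*-homo k x)) (G.*-homo k _)
      }
      where
      module Z = LeftModule Z
      module F = IsLinear F
      module G = IsLinear G

Endo : ∀ {r ℓr a ℓa} {R : Ring r ℓr} → LeftModule R a ℓa → Set a
Endo X = LeftModule.Carrierᴹ X → LeftModule.Carrierᴹ X

-- Sequences, recurrences and paths

module Sequences {r ℓr a ℓa : Level} {R : Ring r ℓr} (X : LeftModule R a ℓa) where
  open ModuleLemmas X
  private
    S = power R ℕ X
    module S = ModuleLemmas S

  Seq : Set a
  Seq = ℕ → Carrierᴹ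

  shift : ℕ → Seq → Seq
  shift k f i = f (k ℕ.+ i)

  single : ℕ → Carrierᴹ → Seq
  single i x j with j ℕ.≟ i
  ... | yes _ = x
  ... | no  _ = 0ᴹ

  single-≡ : ∀ i x → single i x i ≈ᴹ x
  single-≡ i x with i ℕ.≟ i
  ... | yes _   = ≈ᴹ-refl
  ... | no  i≢i = ⊥-elim (i≢i refl)

  single-≢ : ∀ i j x → j ≢ i → single i x j ≈ᴹ 0ᴹ
  single-≢ i j x j≢i with j ℕ.≟ i
  ... | yes j≡i = ⊥-elim (j≢i j≡i)
  ... | no  _   = ≈ᴹ-refl

  single-suc : ∀ i x j → single (suc i) x (suc j) ≈ᴹ single i x j
  single-suc i x j with j ℕ.≟ i
  ... | yes refl = single-≡ (suc i) x
  ... | no  j≢i    = single-≢ (suc i) (suc j) x (λ p → j≢i (ℕₚ.suc-injective p))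

  single-linear : ∀ i → IsLinear R X S (single i)
  single-linear i = pointwise-linear R X X at
    where
    at : ∀ j → IsLinear R X X (λ x → single i x j)
    at j with j ℕ.≟ i
    ... | yes _ = id-linear R X
    ... | no  _ = zero-linear R X X

  shift-linear : ∀ k → IsLinear R S S (shift k)
  shift-linear k = reindex-linear R X (k ℕ.+_)

  shift-shift : ∀ j k f → shift j (shift k f) S.≈ᴹ shift (k ℕ.+ j) f
  shift-shift j k f i = ≈ᴹ-reflexive (cong f (sym (ℕₚ.+-assoc k j i)))

  -- A linear functional on sequences whose dependence on the n-th term is the identity: an
  -- inhomogeneous linear recurrence  f n = next f + Ψ f  of order n with operator coefficients,
  -- i.e. a monic polynomial of degree n over End X.
  record Recurrence (n : ℕ) : Set (r ⊔ a ⊔ ℓa) where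
    field
      Ψ        : Seq → Carrierᴹ
      Ψ-linear : IsLinear R S X Ψ
      Ψ-monic  : ∀ {f} → (∀ i → i < n → f i ≈ᴹ 0ᴹ) → Ψ f ≈ᴹ f n

    module Ψ = IsLinear Ψ-linear

    next : Seq → Carrierᴹ
    next f = f n -ᴹ Ψ f

    next-linear : IsLinear R S X next
    next-linear = sub-linear R S X (eval-linear R X n) Ψ-linear

    module Next = IsLinear next-linear

    -- By linearity only `f - g` matters, and its first n terms vanish. There monicity turns `Ψ`
    -- into reading term n, which `next` subtracts from itself.
    next-local : ∀ {f g} → (∀ i → i < n → f i ≈ᴹ g i) → next f ≈ᴹ next g
    next-local {f} {g} f≈g = x-y≈0⇒x≈y (begin
      next f -ᴹ next g                    ≈⟨ Next.-‿homo f g ⟨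
      (f n -ᴹ g n) -ᴹ Ψ (f S.-ᴹ g) ≈⟨ -ᴹ-cong ≈ᴹ-refl (Ψ-monic (λ i i<n → x≈y⇒x-y≈0 (f≈g i i<n))) ⟩
      (f n -ᴹ g n) -ᴹ (f n -ᴹ g n)        ≈⟨ x-x≈0 _ ⟩
      0ᴹ                                  ∎)
      where open ≈ᴹ-Reasoning

    -- For i < n the operator sending x to `next (single i x)` is minus the coefficient of τ^i; this
    -- is the recurrence written out by its coefficients. The letters of words will stand for these
    -- operators.
    next-expand : ∀ f → next f ≈ᴹ ∑ (upTo n) (λ i → next (single i (f i)))
    next-expand f = ≈ᴹ-trans
      (next-local λ j j<n → ≈ᴹ-sym (begin
        S.∑ (upTo n) (λ i → single i (f i)) j ≈⟨ IsLinear.∑-homo (eval-linear R X j) (upTo n) (λ i → single i (f i)) ⟩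
        ∑ (upTo n) (λ i → single i (f i) j) ≈⟨ ∑-single (upTo n) (Uniqueₚ.upTo⁺ n) (∈ₚ.∈-upTo⁺ j<n) (λ i → single i (f i) j)
            (λ i i≢j → single-≢ i j (f i) (λ p → i≢j (sym p))) ⟩
        single j (f j) j                          ≈⟨ single-≡ j (f j) ⟩
        f j                                       ∎))
      (Next.∑-homo (upTo n) (λ i → single i (f i)))
      where open ≈ᴹ-Reasoning

    Solution : Seq → Set ℓa
    Solution f = ∀ k → Ψ (shift k f) ≈ᴹ 0ᴹ

    solution⇒next : ∀ {f} → Ψ f ≈ᴹ 0ᴹ → f n ≈ᴹ next f
    solution⇒next p = ≈ᴹ-sym (-0≈ p)

    solution-shift : ∀ f → Solution f → ∀ k → Solution (shift k f)
    solution-shift f s k j = ≈ᴹ-trans (Ψ.resp (shift-shift j k f)) (s (k ℕ.+ j))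

    zero-unique : ∀ {f} → (∀ i → i < n → f i ≈ᴹ 0ᴹ) → Solution f → ∀ i → f i ≈ᴹ 0ᴹ
    zero-unique {f} init s i = below (suc i) i ℕₚ.≤-refl
      where
      below : ∀ m i → i < m → f i ≈ᴹ 0ᴹ
      below (suc m) i i<1+m with ℕₚ.m≤n⇒m<n∨m≡n (ℕₚ.≤-pred i<1+m)
      ... | inj₁ i<m = below m i i<m
      ... | inj₂ refl with i ℕ.<? n
      ...   | yes i<n = init i i<n
      ...   | no  i≮n = begin
        f i                    ≡⟨ cong f (ℕₚ.m∸n+n≡m n≤i) ⟨
        f ((i ∸ n) ℕ.+ n) ≈⟨ Ψ-monic (λ j j<n → below i _ (subst ((i ∸ n) ℕ.+ j <_) (ℕₚ.m∸n+n≡m n≤i) (ℕₚ.+-monoʳ-< (i ∸ n) j<n))) ⟨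
        Ψ (shift (i ∸ n) f)    ≈⟨ s (i ∸ n) ⟩
        0ᴹ                     ∎
        where
        open ≈ᴹ-Reasoning
        n≤i = ℕₚ.≮⇒≥ i≮n

    unique : ∀ {f g} → (∀ i → i < n → f i ≈ᴹ g i) → (∀ k → Ψ (shift k f) ≈ᴹ Ψ (shift k g)) → f S.≈ᴹ g
    unique {f} {g} init p i = x-y≈0⇒x≈y (zero-unique
      (λ j j<n → x≈y⇒x-y≈0 (init j j<n))
      (λ k → ≈ᴹ-trans (Ψ.-‿homo (shift k f) (shift k g)) (x≈y⇒x-y≈0 (p k))) i)

    module _ (g y : Seq) where
      private
        -- Stage k is final at positions below k + n. The passage to stage k + 1 alters position k +
        -- n only, so as to give `Ψ` of the shift by k its prescribed value `y k`.
        approx : ℕ → Seq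
        approx zero    j = g j
        approx (suc k) j with j ℕ.≟ k ℕ.+ n
        ... | yes _ = y k +ᴹ next (shift k (approx k))
        ... | no  _ = approx k j

        approx-suc : ∀ k j → j < k ℕ.+ n → approx (suc k) j ≡ approx k j
        approx-suc k j j<k+n with j ℕ.≟ k ℕ.+ n
        ... | yes refl = ⊥-elim (ℕₚ.<-irrefl refl j<k+n)
        ... | no  _      = refl

        approx-new : ∀ k → approx (suc k) (k ℕ.+ n) ≡ y k +ᴹ next (shift k (approx k))
        approx-new k with k ℕ.+ n ℕ.≟ k ℕ.+ n
        ... | yes _ = refl
        ... | no ≢  = ⊥-elim (≢ refl)

        approx-+ : ∀ m k j → j < k ℕ.+ n → approx (m ℕ.+ k) j ≡ approx k j
        approx-+ zero    k j p = refl
        approx-+ (suc m) k j p =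
          trans (approx-suc (m ℕ.+ k) j (ℕₚ.<-≤-trans p (ℕₚ.+-monoˡ-≤ n (ℕₚ.m≤n+m k m)))) (approx-+ m k j p)

      solve : Seq
      -- Stage `suc i` is final at position i even for n = 0, where stage i would be too early.
      solve i = approx (suc i) i

      private
        solve≡approx : ∀ k j → j < k ℕ.+ n → solve j ≡ approx k j
        solve≡approx k j p = trans
          (sym (approx-+ k (suc j) j (s≤s (ℕₚ.m≤m+n j n))))
          (trans (cong (λ m → approx m j) (ℕₚ.+-comm k (suc j))) (approx-+ (suc j) k j p))

      solve-init : ∀ i → i < n → solve i ≈ᴹ g i
      solve-init i i<n = ≈ᴹ-reflexive (solve≡approx 0 i i<n)

      solve-Ψ : ∀ k → Ψ (shift k solve) ≈ᴹ y k
      solve-Ψ k = begin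
        Ψ f                        ≈⟨ x-[x-y]≈y (f n) (Ψ f) ⟨
        f n -ᴹ next f              ≈⟨ -ᴹ-cong top ≈ᴹ-refl ⟩
        (y k +ᴹ next f) -ᴹ next f  ≈⟨ x+y-y≈x (y k) (next f) ⟩
        y k                        ∎
        where
        open ≈ᴹ-Reasoning
        f = shift k solve
        top : f n ≈ᴹ y k +ᴹ next f
        top = begin
          solve (k ℕ.+ n) ≡⟨ solve≡approx (suc k) (k ℕ.+ n) (s≤s ℕₚ.≤-refl) ⟩
          approx (suc k) (k ℕ.+ n)            ≡⟨ approx-new k ⟩
          y k +ᴹ next (shift k (approx k)) ≈⟨ +ᴹ-congˡ (next-local (λ j j<n → ≈ᴹ-reflexive (sym (solve≡approx k (k ℕ.+ j) (ℕₚ.+-monoʳ-< k j<n))))) ⟩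
          y k +ᴹ next f                       ∎

    extend : Seq → Seq
    extend g = solve g S.0ᴹ

    extend-init : ∀ g i → i < n → extend g i ≈ᴹ g i
    extend-init g = solve-init g S.0ᴹ

    extend-solution : ∀ g → Solution (extend g)
    extend-solution g = solve-Ψ g S.0ᴹ

    extend-unique : ∀ {f} g → (∀ i → i < n → g i ≈ᴹ f i) → Solution f → extend g S.≈ᴹ f
    extend-unique g p s = unique
      (λ i i<n → ≈ᴹ-trans (extend-init g i i<n) (p i i<n))
      (λ k → ≈ᴹ-trans (extend-solution g k) (≈ᴹ-sym (s k)))

    extend-fixed : ∀ f → Solution f → extend f S.≈ᴹ f
    extend-fixed f = extend-unique f (λ _ _ → ≈ᴹ-refl)

    extend-local : ∀ {f g} → (∀ i → i < n → f i ≈ᴹ g i) → extend f S.≈ᴹ extend g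
    extend-local {f} {g} p =
      extend-unique f (λ i i<n → ≈ᴹ-trans (p i i<n) (≈ᴹ-sym (extend-init g i i<n))) (extend-solution g)

    extend-linear : IsLinear R S S extend
    extend-linear = record
      { resp   = λ p → extend-local (λ i _ → p i)
      ; +-homo = λ f g → extend-unique (f S.+ᴹ g)
          (λ i i<n → ≈ᴹ-sym (+ᴹ-cong (extend-init f i i<n) (extend-init g i i<n)))
          (λ k → ≈ᴹ-trans (Ψ.+-homo _ _) (0+0≈0 (extend-solution f k) (extend-solution g k)))
      ; *-homo = λ c f → extend-unique (c S.*ₗ f)
          (λ i i<n → ≈ᴹ-sym (*ₗ-congˡ (extend-init f i i<n)))
          (λ k → ≈ᴹ-trans (Ψ.*-homo _ _) (*0≈0 (extend-solution f k)))
      }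

    extend-late : ∀ f {m} → n ≤ m → extend f m ≈ᴹ next (shift (m ∸ n) (extend f))
    extend-late f {m} n≤m = ≈ᴹ-trans
      (≈ᴹ-reflexive (cong (extend f) (sym (ℕₚ.m∸n+n≡m n≤m))))
      (solution⇒next (extend-solution f (m ∸ n)))

    extend-next : ∀ f → extend f n ≈ᴹ next f
    extend-next f = ≈ᴹ-trans (solution⇒next (extend-solution f 0)) (next-local (extend-init f))

module Paths {r ℓr a ℓa : Level} {R : Ring r ℓr} (X : LeftModule R a ℓa) {nE : ℕ}
    (edge : Fin nE → Endo X)
    (edge-linear : ∀ e → IsLinear R X X (edge e)) where
  open ModuleLemmas X
  open Sequences X
  private
    S = power R ℕ X

  -- The value at 0 of (σ - e₁)⋯(σ - eₘ) f, where σ is the shift of sequences.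
  Φ : List (Fin nE) → Seq → Carrierᴹ
  Φ []      f = f 0
  Φ (e ∷ π) f = Φ π (shift 1 f) -ᴹ edge e (Φ π f)

  Φ-linear : ∀ π → IsLinear R S X (Φ π)
  Φ-linear []      = eval-linear R X 0
  Φ-linear (e ∷ π) = sub-linear R S X
    (∘-linear R S S X (Φ-linear π) (shift-linear 1))
    (∘-linear R S X X (edge-linear e) (Φ-linear π))

  Φ-monic : ∀ π {f} → (∀ i → i < length π → f i ≈ᴹ 0ᴹ) → Φ π f ≈ᴹ f (length π)
  Φ-monic []      z = ≈ᴹ-refl
  Φ-monic (e ∷ π) z = ≈ᴹ-trans
    (-0≈ (IsLinear.≈0-homo (edge-linear e)
      (≈ᴹ-trans (Φ-monic π (λ i i<n → z i (ℕₚ.m≤n⇒m≤1+n i<n))) (z (length π) ℕₚ.≤-refl))))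
    (Φ-monic π (λ i i<n → z (suc i) (s≤s i<n)))

  Φ-++ : ∀ π σ f → Φ (π ++ σ) f ≈ᴹ Φ π (λ i → Φ σ (shift i f))
  Φ-++ []      σ f = ≈ᴹ-refl
  Φ-++ (e ∷ π) σ f = -ᴹ-cong (Φ-++ π σ (shift 1 f)) (IsLinear.resp (edge-linear e) (Φ-++ π σ f))

-- Normal words and the representation on functions of words

module GraphLemmas (Γ : Graph) where
  open GraphNotions Γ public

  path-++ : ∀ {v w z} π σ → IsPath v w π → IsPath w z σ → IsPath v z (π ++ σ)
  path-++ []      σ refl q    = q
  path-++ (e ∷ π) σ (p , ps) q = p , path-++ π σ ps q

  path-level : ∀ {v w} π → IsPath v w π → level v ≡ length π ℕ.+ level w
  path-level []      refl   = refl
  path-level (e ∷ π) (refl , p) = trans (layered e) (cong suc (path-level π p))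

  >V⇒level : ∀ {v w} → v >V w → level w < level v
  >V⇒level {v} {w} (π , 1≤m , p) = subst (level w <_) (sym (path-level π p)) (ℕₚ.+-monoˡ-≤ (level w) 1≤m)

  >V-trans : ∀ {v w z} → v >V w → w >V z → v >V z
  >V-trans (π , 1≤m , p) (σ , _ , q) =
    π ++ σ , ℕₚ.≤-trans (ℕₚ.≤-trans 1≤m (ℕₚ.m≤m+n _ _)) (ℕₚ.≤-reflexive (sym (Listₚ.length-++ π))) , path-++ π σ p q

  tl>hd : ∀ e → tl e >V hd e
  tl>hd e = e ∷ [] , s≤s z≤n , refl , refl

concatMap-unique : ∀ {a b} {A : Set a} {B : Set b} {f : A → List B} {xs} → Unique xs → (∀ x → Unique (f x)) →
  (∀ {x y z} → z ∈ f x → z ∈ f y → x ≡ y) → Unique (concatMap f xs)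
concatMap-unique {xs = []}     []       uf inj = []
concatMap-unique {f = f} {xs = x ∷ xs} (x∉ ∷ u) uf inj =
  Uniqueₚ.++⁺ (uf x) (concatMap-unique u uf inj) λ { (z∈₁ , z∈₂) → disjoint x∉ z∈₁ z∈₂ }
  where
  disjoint : ∀ {xs z} → All (x ≢_) xs → z ∈ f x → ¬ z ∈ concatMap f xs
  disjoint {y ∷ ys} (x≢y ∷ x∉) z∈₁ z∈₂ with ∈ₚ.∈-++⁻ (f y) z∈₂
  ... | inj₁ z∈y = x≢y (inj z∈₁ z∈y)
  ... | inj₂ z∈  = disjoint x∉ z∈₁ z∈

module NormalWords (Γ : Graph) (_>?_ : Decidable₂ (GraphNotions._>V_ Γ)) where
  open GraphLemmas Γ

  -- Weak in the level: within one level the order in which vertices are cleared is immaterial.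
  Above : Vert → Vert → Set
  Above a u = level u ≤ level a × a ≢ u

  -- The levels descend along the list, which is the order in which the reduction has to clear
  -- vertices.
  below : ℕ → List Vert
  below zero    = []
  below (suc n) = filter (λ u → level u ℕ.≟ n) (allFin nV) ++ below n

  ∈-below⁺ : ∀ n {u} → level u < n → u ∈ below n
  ∈-below⁺ (suc n) {u} (s≤s p) with ℕₚ.m≤n⇒m<n∨m≡n p
  ... | inj₁ l<n = ∈ₚ.∈-++⁺ʳ _ (∈-below⁺ n l<n)
  ... | inj₂ l≡n = ∈ₚ.∈-++⁺ˡ (∈ₚ.∈-filter⁺ (λ u → level u ℕ.≟ n) (∈ₚ.∈-allFin u) l≡n)

  all-below : ∀ n → All (λ u → level u < n) (below n)
  all-below zero    = []
  all-below (suc n) = Allₚ.++⁺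
    (All.map (λ l≡n → s≤s (ℕₚ.≤-reflexive l≡n)) (Allₚ.all-filter (λ u → level u ℕ.≟ n) (allFin nV)))
    (All.map ℕₚ.m≤n⇒m≤1+n (all-below n))

  below-descending : ∀ n → AllPairs Above (below n)
  below-descending zero    = []
  below-descending (suc n) = AllPairsₚ.++⁺
    (same-level (Allₚ.all-filter level≟n (allFin nV)) (Uniqueₚ.filter⁺ level≟n (Uniqueₚ.allFin⁺ nV)))
    (below-descending n)
    (All.map (λ {a} a≡n → All.map (λ {u} u<n → ℕₚ.<⇒≤ (subst (level u <_) (sym a≡n) u<n)
        , λ { refl → ℕₚ.<-irrefl a≡n u<n })
                                  (all-below n))
             (Allₚ.all-filter level≟n (allFin nV)))
    where
    level≟n = λ u → level u ℕ.≟ n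
    same-level : ∀ {us} → All (λ u → level u ≡ n) us → Unique us → AllPairs Above us
    same-level []       []       = []
    same-level (p ∷ ps) (q ∷ qs) =
      All.zipWith (λ (l , ne) → ℕₚ.≤-reflexive (trans l (sym p)) , ne) (ps , q) ∷ same-level ps qs

  down : Vert → List Vert
  down v = filter (v >?_) (below (level v))

  ∈-down⁺ : ∀ {v w} → v >V w → w ∈ down v
  ∈-down⁺ {v} v>w = ∈ₚ.∈-filter⁺ (v >?_) (∈-below⁺ (level v) (>V⇒level v>w)) v>w

  ∈-down⁻ : ∀ {v w} → w ∈ down v → v >V w
  ∈-down⁻ {v} w∈ = proj₂ (∈ₚ.∈-filter⁻ (v >?_) {xs = below (level v)} w∈)

  Closed : List Vert → Set
  Closed us = ∀ {u w} → u ∈ us → u >V w → w ∈ us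

  -- What `down v` shares with all its tails, so that statements about the reduction can be proved
  -- by induction on the list.
  record Descending (us : List Vert) : Set where
    field
      sorted : AllPairs Above us
      closed : Closed us

  down-descending : ∀ v → Descending (down v)
  down-descending v = record
    { sorted = AllPairsₚ.filter⁺ (v >?_) (below-descending (level v))
    ; closed = λ u∈ u>w → ∈-down⁺ (>V-trans (∈-down⁻ u∈) u>w)
    }

  module Descending-∷ {a : Vert} {as : List Vert} (d : Descending (a ∷ as)) where
    open Descending d

    head-above : ∀ {u} → u ∈ as → Above a u
    head-above u∈ = All.lookup (AllPairs.head sorted) u∈

    down⊆tail : ∀ {w} → a >V w → w ∈ as
    down⊆tail a>w with closed (here refl) a>w
    ... | here refl = ⊥-elim (ℕₚ.<-irrefl refl (>V⇒level a>w))
    ... | there w∈    = w∈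

    tail-descending : Descending as
    tail-descending = record { sorted = AllPairs.tail sorted ; closed = closed′ }
      where
      closed′ : Closed as
      closed′ u∈ u>w with closed (there u∈) u>w
      ... | there w∈    = w∈
      ... | here refl = ⊥-elim (ℕₚ.<-irrefl refl (ℕₚ.<-≤-trans (>V⇒level u>w) (proj₁ (head-above u∈))))

  -- The letter (v , i), with i < level v, stands for -e(v, level v - i).
  Letter : Set
  Letter = Vert × ℕ

  LWord : Set
  LWord = List Letter

  _≟L_ : (U W : LWord) → Dec (U ≡ W)
  _≟L_ = Listₚ.≡-dec (×ₚ.≡-dec _≟F_ ℕ._≟_)

  Covers : Letter → Letter → Set
  Covers (v , i) (u , _) = v >V u × level u ≡ i

  Fits : Letter → LWord → Set
  Fits x []      = ⊤
  Fits x (y ∷ _) = ¬ Covers x y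

  Normal : LWord → Set
  Normal []            = ⊤
  Normal ((v , i) ∷ W) = i < level v × Fits (v , i) W × Normal W

  fits? : ∀ x W → Dec (Fits x W)
  fits? x       []            = yes tt
  fits? (v , i) ((u , j) ∷ W) = ¬? ((v >? u) ×-dec (level u ℕ.≟ i))

  normal? : ∀ W → Dec (Normal W)
  normal? []            = yes tt
  normal? ((v , i) ∷ W) = (i ℕ.<? level v) ×-dec (fits? (v , i) W ×-dec normal? W)

  degree : LWord → ℕ
  degree []            = 0
  degree ((v , i) ∷ W) = (level v ∸ i) ℕ.+ degree W

  vertices : List Vert
  vertices = allFin nV

  letters : List Letter
  letters = concatMap (λ v → map (v ,_) (upTo (level v))) vertices

  -- The words with fewer than k letters.
  words : ℕ → List LWord
  words zero    = []
  words (suc k) = [] ∷ concatMap (λ x → map (x ∷_) (words k)) letters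

  module _ {r ℓr a ℓa : Level} {R : Ring r ℓr} (X : LeftModule R a ℓa) where
    open ModuleLemmas X

    ∑-words : ∀ k (f : LWord → Carrierᴹ) → ∑ (words (suc k)) f ≈ᴹ
      f [] +ᴹ ∑ vertices (λ v → ∑ (upTo (level v)) (λ i → ∑ (words k) (λ W → f ((v , i) ∷ W))))
    ∑-words k f = +ᴹ-congˡ (begin
      ∑ (concatMap (λ x → map (x ∷_) (words k)) letters) f
        ≈⟨ ∑-concatMap (λ x → map (x ∷_) (words k)) letters f ⟩
      ∑ letters (λ x → ∑ (map (x ∷_) (words k)) f)
        ≈⟨ ∑-cong letters (λ x → ∑-map (x ∷_) (words k) f) ⟩
      ∑ letters by-letter
        ≈⟨ ∑-concatMap (λ v → map (v ,_) (upTo (level v))) vertices by-letter ⟩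
      ∑ vertices (λ v → ∑ (map (v ,_) (upTo (level v))) by-letter)
        ≈⟨ ∑-cong vertices (λ v → ∑-map (v ,_) (upTo (level v)) by-letter) ⟩
      ∑ vertices (λ v → ∑ (upTo (level v)) (λ i → by-letter (v , i)))
        ∎)
      where
      open ≈ᴹ-Reasoning
      by-letter : Letter → Carrierᴹ
      by-letter x = ∑ (words k) (λ W → f (x ∷ W))

    ∑-words-stable : ∀ k f → (∀ W → k ≤ length W → f W ≈ᴹ 0ᴹ) → ∀ j → ∑ (words (j ℕ.+ k)) f ≈ᴹ ∑ (words k) f
    ∑-words-stable k f z zero    = ≈ᴹ-refl
    ∑-words-stable k f z (suc j) = ≈ᴹ-trans
      (step (j ℕ.+ k) f (λ W j+k≤ → z W (ℕₚ.≤-trans (ℕₚ.m≤n+m k j) j+k≤))) (∑-words-stable k f z j)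
      where
      step : ∀ k f → (∀ W → k ≤ length W → f W ≈ᴹ 0ᴹ) → ∑ (words (suc k)) f ≈ᴹ ∑ (words k) f
      step zero    f z = ≈ᴹ-trans (∑-words zero f) (0+0≈0 (z [] z≤n)
        (∑-zero vertices (λ v → ∑-zero (upTo (level v)) (λ i → ≈ᴹ-refl))))
      step (suc k) f z = ≈ᴹ-trans (∑-words (suc k) f) (≈ᴹ-trans
        (+ᴹ-congˡ (∑-cong vertices (λ v → ∑-cong (upTo (level v)) (λ i →
          step k (λ W → f ((v , i) ∷ W)) (λ W k≤ → z ((v , i) ∷ W) (s≤s k≤))))))
        (≈ᴹ-sym (∑-words k f)))

  letters-unique : Unique letters
  letters-unique = concatMap-unique (Uniqueₚ.allFin⁺ nV)
    (λ v → Uniqueₚ.map⁺ ×ₚ.,-injectiveʳ (Uniqueₚ.upTo⁺ (level v))) same-head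
    where
    same-head : ∀ {u v z} → z ∈ map (u ,_) (upTo (level u)) → z ∈ map (v ,_) (upTo (level v)) → u ≡ v
    same-head z∈₁ z∈₂ with ∈ₚ.∈-map⁻ _ z∈₁ | ∈ₚ.∈-map⁻ _ z∈₂
    ... | _ , _ , p | _ , _ , q = ×ₚ.,-injectiveˡ (trans (sym p) q)

  words-unique : ∀ k → Unique (words k)
  words-unique zero    = []
  words-unique (suc k) = All.tabulate (λ W∈ p → nonempty letters (subst (_∈ _) (sym p) W∈))
    ∷ concatMap-unique letters-unique (λ x → Uniqueₚ.map⁺ Listₚ.∷-injectiveʳ (words-unique k)) same-head
    where
    same-head : ∀ {x y Z} → Z ∈ map (x ∷_) (words k) → Z ∈ map (y ∷_) (words k) → x ≡ y
    same-head Z∈₁ Z∈₂ with ∈ₚ.∈-map⁻ _ Z∈₁ | ∈ₚ.∈-map⁻ _ Z∈₂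
    ... | _ , _ , p | _ , _ , q = Listₚ.∷-injectiveˡ (trans (sym p) q)
    nonempty : ∀ xs → ¬ [] ∈ concatMap (λ x → map (x ∷_) (words k)) xs
    nonempty (x ∷ xs) []∈ with ∈ₚ.∈-++⁻ (map (x ∷_) (words k)) []∈
    ... | inj₂ p = nonempty xs p
    ... | inj₁ p with ∈ₚ.∈-map⁻ _ p
    ...   | _ , _ , ()

  NormalOfDegree : ℕ → LWord → Set
  NormalOfDegree d W = Normal W × degree W ≡ d

  normalOfDegree? : ∀ d → Decidable (NormalOfDegree d)
  normalOfDegree? d W = normal? W ×-dec (degree W ℕ.≟ d)

  -- The bound on the length loses nothing: every letter of a normal word has degree at least 1.
  normalWords : ℕ → List LWord
  normalWords d = filter (normalOfDegree? d) (words (suc d))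

  normalWords-unique : ∀ d → Unique (normalWords d)
  normalWords-unique d = Uniqueₚ.filter⁺ (normalOfDegree? d) (words-unique (suc d))

  ∈-normalWords⁻ : ∀ d {W} → W ∈ normalWords d → NormalOfDegree d W
  ∈-normalWords⁻ d W∈ = proj₂ (∈ₚ.∈-filter⁻ (normalOfDegree? d) {xs = words (suc d)} W∈)

module WordModule {c ℓ : Level} (F : Field c ℓ) (Γ : Graph)
    (_>?_ : Decidable₂ (GraphNotions._>V_ Γ)) where
  open GraphLemmas Γ
  open NormalWords Γ _>?_
  R : Ring c ℓ
  R = Field.ring F
  private
    module F = Field F
    𝔽 = TensorUnit.leftModule {R = R}

  -- Arbitrary functions, so that no finiteness of supports has to be carried through the reduction.
  M : LeftModule R c ℓ
  M = power R LWord 𝔽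

  open ModuleLemmas M
  open Sequences M
  S : LeftModule R c ℓ
  S = power R ℕ M
  private module S = ModuleLemmas S

  δ : LWord → Carrierᴹ
  δ U W with U ≟L W
  ... | yes _ = F.1#
  ... | no  _ = F.0#

  δ-≢ : ∀ U W → U ≢ W → δ U W F.≈ F.0#
  δ-≢ U W U≢W with U ≟L W
  ... | yes p = ⊥-elim (U≢W p)
  ... | no  _ = F.refl

  δ-≡ : ∀ U → δ U U F.≈ F.1#
  δ-≡ U with U ≟L U
  ... | yes _ = F.refl
  ... | no ≢  = ⊥-elim (≢ refl)

  part : Vert → Carrierᴹ → Seq
  part v m i W = m ((v , i) ∷ W)

  part-linear : ∀ v → IsLinear R M S (part v)
  part-linear v = record
    { resp = λ p i W → p ((v , i) ∷ W) ; +-homo = λ _ _ _ _ → F.refl ; *-homo = λ _ _ _ _ → F.refl }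

  -- The guard on i discards pairs that are not letters; thereby only the first `level v` terms are
  -- read, as a monic recurrence demands.
  prepend : Vert → Seq → Carrierᴹ
  prepend v f []            = F.0#
  prepend v f ((u , i) ∷ W) with u ≟F v | i ℕ.<? level v
  ... | yes _ | yes _ = f i W
  ... | _     | _     = F.0#

  prepend-linear : ∀ v → IsLinear R S M (prepend v)
  prepend-linear v = record
    { resp   = λ { p [] → F.refl ; p (x ∷ W) → IsLinear.resp (at x W) p }
    ; +-homo = λ { f g [] → F.sym (F.+-identityˡ F.0#) ; f g (x ∷ W) → IsLinear.+-homo (at x W) f g }
    ; *-homo = λ { k f [] → F.sym (F.zeroʳ k) ; k f (x ∷ W) → IsLinear.*-homo (at x W) k f }
    }
    where
    at : ∀ x W → IsLinear R S 𝔽 (λ f → prepend v f (x ∷ W))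
    at (u , i) W with u ≟F v | i ℕ.<? level v
    ... | yes _ | yes _ = record { resp = λ p → p i W ; +-homo = λ _ _ → F.refl ; *-homo = λ _ _ → F.refl }
    ... | yes _ | no  _ = zero-linear R S 𝔽
    ... | no  _ | _     = zero-linear R S 𝔽

  part-prepend-≢ : ∀ {a u} → a ≢ u → ∀ f → part a (prepend u f) S.≈ᴹ S.0ᴹ
  part-prepend-≢ {a} {u} a≢u f i W with a ≟F u | i ℕ.<? level u
  ... | yes a≡u | _ = ⊥-elim (a≢u a≡u)
  ... | no _    | _ = F.refl

  part-prepend-≡ : ∀ u f i → i < level u → part u (prepend u f) i ≈ᴹ f i
  part-prepend-≡ u f i i<n W with u ≟F u | i ℕ.<? level u
  ... | yes _ | yes _   = F.refl
  ... | yes _ | no  i≮n = ⊥-elim (i≮n i<n)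
  ... | no ≢  | _       = ⊥-elim (≢ refl)

  prepend-local : ∀ v {f g} → (∀ i → i < level v → f i ≈ᴹ g i) → prepend v f ≈ᴹ prepend v g
  prepend-local v p []            = F.refl
  prepend-local v p ((u , i) ∷ W) with u ≟F v | i ℕ.<? level v
  ... | yes _ | yes i<n = p i i<n W
  ... | yes _ | no  _   = F.refl
  ... | no  _ | _       = F.refl

  Family : Set (c ⊔ ℓ)
  Family = ∀ v → Recurrence (level v)

  module Reduction (T : Family) where
    module T (v : Vert) = Recurrence (T v)

    -- The next term of a solution puts the letters (u , i) in front of its initial terms. Stripping
    -- these letters from `f (level u)` gives initial terms whose solution, if they are already
    -- reduced, reproduces at term `level u` the words of f beginning with u.
    correction : Vert → Seq → Seq
    correction u f = T.extend u (part u (f (level u)))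

    correction-linear : ∀ u → IsLinear R S S (correction u)
    correction-linear u = ∘-linear R S S S (T.extend-linear u)
      (∘-linear R S M S (part-linear u) (eval-linear R M (level u)))

    -- One step clears the letters of vertex u from the term number level u of the sequence.
    reduce : List Vert → Seq → Seq
    reduce []       f = f
    reduce (u ∷ us) f = reduce us (f S.-ᴹ correction u f)

    reduce-linear : ∀ us → IsLinear R S S (reduce us)
    reduce-linear []       = id-linear R S
    reduce-linear (u ∷ us) = ∘-linear R S S S (reduce-linear us)
      (sub-linear R S S (id-linear R S) (correction-linear u))

    Reduced : List Vert → Seq → Set ℓ
    Reduced us f = ∀ {u} → u ∈ us → ∀ j → j < level u → part u (f (level u)) j ≈ᴹ 0ᴹ

    reduce-reduced : ∀ us {f} → Reduced us f → reduce us f S.≈ᴹ f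
    reduce-reduced []       z = S.≈ᴹ-refl
    reduce-reduced (u ∷ us) {f} z = S.≈ᴹ-trans
      (IsLinear.resp (reduce-linear us) (S.-0≈ {x = f} (S.≈ᴹ-trans
        (T.extend-local u (z (here refl))) (IsLinear.0-homo (T.extend-linear u)))))
      (reduce-reduced us (λ u∈ → z (there u∈)))

    -- The reduction changes f only by solutions belonging to vertices of `us`, so a linear map that
    -- kills those cannot notice it. With varying `L` this is the main tool for handling `reduce`.
    reduce-invariant : ∀ {b ℓb} {Y : LeftModule R b ℓb} {L : Seq → LeftModule.Carrierᴹ Y} → IsLinear R S Y L →
      ∀ us → (∀ {u} → u ∈ us → ∀ g → LeftModule._≈ᴹ_ Y (L (T.extend u g)) (LeftModule.0ᴹ Y)) →
      ∀ f → LeftModule._≈ᴹ_ Y (L (reduce us f)) (L f)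
    reduce-invariant {Y = Y} L-linear []       z f = LeftModule.≈ᴹ-refl Y
    reduce-invariant {Y = Y} {L} L-linear (u ∷ us) z f = begin
      L (reduce us (f S.-ᴹ correction u f)) ≈⟨ reduce-invariant L-linear us (λ u∈ → z (there u∈)) _ ⟩
      L (f S.-ᴹ correction u f) ≈⟨ L.-‿homo f (correction u f) ⟩
      L f Y.-ᴹ L (correction u f) ≈⟨ Y.-0≈ (z (here refl) _) ⟩
      L f                                     ∎
      where
      module Y = ModuleLemmas Y
      module L = IsLinear L-linear
      open Y.≈ᴹ-Reasoning

    normalise : Vert → Seq → Carrierᴹ
    normalise v f = reduce (down v) f (level v) -ᴹ prepend v (reduce (down v) f)

    recurrence : ∀ v → Recurrence (level v)
    recurrence v = record
      { Ψ        = normalise v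
      ; Ψ-linear = ∘-linear R S S M
          (sub-linear R S M (eval-linear R M (level v)) (prepend-linear v)) (reduce-linear (down v))
      ; Ψ-monic  = monic
      }
      where
      monic : ∀ {f} → (∀ i → i < level v → f i ≈ᴹ 0ᴹ) → normalise v f ≈ᴹ f (level v)
      monic {f} z = ≈ᴹ-trans
        (-ᴹ-cong (red (level v))
          (≈ᴹ-trans (prepend-local v (λ i i<n → ≈ᴹ-trans (red i) (z i i<n))) (IsLinear.0-homo (prepend-linear v))))
        (x-0≈x (f (level v)))
        where
        red : reduce (down v) f S.≈ᴹ f
        red = reduce-reduced (down v) (λ {u} u∈ j _ W → z (level u) (>V⇒level (∈-down⁻ u∈)) ((u , j) ∷ W))

  reduce-family : ∀ (T T′ : Family) us → (∀ {u} → u ∈ us → T u ≡ T′ u) →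
    ∀ {f g} → f S.≈ᴹ g → Reduction.reduce T us f S.≈ᴹ Reduction.reduce T′ us g
  reduce-family T T′ []       p f≈g = f≈g
  reduce-family T T′ (u ∷ us) p {f} {g} f≈g = reduce-family T T′ us (λ u∈ → p (there u∈))
    (S.-ᴹ-cong f≈g (S.≈ᴹ-trans (IsLinear.resp (Reduction.correction-linear T u) f≈g)
      (S.≈ᴹ-reflexive (cong (λ t → Recurrence.extend t (part u (g (level u)))) (p (here refl))))))

  -- Recursion on the level through a numeric bound. Stage n is final at levels below n; elsewhere
  -- it holds a placeholder, the polynomial τ^|u|. The recurrence at v consults only vertices of
  -- lower level.
  table : ℕ → Family
  table zero    u = record { Ψ = λ f → f (level u) ; Ψ-linear = eval-linear R M (level u) ; Ψ-monic = λ _ → ≈ᴹ-refl }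
  table (suc n) u with level u ℕ.≟ n
  ... | yes _ = Reduction.recurrence (table n) u
  ... | no  _ = table n u

  family : Family
  family u = table (suc (level u)) u

  table-stable : ∀ n u → level u < n → table n u ≡ family u
  table-stable (suc n) u (s≤s l≤n) with level u ℕ.≟ n
  ... | no  l≢n    = table-stable n u (ℕₚ.≤∧≢⇒< l≤n l≢n)
  ... | yes refl with level u ℕ.≟ level u
  ...   | yes _ = refl
  ...   | no ≢  = ⊥-elim (≢ refl)

  open Reduction family public

  -- The recursive definition as an equation of the family with itself: `down v` meets only entries
  -- of the table that are already final.
  family-Ψ : ∀ v f → T.Ψ v f ≈ᴹ normalise v f
  family-Ψ v f with level v ℕ.≟ level v
  ... | no ≢  = ⊥-elim (≢ refl)
  ... | yes _ = -ᴹ-cong (red (level v)) (IsLinear.resp (prepend-linear v) red)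
    where
    red : Reduction.reduce (table (level v)) (down v) f S.≈ᴹ reduce (down v) f
    red = reduce-family (table (level v)) family (down v)
      (λ {u} u∈ → table-stable (level v) u (>V⇒level (∈-down⁻ u∈))) S.≈ᴹ-refl

-- Inclusion of solution spaces and the edge operators

module NormalForms {c ℓ : Level} (F : Field c ℓ) (Γ : Graph)
    (_>?_ : Decidable₂ (GraphNotions._>V_ Γ)) where
  open GraphLemmas Γ
  open NormalWords Γ _>?_
  open WordModule F Γ _>?_
  open ModuleLemmas M
  open Sequences M
  private
    module S = ModuleLemmas S

  down-level : ∀ {v w} → w ∈ down v → level w < level v
  down-level w∈ = >V⇒level (∈-down⁻ w∈)

  term-part-linear : ∀ a n → IsLinear R S S (λ f → part a (f n))
  term-part-linear a n = ∘-linear R S M S (part-linear a) (eval-linear R M n)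

  private
    part-next : ∀ u a f → part a (f (level u) -ᴹ T.next u f) S.≈ᴹ
      part a (reduce (down u) f (level u)) S.-ᴹ part a (prepend u (reduce (down u) f))
    part-next u a f = S.≈ᴹ-trans
      (IsLinear.resp (part-linear a) (≈ᴹ-trans (x-[x-y]≈y (f (level u)) (T.Ψ u f)) (family-Ψ u f)))
      (IsLinear.-‿homo (part-linear a) (reduce (down u) f (level u)) (prepend u (reduce (down u) f)))

    part-next′ : ∀ u a f → part a (reduce (down u) f (level u)) S.≈ᴹ part a (f (level u)) →
      part a (T.next u f) S.≈ᴹ part a (prepend u (reduce (down u) f))
    part-next′ u a f inv = begin
      part a (T.next u f) ≈⟨ S.x-[x-y]≈y (part a (f n)) _ ⟨
      part a (f n) S.-ᴹ (part a (f n) S.-ᴹ part a (T.next u f)) ≈⟨ S.-ᴹ-cong S.≈ᴹ-refl (IsLinear.-‿homo (part-linear a) (f n) (T.next u f)) ⟨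
      part a (f n) S.-ᴹ part a (f n -ᴹ T.next u f) ≈⟨ S.-ᴹ-cong S.≈ᴹ-refl (part-next u a f) ⟩
      part a (f n) S.-ᴹ (part a (g n) S.-ᴹ part a (prepend u g)) ≈⟨ S.-ᴹ-cong S.≈ᴹ-refl (S.-ᴹ-cong inv S.≈ᴹ-refl) ⟩
      part a (f n) S.-ᴹ (part a (f n) S.-ᴹ part a (prepend u g)) ≈⟨ S.x-[x-y]≈y (part a (f n)) _ ⟩
      part a (prepend u g)                                       ∎
      where
      open S.≈ᴹ-Reasoning
      n = level u
      g = reduce (down u) f

    -- The next term consists of words made by `prepend u` and of corrections belonging to vertices
    -- below u. The former begin with u; to the latter the companion statement about `extend`
    -- applies at a lower level, whence the mutual induction on b.
    part-next-≢-below : ∀ b {u a} → level u < b → a ≢ u → level u ≤ level a →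
      ∀ f → part a (T.next u f) S.≈ᴹ S.0ᴹ

    part-extend-below : ∀ b {u a n} → level u < b → a ≢ u → level u ≤ level a → level u ≤ n →
      ∀ f → part a (T.extend u f n) S.≈ᴹ S.0ᴹ
    part-extend-below b {u} {a} {n} u<b a≢u u≤a u≤n f = S.≈ᴹ-trans
      (IsLinear.resp (part-linear a) (T.extend-late u f u≤n))
      (part-next-≢-below b u<b a≢u u≤a (shift (n ∸ level u) (T.extend u f)))

    part-next-≢-below (suc b) {u} {a} (s≤s u≤b) a≢u u≤a f = S.≈ᴹ-trans
      (part-next′ u a f (reduce-invariant (term-part-linear a (level u)) (down u)
        (λ {w} w∈ → part-extend-below b
          (ℕₚ.<-≤-trans (down-level w∈) u≤b)
          (λ { refl → ℕₚ.<⇒≱ (down-level w∈) u≤a })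
          (ℕₚ.≤-trans (ℕₚ.<⇒≤ (down-level w∈)) u≤a)
          (ℕₚ.<⇒≤ (down-level w∈)))
        f))
      (part-prepend-≢ a≢u (reduce (down u) f))

  part-extend : ∀ {u a n} → a ≢ u → level u ≤ level a → level u ≤ n → ∀ f → part a (T.extend u f n) S.≈ᴹ S.0ᴹ
  part-extend = part-extend-below _ ℕₚ.≤-refl

  -- Corrections of lower vertices contribute no word beginning with u at term |u|, so all such
  -- words come from `prepend u`.
  part-next-≡ : ∀ u f i → i < level u → part u (T.next u f) i ≈ᴹ reduce (down u) f i
  part-next-≡ u f i i<n = ≈ᴹ-trans
    (part-next′ u u f (reduce-invariant (term-part-linear u (level u)) (down u)
      (λ {w} w∈ → part-extend
        (λ { refl → ℕₚ.<-irrefl refl (down-level w∈) })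
        (ℕₚ.<⇒≤ (down-level w∈)) (ℕₚ.<⇒≤ (down-level w∈)))
      f) i)
    (part-prepend-≡ u (reduce (down u) f) i i<n)

  private
    ReduceKills : ℕ → Set (c ⊔ ℓ)
    ReduceKills b = ∀ {us} → Descending us → (∀ {u} → u ∈ us → level u < b) →
      ∀ {u} → u ∈ us → ∀ f → reduce us (T.extend u f) S.≈ᴹ S.0ᴹ

    -- `Ψ` of v reduces its argument before doing anything else, and the reduction sends a solution
    -- for u to zero.
    solution-below : ∀ b → ReduceKills b → ∀ {u v} → level v ≤ b → v >V u → ∀ f → T.Solution u f → T.Solution v f
    solution-below b kill {u} {v} v≤b v>u f s k = begin
      T.Ψ v g                                      ≈⟨ family-Ψ v g ⟩
      reduce (down v) g n -ᴹ prepend v (reduce (down v) g) ≈⟨ 0-0≈0 (red n) (IsLinear.≈0-homo (prepend-linear v) red) ⟩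
      0ᴹ                                           ∎
      where
      open ≈ᴹ-Reasoning
      n = level v
      g = shift k f
      red : reduce (down v) g S.≈ᴹ S.0ᴹ
      red = S.≈ᴹ-trans
        (IsLinear.resp (reduce-linear (down v)) (S.≈ᴹ-sym (T.extend-fixed u g (T.solution-shift u f s k))))
        (kill (down-descending v) (λ w∈ → ℕₚ.<-≤-trans (down-level w∈) v≤b) (∈-down⁺ v>u) g)

    -- If u is the head a, subtracting its correction leaves the solution with initial terms `f`
    -- minus `reduce (down a) f`, a difference made of solutions for vertices below a. By the
    -- hypothesis for b these are solutions for a as well, hence unchanged by `ext`; their vertices
    -- lie in the closed tail, which kills them. If u comes later, a finds no word of its own at
    -- term |a| and its correction is zero.
    reduce-kills-suc : ∀ b → ReduceKills b → ReduceKills (suc b)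
    reduce-kills-suc b ih {a ∷ as} d us<b (here refl) f = begin
      reduce as (ext f S.-ᴹ ext (part a (ext f n)))
        ≈⟨ IsLinear.-‿homo (reduce-linear as) (ext f) (ext (part a (ext f n))) ⟩
      reduce as (ext f) S.-ᴹ reduce as (ext (part a (ext f n)))
        ≈⟨ S.-ᴹ-cong S.≈ᴹ-refl (IsLinear.resp (reduce-linear as) (T.extend-local a own)) ⟩
      reduce as (ext f) S.-ᴹ reduce as (ext (reduce (down a) f))
        ≈⟨ S.x≈y⇒x-y≈0 (S.≈ᴹ-sym (reduce-invariant
             (∘-linear R S S S (reduce-linear as) (T.extend-linear a)) (down a) kills f)) ⟩
      S.0ᴹ ∎
      where
      open S.≈ᴹ-Reasoning
      open Descending-∷ d
      n = level a
      ext = T.extend a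
      own : ∀ i → i < n → part a (ext f n) i ≈ᴹ reduce (down a) f i
      own i i<n = ≈ᴹ-trans (IsLinear.resp (part-linear a) (T.extend-next a f) i) (part-next-≡ a f i i<n)
      a≤b : level a ≤ b
      a≤b = ℕₚ.≤-pred (us<b (here refl))
      kills : ∀ {w} → w ∈ down a → ∀ g → reduce as (ext (T.extend w g)) S.≈ᴹ S.0ᴹ
      kills {w} w∈ g = S.≈ᴹ-trans
        (IsLinear.resp (reduce-linear as) (T.extend-fixed a (T.extend w g)
          (solution-below b ih a≤b (∈-down⁻ w∈) (T.extend w g) (T.extend-solution w g))))
        (reduce-kills-suc b ih tail-descending (λ u∈ → us<b (there u∈)) (down⊆tail (∈-down⁻ w∈)) g)
    reduce-kills-suc b ih {a ∷ as} d us<b {u} (there u∈) f = S.≈ᴹ-trans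
      (IsLinear.resp (reduce-linear as) (S.-0≈ {x = T.extend u f} (IsLinear.≈0-homo (T.extend-linear a)
        (part-extend (proj₂ (head-above u∈)) (proj₁ (head-above u∈)) (proj₁ (head-above u∈)) f))))
      (reduce-kills-suc b ih tail-descending (λ w∈ → us<b (there w∈)) u∈ f)
      where open Descending-∷ d

    reduce-kills-below : ∀ b → ReduceKills b
    reduce-kills-below zero    d us<b u∈ f with () ← us<b u∈
    reduce-kills-below (suc b) = reduce-kills-suc b (reduce-kills-below b)

  -- P_u is a right divisor of P_v.
  solution-mono : ∀ {u v} → v >V u → ∀ f → T.Solution u f → T.Solution v f
  solution-mono {v = v} = solution-below (level v) (reduce-kills-below (level v)) ℕₚ.≤-refl

  -- Forced by P_v = (τ - e) P_w for v = `tl e`, w = `hd e`: evaluate both sides on the sequence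
  -- whose only nonzero term is x at position |w|, where the monic P_w returns x.
  edgeᴹ : Edge → Carrierᴹ → Carrierᴹ
  edgeᴹ e x = T.Ψ (hd e) (shift 1 (single (level (hd e)) x)) -ᴹ T.Ψ (tl e) (single (level (hd e)) x)

  edgeᴹ-linear : ∀ e → IsLinear R M M (edgeᴹ e)
  edgeᴹ-linear e = ∘-linear R M S M
    (sub-linear R S M (∘-linear R S S M (T.Ψ-linear (hd e)) (shift-linear 1)) (T.Ψ-linear (tl e)))
    (single-linear (level (hd e)))

  -- Split f into a single term d at position |w|, for which the equation defines `edgeᴹ`, and a
  -- rest h with `Ψw h` zero. Up to position |w| this h agrees with a solution for w, which both
  -- sides kill because v > w; on the difference both sides merely read term |w| + 1.
  Ψ-edge : ∀ e f → T.Ψ (tl e) f ≈ᴹ T.Ψ (hd e) (shift 1 f) -ᴹ edgeᴹ e (T.Ψ (hd e) f)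
  Ψ-edge e f = begin
    Ψᵥ f ≈⟨ Ψᵥ.resp (S.x-y+y≈x f d) ⟨
    Ψᵥ (h S.+ᴹ d) ≈⟨ Ψᵥ.+-homo h d ⟩
    Ψᵥ h +ᴹ Ψᵥ d ≈⟨ +ᴹ-cong step (≈ᴹ-sym (x-[x-y]≈y (Ψw (shift 1 d)) (Ψᵥ d))) ⟩
    Ψw (shift 1 h) +ᴹ (Ψw (shift 1 d) -ᴹ edgeᴹ e z) ≈⟨ +ᴹ-assoc _ _ _ ⟨
    (Ψw (shift 1 h) +ᴹ Ψw (shift 1 d)) -ᴹ edgeᴹ e z ≈⟨ -ᴹ-cong (Ψw.+-homo (shift 1 h) (shift 1 d)) ≈ᴹ-refl ⟨
    Ψw (shift 1 (h S.+ᴹ d)) -ᴹ edgeᴹ e z ≈⟨ -ᴹ-cong (Ψw.resp (λ i → S.x-y+y≈x f d (1 ℕ.+ i))) ≈ᴹ-refl ⟩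
    Ψw (shift 1 f) -ᴹ edgeᴹ e z                           ∎
    where
    open ≈ᴹ-Reasoning
    v = tl e
    w = hd e
    m = level w
    Ψᵥ = T.Ψ v
    Ψw = T.Ψ w
    module Ψᵥ = IsLinear (T.Ψ-linear v)
    module Ψw = IsLinear (T.Ψ-linear w)
    z = Ψw f
    d = single m z
    h = f S.-ᴹ d
    Ψwd : Ψw d ≈ᴹ z
    Ψwd = ≈ᴹ-trans (T.Ψ-monic w (λ i i<m → single-≢ m i z (ℕₚ.<⇒≢ i<m))) (single-≡ m z)
    Ψwh : Ψw h ≈ᴹ 0ᴹ
    Ψwh = ≈ᴹ-trans (Ψw.-‿homo f d) (x≈y⇒x-y≈0 (≈ᴹ-sym Ψwd))
    h′ = T.extend w h
    h′-solution = T.extend-solution w h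
    h≈h′ : ∀ i → i < suc m → h i -ᴹ h′ i ≈ᴹ 0ᴹ
    h≈h′ i i<1+m with ℕₚ.m≤n⇒m<n∨m≡n (ℕₚ.≤-pred i<1+m)
    ... | inj₁ i<m = x≈y⇒x-y≈0 (≈ᴹ-sym (T.extend-init w h i i<m))
    ... | inj₂ refl = x≈y⇒x-y≈0 (≈ᴹ-trans (T.solution⇒next w Ψwh) (≈ᴹ-sym (T.extend-next w h)))
    g = h S.-ᴹ h′
    Ψᵥg : Ψᵥ g ≈ᴹ g (suc m)
    Ψᵥg = ≈ᴹ-trans
      (T.Ψ-monic v (λ i i<n → h≈h′ i (subst (i <_) (layered e) i<n)))
      (≈ᴹ-reflexive (cong g (layered e)))
    Ψwg : Ψw (shift 1 g) ≈ᴹ g (suc m)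
    Ψwg = T.Ψ-monic w (λ i i<m → h≈h′ (suc i) (s≤s i<m))
    step : Ψᵥ h ≈ᴹ Ψw (shift 1 h)
    step = begin
      Ψᵥ h ≈⟨ -0≈ (solution-mono (tl>hd e) h′ h′-solution 0) ⟨
      Ψᵥ h -ᴹ Ψᵥ h′                       ≈⟨ Ψᵥ.-‿homo h h′ ⟨
      Ψᵥ g                                ≈⟨ Ψᵥg ⟩
      g (suc m)                           ≈⟨ Ψwg ⟨
      Ψw (shift 1 g) ≈⟨ Ψw.-‿homo (shift 1 h) (shift 1 h′) ⟩
      Ψw (shift 1 h) -ᴹ Ψw (shift 1 h′)   ≈⟨ -0≈ (h′-solution 1) ⟩
      Ψw (shift 1 h)                      ∎

  open Paths M edgeᴹ edgeᴹ-linear public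

  Φ-Ψ : ∀ {v w} π → IsPath v w π → ∀ f → Φ π (λ i → T.Ψ w (shift i f)) ≈ᴹ T.Ψ v f
  Φ-Ψ []      refl       f = ≈ᴹ-refl
  Φ-Ψ {w = w} (e ∷ π) (refl , p) f = ≈ᴹ-trans
    (-ᴹ-cong (Φ-Ψ π p (shift 1 f)) (IsLinear.resp (edgeᴹ-linear e) (Φ-Ψ π p f)))
    (≈ᴹ-sym (Ψ-edge e f))

  -- P_π P_w = P_v determines P_π, since the monic polynomial P_w acts surjectively on sequences.
  Φ-parallel : ∀ {v w π₁ π₂} → IsPath v w π₁ → IsPath v w π₂ → ∀ f → Φ π₁ f ≈ᴹ Φ π₂ f
  Φ-parallel {v} {w} {π₁} {π₂} p₁ p₂ f = begin
    Φ π₁ f ≈⟨ IsLinear.resp (Φ-linear π₁) Ψg ⟨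
    Φ π₁ (λ i → T.Ψ w (shift i g))     ≈⟨ Φ-Ψ π₁ p₁ g ⟩
    T.Ψ v g                            ≈⟨ Φ-Ψ π₂ p₂ g ⟨
    Φ π₂ (λ i → T.Ψ w (shift i g)) ≈⟨ IsLinear.resp (Φ-linear π₂) Ψg ⟩
    Φ π₂ f                             ∎
    where
    open ≈ᴹ-Reasoning
    g = T.solve w S.0ᴹ f
    Ψg : ∀ i → T.Ψ w (shift i g) ≈ᴹ f i
    Ψg = T.solve-Ψ w S.0ᴹ f

-- The action of T(E) defined by edge operators

module TensorAction {c ℓ a ℓa : Level} (F : Field c ℓ) (Γ : Graph) (X : LeftModule (Field.ring F) a ℓa)
    (edge : Fin (Graph.nE Γ) → Endo X)
    (edge-linear : ∀ e → IsLinear (Field.ring F) X X (edge e)) where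
  open GraphLemmas Γ
  open Alg F Γ
  open ModuleLemmas X
  open Sequences X
  open Paths X edge edge-linear
  private
    module F = Field F
    R = F.ring
    S = power R ℕ X

  eval : (Word → Carrierᴹ) → TE → Carrierᴹ
  eval φ p = ∑ p (λ (k , u) → k *ₗ φ u)

  private
    ∑-at : ∀ (φ : Word → Carrierᴹ) k u ws → Unique ws → u ∈ ws → ∀ p →
      ∑ ws (λ w → coeff ((k , u) ∷ p) w *ₗ φ w) ≈ᴹ k *ₗ φ u +ᴹ ∑ ws (λ w → coeff p w *ₗ φ w)
    ∑-off : ∀ (φ : Word → Carrierᴹ) k u ws → All (u ≢_) ws → ∀ p →
      ∑ ws (λ w → coeff ((k , u) ∷ p) w *ₗ φ w) ≈ᴹ ∑ ws (λ w → coeff p w *ₗ φ w)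

    ∑-off φ k u []       []       p = ≈ᴹ-refl
    ∑-off φ k u (w ∷ ws) (q ∷ qs) p with u ≟W w
    ... | yes u≡w = ⊥-elim (q u≡w)
    ... | no  _   = +ᴹ-congˡ (∑-off φ k u ws qs p)

    ∑-at φ k u (w ∷ ws) (q ∷ qs) u∈ p with u ≟W w
    ... | yes refl = begin
      (k F.+ coeff p u) *ₗ φ u +ᴹ ∑ ws (λ w → coeff ((k , u) ∷ p) w *ₗ φ w) ≈⟨ +ᴹ-cong (*ₗ-distribʳ (φ u) k (coeff p u)) (∑-off φ k u ws q p) ⟩
      (k *ₗ φ u +ᴹ coeff p u *ₗ φ u) +ᴹ ∑ ws (λ w → coeff p w *ₗ φ w) ≈⟨ +ᴹ-assoc _ _ _ ⟩
      k *ₗ φ u +ᴹ (coeff p u *ₗ φ u +ᴹ ∑ ws (λ w → coeff p w *ₗ φ w))        ∎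
      where open ≈ᴹ-Reasoning
    ∑-at φ k u (w ∷ ws) (q ∷ qs) (here u≡w) p | no u≢w = ⊥-elim (u≢w u≡w)
    ∑-at φ k u (w ∷ ws) (q ∷ qs) (there u∈) p | no _ = begin
      x +ᴹ ∑ ws (λ w → coeff ((k , u) ∷ p) w *ₗ φ w) ≈⟨ +ᴹ-congˡ (∑-at φ k u ws qs u∈ p) ⟩
      x +ᴹ (k *ₗ φ u +ᴹ y) ≈⟨ +ᴹ-assoc _ _ _ ⟨
      (x +ᴹ k *ₗ φ u) +ᴹ y ≈⟨ +ᴹ-congʳ (+ᴹ-comm _ _) ⟩
      (k *ₗ φ u +ᴹ x) +ᴹ y ≈⟨ +ᴹ-assoc _ _ _ ⟩
      k *ₗ φ u +ᴹ (x +ᴹ y)                             ∎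
      where
      open ≈ᴹ-Reasoning
      x = coeff p w *ₗ φ w
      y = ∑ ws (λ w → coeff p w *ₗ φ w)

    eval-coeff : ∀ φ p ws → Unique ws → (∀ {u} → u ∈ map proj₂ p → u ∈ ws) →
      eval φ p ≈ᴹ ∑ ws (λ w → coeff p w *ₗ φ w)
    eval-coeff φ []            ws q ⊆ws = ≈ᴹ-sym (∑-zero ws (λ w → *ₗ-zeroˡ (φ w)))
    eval-coeff φ ((k , u) ∷ p) ws q ⊆ws = ≈ᴹ-trans
      (+ᴹ-congˡ (eval-coeff φ p ws q (λ u∈ → ⊆ws (there u∈))))
      (≈ᴹ-sym (∑-at φ k u ws q (⊆ws (here refl)) p))

  -- Equality in T(E) is coefficientwise, whereas `eval` runs over lists that may repeat words. Both
  -- sums are regrouped over one duplicate-free list of all words that occur.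
  eval-≈T : ∀ φ {p q} → p ≈T q → eval φ p ≈ᴹ eval φ q
  eval-≈T φ {p} {q} p≈q = begin
    eval φ p ≈⟨ eval-coeff φ p ws unique-ws (λ u∈ → ∈-ws (∈ₚ.∈-++⁺ˡ u∈)) ⟩
    ∑ ws (λ w → coeff p w *ₗ φ w) ≈⟨ ∑-cong ws (λ w → *ₗ-congʳ (p≈q w)) ⟩
    ∑ ws (λ w → coeff q w *ₗ φ w) ≈⟨ eval-coeff φ q ws unique-ws (λ u∈ → ∈-ws (∈ₚ.∈-++⁺ʳ (map proj₂ p) u∈)) ⟨
    eval φ q                        ∎
    where
    open ≈ᴹ-Reasoning
    us = map proj₂ p ++ map proj₂ q
    ws = deduplicate _≟W_ us
    unique-ws = deduplicate-! _≟W_ us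
    ∈-ws : ∀ {u} → u ∈ us → u ∈ ws
    ∈-ws = ∈ₚ.∈-deduplicate⁺ _≟W_

  word : Word → Carrierᴹ → Carrierᴹ
  word []      x = x
  word (e ∷ u) x = edge e (word u x)

  word-linear : ∀ u → IsLinear R X X (word u)
  word-linear []      = id-linear R X
  word-linear (e ∷ u) = ∘-linear R X X X (edge-linear e) (word-linear u)

  word-++ : ∀ u w x → word (u ++ w) x ≡ word u (word w x)
  word-++ []      w x = refl
  word-++ (e ∷ u) w x = cong (edge e) (word-++ u w x)

  act : TE → Carrierᴹ → Carrierᴹ
  act p x = eval (λ u → word u x) p

  scale-linear : ∀ k → IsLinear R X X (k *ₗ_)
  scale-linear k = record
    { resp   = *ₗ-congˡ
    ; +-homo = *ₗ-distribˡ k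
    ; *-homo = λ l x → ≈ᴹ-trans (≈ᴹ-sym (*ₗ-assoc k l x)) (≈ᴹ-trans (*ₗ-congʳ (F.*-comm k l)) (*ₗ-assoc l k x))
    }

  act-linear : ∀ p → IsLinear R X X (act p)
  act-linear p = ∑-linear R X X p
    (λ (k , u) → ∘-linear R X X X (scale-linear k) (word-linear u))

  act-+T : ∀ p q x → act (p +T q) x ≈ᴹ act p x +ᴹ act q x
  act-+T p q x = ∑-++ p q _

  act-scaleT : ∀ k p x → act (scaleT k p) x ≈ᴹ k *ₗ act p x
  act-scaleT k p x = ≈ᴹ-trans (∑-map _ p _)
    (≈ᴹ-trans (∑-cong p (λ (l , u) → *ₗ-assoc k l (word u x))) (∑-* p k _))

  act-negT : ∀ p x → act (negT p) x ≈ᴹ -ᴹ act p x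
  act-negT p x = begin
    act (negT p) x ≈⟨ act-scaleT (F.- F.1#) p x ⟩
    (F.- F.1#) *ₗ y                             ≈⟨ x+y-y≈x _ y ⟨
    ((F.- F.1#) *ₗ y +ᴹ y) -ᴹ y ≈⟨ -ᴹ-cong (+ᴹ-congˡ (*ₗ-identityˡ y)) ≈ᴹ-refl ⟨
    ((F.- F.1#) *ₗ y +ᴹ F.1# *ₗ y) -ᴹ y ≈⟨ -ᴹ-cong (*ₗ-distribʳ y (F.- F.1#) F.1#) ≈ᴹ-refl ⟨
    ((F.- F.1#) F.+ F.1#) *ₗ y -ᴹ y ≈⟨ -ᴹ-cong (*ₗ-congʳ (F.-‿inverseˡ F.1#)) ≈ᴹ-refl ⟩
    F.0# *ₗ y -ᴹ y ≈⟨ -ᴹ-cong (*ₗ-zeroˡ y) ≈ᴹ-refl ⟩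
    0ᴹ -ᴹ y                                     ≈⟨ 0+≈ ≈ᴹ-refl ⟩
    -ᴹ y                                        ∎
    where
    open ≈ᴹ-Reasoning
    y = act p x

  act-*T : ∀ p q x → act (p *T q) x ≈ᴹ act p (act q x)
  act-*T p q x = ≈ᴹ-trans (∑-concatMap _ p _) (∑-cong p λ (k , u) → begin
    act (map (λ { (l , w) → (k F.* l , u ++ w) }) q) x ≈⟨ ∑-map _ q _ ⟩
    ∑ q (λ (l , w) → (k F.* l) *ₗ word (u ++ w) x) ≈⟨ ∑-cong q (λ (l , w) → ≈ᴹ-trans (*ₗ-assoc k l _)
        (*ₗ-congˡ (≈ᴹ-trans (*ₗ-congˡ (≈ᴹ-reflexive (word-++ u w x)))
          (≈ᴹ-sym (IsLinear.*-homo (word-linear u) l (word w x)))))) ⟩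
    ∑ q (λ (l , w) → k *ₗ word u (l *ₗ word w x)) ≈⟨ ∑-* q k _ ⟩
    k *ₗ ∑ q (λ (l , w) → word u (l *ₗ word w x)) ≈⟨ *ₗ-congˡ (IsLinear.∑-homo (word-linear u) q _) ⟨
    k *ₗ word u (act q x)                                    ∎)
    where open ≈ᴹ-Reasoning

  act-wordT : ∀ u x → act (wordT u) x ≈ᴹ word u x
  act-wordT u x = ≈ᴹ-trans (+ᴹ-identityʳ _) (*ₗ-identityˡ _)

  -- The polynomial with τ acting as the shift, applied to f and read at position 0.
  actP : PolyT → Seq → Carrierᴹ
  actP []      f = 0ᴹ
  actP (p ∷ P) f = act p (f 0) +ᴹ actP P (shift 1 f)

  actP-linear : ∀ P → IsLinear R S X (actP P)
  actP-linear []      = zero-linear R S X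
  actP-linear (p ∷ P) = add-linear R S X
    (∘-linear R S X X (act-linear p) (eval-linear R X 0))
    (∘-linear R S S X (actP-linear P) (shift-linear 1))

  actP-+P : ∀ P Q f → actP (P +P Q) f ≈ᴹ actP P f +ᴹ actP Q f
  actP-+P []      Q       f = ≈ᴹ-sym (+ᴹ-identityˡ _)
  actP-+P (p ∷ P) []      f = ≈ᴹ-sym (+ᴹ-identityʳ _)
  actP-+P (p ∷ P) (q ∷ Q) f = ≈ᴹ-trans
    (+ᴹ-cong (act-+T p q (f 0)) (actP-+P P Q (shift 1 f))) (+-interchange _ _ _ _)

  actP-map-*T : ∀ p Q f → actP (map (p *T_) Q) f ≈ᴹ act p (actP Q f)
  actP-map-*T p []      f = ≈ᴹ-sym (IsLinear.0-homo (act-linear p))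
  actP-map-*T p (q ∷ Q) f = ≈ᴹ-trans
    (+ᴹ-cong (act-*T p q (f 0)) (actP-map-*T p Q (shift 1 f))) (≈ᴹ-sym (IsLinear.+-homo (act-linear p) _ _))

  actP-*P : ∀ P Q f → actP (P *P Q) f ≈ᴹ actP P (λ i → actP Q (shift i f))
  actP-*P []      Q f = ≈ᴹ-refl
  actP-*P (p ∷ P) Q f = ≈ᴹ-trans (actP-+P (map (p *T_) Q) (0T ∷ P *P Q) f)
    (+ᴹ-cong (actP-map-*T p Q f) (≈ᴹ-trans (+ᴹ-identityˡ _) (actP-*P P Q (shift 1 f))))

  actP-Pπ : ∀ π f → actP (Pπ π) f ≈ᴹ Φ π f
  actP-Pπ []      f = ≈ᴹ-trans (+ᴹ-identityʳ _) (act-wordT [] (f 0))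
  actP-Pπ (e ∷ π) f = begin
    actP (τ-minus e *P Pπ π) f ≈⟨ actP-*P (τ-minus e) (Pπ π) f ⟩
    act (negT (edgeT e)) (y 0) +ᴹ (act 1T (y 1) +ᴹ 0ᴹ) ≈⟨ +ᴹ-cong
        (≈ᴹ-trans (act-negT (edgeT e) (y 0)) (-ᴹ‿cong (act-wordT (e ∷ []) (y 0))))
        (≈ᴹ-trans (+ᴹ-identityʳ _) (act-wordT [] (y 1))) ⟩
    (-ᴹ edge e (y 0)) +ᴹ y 1                         ≈⟨ +ᴹ-comm _ _ ⟩
    y 1 -ᴹ edge e (y 0) ≈⟨ -ᴹ-cong (actP-Pπ π (shift 1 f)) (IsLinear.resp (edge-linear e) (actP-Pπ π f)) ⟩
    Φ π (shift 1 f) -ᴹ edge e (Φ π f)                ∎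
    where
    open ≈ᴹ-Reasoning
    y = λ i → actP (Pπ π) (shift i f)

  actP-single : ∀ P i x → actP P (single i x) ≈ᴹ act (coeffP P i) x
  actP-single []      i       x = ≈ᴹ-refl
  actP-single (p ∷ P) zero    x = +0≈ (IsLinear.≈0-homo (actP-linear P) (λ j → single-≢ 0 (suc j) x λ ()))
  actP-single (p ∷ P) (suc i) x = ≈ᴹ-trans
    (0+≈ (IsLinear.≈0-homo (act-linear p) (single-≢ (suc i) 0 x λ ())))
    (≈ᴹ-trans (IsLinear.resp (actP-linear P) (single-suc i x)) (actP-single P i x))

  -- A one-term sequence picks out one coefficient of P_π; e(π, k) belongs to the power of τ with
  -- exponent `length π ∸ k`.
  act-eπ : ∀ π k x → act (eπ π k) x ≈ᴹ Φ π (single (length π ∸ k) x)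
  act-eπ π k x = ≈ᴹ-trans (≈ᴹ-sym (actP-single (Pπ π) _ x)) (actP-Pπ π _)

  parallel-length : ∀ {v w π₁ π₂} → IsPath v w π₁ → IsPath v w π₂ → length π₁ ≡ length π₂
  parallel-length {w = w} {π₁} {π₂} p₁ p₂ =
    ℕₚ.+-cancelʳ-≡ (level w) _ _ (trans (sym (path-level π₁ p₁)) (path-level π₂ p₂))

  module _ (Φ-parallel : ∀ {v w π₁ π₂} → IsPath v w π₁ → IsPath v w π₂ → ∀ f → Φ π₁ f ≈ᴹ Φ π₂ f) where

    act-genT : ∀ g x → act (genT g) x ≈ᴹ 0ᴹ
    act-genT g x = begin
      act (genT g) x ≈⟨ act-+T (eπ π₁ k) (negT (eπ π₂ k)) x ⟩
      act (eπ π₁ k) x +ᴹ act (negT (eπ π₂ k)) x ≈⟨ +ᴹ-congˡ (act-negT (eπ π₂ k) x) ⟩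
      act (eπ π₁ k) x -ᴹ act (eπ π₂ k) x ≈⟨ x≈y⇒x-y≈0 (≈ᴹ-trans (act-eπ π₁ k x) (≈ᴹ-trans (Φ-parallel path₁ path₂ _)
          (≈ᴹ-trans same-length (≈ᴹ-sym (act-eπ π₂ k x))))) ⟩
      0ᴹ                                            ∎
      where
      open ≈ᴹ-Reasoning
      open Gen g
      same-length : Φ π₂ (single (length π₁ ∸ k) x) ≈ᴹ Φ π₂ (single (length π₂ ∸ k) x)
      same-length = ≈ᴹ-reflexive (cong (λ n → Φ π₂ (single (n ∸ k) x)) (parallel-length path₁ path₂))

    act-InR : ∀ {p} → InR p → ∀ x → act p x ≈ᴹ 0ᴹ
    act-InR {p} (L , p≈) x = act-generated _ L p≈ λ (k , u , g , w) →
      ≈ᴹ-trans (act-scaleT k (wordT u *T (genT g *T wordT w)) x) (*0≈0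
        (≈ᴹ-trans (act-*T (wordT u) (genT g *T wordT w) x) (IsLinear.≈0-homo (act-linear (wordT u))
          (≈ᴹ-trans (act-*T (genT g) (wordT w) x) (act-genT g (act (wordT w) x))))))
      where
      act-generated : ∀ {i} {I : Set i} (g : I → TE) (is : List I) → p ≈T concatMap g is →
        (∀ j → act (g j) x ≈ᴹ 0ᴹ) → act p x ≈ᴹ 0ᴹ
      act-generated g is p≈ z =
        ≈ᴹ-trans (eval-≈T (λ u → word u x) {p} {concatMap g is} p≈) (≈ᴹ-trans (∑-concatMap g is _) (∑-zero is z))

-- Invariance of the functions supported on normal words

module NormalSupport {c ℓ : Level} (F : Field c ℓ) (Γ : Graph)
    (_>?_ : Decidable₂ (GraphNotions._>V_ Γ)) where
  open GraphLemmas Γ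
  open NormalWords Γ _>?_
  open WordModule F Γ _>?_
  open NormalForms F Γ _>?_
  open ModuleLemmas M
  open Sequences M
  private
    module F = Field F
    module S = ModuleLemmas S

  Supported : Carrierᴹ → Set ℓ
  Supported x = ∀ W → ¬ Normal W → x W F.≈ F.0#

  supported-resp : ∀ {x y} → x ≈ᴹ y → Supported y → Supported x
  supported-resp p s W ¬n = F.trans (p W) (s W ¬n)

  supported-0 : Supported 0ᴹ
  supported-0 _ _ = F.refl

  supported-- : ∀ {x y} → Supported x → Supported y → Supported (x -ᴹ y)
  supported-- {x} {y} s t W ¬n = ModuleLemmas.0-0≈0 (TensorUnit.leftModule {R = R}) (s W ¬n) (t W ¬n)

  supported-single : ∀ i {x} → Supported x → ∀ j → Supported (single i x j)
  supported-single i s j with j ℕ.≟ i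
  ... | yes _ = s
  ... | no  _ = supported-0

  -- When W is normal and i < |v|, the word (v , i) W can fail to be normal only if W begins with a
  -- vertex u < v of level i, and reducedness makes `f i` vanish at exactly such W.
  prepend-supported : ∀ v {f} → (∀ i → i < level v → Supported (f i)) → Reduced (down v) f → Supported (prepend v f)
  prepend-supported v {f} s red []            ¬n = F.refl
  prepend-supported v {f} s red ((u , i) ∷ W) ¬n with u ≟F v | i ℕ.<? level v
  ... | no  _      | _     = F.refl
  ... | yes _      | no  _ = F.refl
  ... | yes refl | yes i<n with normal? W
  ...   | no  ¬nW = s i i<n W ¬nW
  ...   | yes nW  = covered W nW (λ fits → ¬n (i<n , fits , nW))
    where
    covered : ∀ W → Normal W → ¬ Fits (v , i) W → f i W F.≈ F.0#
    covered []            _         ¬fits = ⊥-elim (¬fits tt)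
    covered ((w , j) ∷ W) (j<m , _) ¬fits with v >? w | level w ℕ.≟ i
    ... | yes v>w | yes refl = red (∈-down⁺ v>w) j j<m W
    ... | yes v>w | no  ≢      = ⊥-elim (¬fits (λ (_ , p) → ≢ p))
    ... | no  v≯w | _          = ⊥-elim (¬fits (λ (p , _) → v≯w p))

  private
    NextSupported : Vert → Set (c ⊔ ℓ)
    NextSupported v = ∀ f → (∀ i → i < level v → Supported (f i)) → Supported (T.next v f)

    extend-supported′ : ∀ {u} → NextSupported u → ∀ f → (∀ i → i < level u → Supported (f i)) →
      ∀ b i → i < b → Supported (T.extend u f i)
    extend-supported′ {u} next-s f s (suc b) i (s≤s i≤b) with i ℕ.<? level u
    ... | yes i<n = supported-resp (T.extend-init u f i i<n) (s i i<n)
    ... | no  i≮n = supported-resp (T.extend-late u f n≤i)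
      (next-s _ (λ j j<n → extend-supported′ next-s f s b _
        (ℕₚ.<-≤-trans (subst ((i ∸ level u) ℕ.+ j <_) (ℕₚ.m∸n+n≡m n≤i) (ℕₚ.+-monoʳ-< (i ∸ level u) j<n)) i≤b)))
      where n≤i = ℕₚ.≮⇒≥ i≮n

    reduce-supported′ : ∀ us → (∀ {u} → u ∈ us → NextSupported u) →
      ∀ f → (∀ i → Supported (f i)) → ∀ i → Supported (reduce us f i)
    reduce-supported′ []       next-s f s = s
    reduce-supported′ (u ∷ us) next-s f s = reduce-supported′ us (λ u∈ → next-s (there u∈)) _
      (λ i → supported-- (s i) (extend-supported′ (next-s (here refl)) _
        (λ j j<n W ¬n → s (level u) ((u , j) ∷ W) (λ (_ , _ , nW) → ¬n nW)) (suc i) i ℕₚ.≤-refl))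

    part-reduced : ∀ a {x} → Supported x → Reduced (down a) (part a x)
    part-reduced a s {u} u∈ j j<m W = s _ (λ (_ , fits , _) → fits (∈-down⁻ u∈ , refl))

    -- Clearing a is exact because, for f supported on normal words, the initial terms of its
    -- correction are already reduced. The later vertices do not undo it: their solutions have no
    -- word beginning with a at term |a|.
    reduced-reduce : ∀ {us} → Descending us → (∀ {u} → u ∈ us → NextSupported u) →
      ∀ f → (∀ i → Supported (f i)) → Reduced us (reduce us f)
    reduced-reduce {a ∷ as} d next-s f s (there u∈) =
      reduced-reduce tail-descending (λ u∈ → next-s (there u∈)) (f S.-ᴹ correction a f)
        (reduce-supported′ (a ∷ []) (λ { (here refl) → next-s (here refl) }) f s) u∈
      where open Descending-∷ d
    reduced-reduce {a ∷ as} d next-s f s (here refl) j j<n = begin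
      part a (reduce as g n) j ≈⟨ reduce-invariant (term-part-linear a n) as
          (λ u∈ → part-extend (proj₂ (head-above u∈)) (proj₁ (head-above u∈)) (proj₁ (head-above u∈))) g j ⟩
      part a (f n -ᴹ correction a f n) j ≈⟨ IsLinear.-‿homo (part-linear a) (f n) (correction a f n) j ⟩
      part a (f n) j -ᴹ part a (correction a f n) j ≈⟨ x≈y⇒x-y≈0 (≈ᴹ-sym own) ⟩
      0ᴹ                                                    ∎
      where
      open ≈ᴹ-Reasoning
      open Descending-∷ d
      n = level a
      g = f S.-ᴹ correction a f
      own : part a (correction a f n) j ≈ᴹ part a (f n) j
      own = begin
        part a (correction a f n) j ≈⟨ IsLinear.resp (part-linear a) (T.extend-next a (part a (f n))) j ⟩
        part a (T.next a (part a (f n))) j ≈⟨ part-next-≡ a (part a (f n)) j j<n ⟩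
        reduce (down a) (part a (f n)) j ≈⟨ reduce-reduced (down a) (part-reduced a (s n)) j ⟩
        part a (f n) j                             ∎

    next-supported-below : ∀ b {v} → level v < b → NextSupported v
    next-supported-below (suc b) {v} (s≤s n≤b) f s = supported-resp
      (T.next-local v (λ i i<n → ≈ᴹ-sym (truncate-< i<n)))
      (supported-resp (+ᴹ-congˡ (-ᴹ‿cong (family-Ψ v f′)))
        (supported-- (s′ n) (supported-- (reduce-supported′ (down v) lower f′ s′ n)
          (prepend-supported v (λ i _ → reduce-supported′ (down v) lower f′ s′ i)
            (reduced-reduce (down-descending v) lower f′ s′)))))
      where
      n = level v
      lower : ∀ {u} → u ∈ down v → NextSupported u
      lower u∈ = next-supported-below b (ℕₚ.<-≤-trans (down-level u∈) n≤b)
      -- The hypothesis concerns the terms before n, while the lemmas on `reduce` ask for all terms.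
      -- Setting the others to zero is invisible to `next`.
      f′ : Seq
      f′ i with i ℕ.<? n
      ... | yes _ = f i
      ... | no  _ = 0ᴹ
      truncate-< : ∀ {i} → i < n → f′ i ≈ᴹ f i
      truncate-< {i} i<n with i ℕ.<? n
      ... | yes _   = ≈ᴹ-refl
      ... | no  i≮n = ⊥-elim (i≮n i<n)
      s′ : ∀ i → Supported (f′ i)
      s′ i with i ℕ.<? n
      ... | yes i<n = s i i<n
      ... | no  _   = supported-0

  Ψ-supported : ∀ v f → (∀ i → Supported (f i)) → Supported (T.Ψ v f)
  Ψ-supported v f s = supported-resp (≈ᴹ-sym (x-[x-y]≈y (f (level v)) (T.Ψ v f)))
    (supported-- (s (level v)) (next-supported-below _ ℕₚ.≤-refl f (λ i _ → s i)))

  edge-supported : ∀ e {x} → Supported x → Supported (edgeᴹ e x)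
  edge-supported e s = supported--
    (Ψ-supported (hd e) _ (λ i → supported-single (level (hd e)) s (suc i)))
    (Ψ-supported (tl e) _ (supported-single (level (hd e)) s))

  δ-supported : ∀ {U} → Normal U → Supported (δ U)
  δ-supported {U} nU W ¬n = δ-≢ U W (λ { refl → ¬n nU })

  -- The one-term sequence is already reduced, since W does not begin with a covered letter; so
  -- nothing happens except that (v , i) is put in front.
  next-δ : ∀ v i W → Normal ((v , i) ∷ W) → T.next v (single i (δ W)) ≈ᴹ δ ((v , i) ∷ W)
  next-δ v i W (i<n , fits , nW) = begin
    f n -ᴹ T.Ψ v f ≈⟨ -ᴹ-cong ≈ᴹ-refl (family-Ψ v f) ⟩
    f n -ᴹ (reduce (down v) f n -ᴹ prepend v (reduce (down v) f)) ≈⟨ -ᴹ-cong ≈ᴹ-refl (-ᴹ-cong (red n) (IsLinear.resp (prepend-linear v) red)) ⟩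
    f n -ᴹ (f n -ᴹ prepend v f) ≈⟨ x-[x-y]≈y (f n) (prepend v f) ⟩
    prepend v f ≈⟨ value ⟩
    δ ((v , i) ∷ W)                                             ∎
    where
    open ≈ᴹ-Reasoning
    n = level v
    f = single i (δ W)
    uncovered : ∀ {u} j W′ → v >V u → Fits (v , level u) W → W ≢ (u , j) ∷ W′
    uncovered j W′ v>u fits refl = fits (v>u , refl)
    red : reduce (down v) f S.≈ᴹ f
    red = reduce-reduced (down v) λ {u} u∈ j _ W′ → f-reduced u (∈-down⁻ u∈) j W′
      where
      f-reduced : ∀ u → v >V u → ∀ j W′ → f (level u) ((u , j) ∷ W′) F.≈ F.0#
      f-reduced u v>u j W′ with level u ℕ.≟ i
      ... | yes refl = δ-≢ W _ (uncovered j W′ v>u fits)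
      ... | no  _      = F.refl
    tails : ∀ X → δ W X F.≈ δ ((v , i) ∷ W) ((v , i) ∷ X)
    tails X = at (W ≟L X)
      where
      at : Dec (W ≡ X) → δ W X F.≈ δ ((v , i) ∷ W) ((v , i) ∷ X)
      at (yes refl) = F.trans (δ-≡ W) (F.sym (δ-≡ ((v , i) ∷ W)))
      at (no W≢X)     = F.trans (δ-≢ W X W≢X) (F.sym (δ-≢ ((v , i) ∷ W) ((v , i) ∷ X) (λ p → W≢X (Listₚ.∷-injectiveʳ p))))
    value : prepend v f ≈ᴹ δ ((v , i) ∷ W)
    value []            = F.sym (δ-≢ ((v , i) ∷ W) [] (λ ()))
    value ((u , k) ∷ X) with u ≟F v | k ℕ.<? n
    ... | no  u≢v    | _       = F.sym (δ-≢ ((v , i) ∷ W) ((u , k) ∷ X) (λ { refl → u≢v refl }))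
    ... | yes _      | no  k≮n = F.sym (δ-≢ ((v , i) ∷ W) ((u , k) ∷ X) (λ { refl → k≮n i<n }))
    ... | yes refl | yes _ with k ℕ.≟ i
    ...   | yes refl = tails X
    ...   | no  k≢i    = F.sym (δ-≢ ((v , i) ∷ W) ((v , k) ∷ X) (λ { refl → k≢i refl }))

  act-supported : ∀ p {x} → Supported x → Supported (TensorAction.act F Γ M edgeᴹ edgeᴹ-linear p x)
  act-supported []            s = supported-0
  act-supported ((k , u) ∷ p) s W ¬n = ModuleLemmas.0+0≈0 (TensorUnit.leftModule {R = R})
    (F.trans (F.*-congˡ (word-supported u W ¬n)) (F.zeroʳ k)) (act-supported p s W ¬n)
    where
    word-supported : ∀ u → Supported (TensorAction.word F Γ M edgeᴹ edgeᴹ-linear u _)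
    word-supported []      = s
    word-supported (e ∷ u) = edge-supported e (word-supported u)

-- The algebra A(Γ)

-- Keeps the relation from unfolding, so that x and y can be inferred from the type of an equality
-- proof.
record Wrap {a p : Level} {A : Set a} (P : A → A → Set p) (x y : A) : Set p where
  constructor wrap
  field unwrap : P x y

open Wrap public

module _ {r ℓr : Level} (R : Ring r ℓr) {a ℓa : Level} (X : LeftModule R a ℓa) where
  open ModuleLemmas X
  open Ring R using () renaming (Carrier to K)

  quotient : ∀ {p} (N : Carrierᴹ → Set p) → (∀ {x y} → x ≈ᴹ y → N y → N x) → N 0ᴹ →
    (∀ {x y} → N x → N y → N (x +ᴹ y)) → (∀ k {x} → N x → N (k *ₗ x)) → LeftModule R a p
  quotient N N-resp N-0 N-+ N-* = record
    { Carrierᴹ     = Carrierᴹ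
    ; _≈ᴹ_         = Wrap (λ x y → N (x -ᴹ y))
    ; _+ᴹ_         = _+ᴹ_
    ; _*ₗ_         = _*ₗ_
    ; 0ᴹ           = 0ᴹ
    ; -ᴹ_          = -ᴹ_
    ; isLeftModule = record
      { isLeftSemimodule = record
        { +ᴹ-isCommutativeMonoid = record
          { isMonoid = record
            { isSemigroup = record
              { isMagma = record
                { isEquivalence = record
                  { refl  = ≈⇒ ≈ᴹ-refl
                  ; sym   = λ (wrap p) → wrap (symᴺ p)
                  ; trans = λ (wrap p) (wrap q) → wrap (transᴺ p q)
                  }
                ; ∙-cong = λ (wrap p) (wrap q) → wrap (N-resp (-‿interchange _ _ _ _) (N-+ p q))
                }
              ; assoc = λ x y z → ≈⇒ (+ᴹ-assoc x y z)
              }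
            ; identity = (λ x → ≈⇒ (+ᴹ-identityˡ x)) , (λ x → ≈⇒ (+ᴹ-identityʳ x))
            }
          ; comm = λ x y → ≈⇒ (+ᴹ-comm x y)
          }
        ; isPreleftSemimodule = record
          { *ₗ-cong      = λ {k} {l} {x} {y} k≈l (wrap p) →
              wrap (N-resp (≈ᴹ-trans (-ᴹ-cong ≈ᴹ-refl (*ₗ-congʳ (K.sym k≈l))) (≈ᴹ-sym (*ₗ-distribˡ-- k x y))) (N-* k p))
          ; *ₗ-zeroˡ     = λ x → ≈⇒ (*ₗ-zeroˡ x)
          ; *ₗ-distribʳ  = λ x k l → ≈⇒ (*ₗ-distribʳ x k l)
          ; *ₗ-identityˡ = λ x → ≈⇒ (*ₗ-identityˡ x)
          ; *ₗ-assoc     = λ k l x → ≈⇒ (*ₗ-assoc k l x)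
          ; *ₗ-zeroʳ     = λ k → ≈⇒ (*ₗ-zeroʳ k)
          ; *ₗ-distribˡ  = λ k x y → ≈⇒ (*ₗ-distribˡ k x y)
          }
        }
      ; -ᴹ‿cong    = λ {x} {y} (wrap p) → wrap (N-resp (neg-sub x y) (N-* (K.- K.1#) p))
      ; -ᴹ‿inverse = (λ x → ≈⇒ (-ᴹ‿inverseˡ x)) , (λ x → ≈⇒ (-ᴹ‿inverseʳ x))
      }
    }
    where
    module K = Ring R
    ≈⇒ : ∀ {x y} → x ≈ᴹ y → Wrap (λ x y → N (x -ᴹ y)) x y
    ≈⇒ p = wrap (N-resp (x≈y⇒x-y≈0 p) N-0)
    -1*x≈-x : ∀ x → (K.- K.1#) *ₗ x ≈ᴹ -ᴹ x
    -1*x≈-x x = x-y≈0⇒x≈y (≈ᴹ-trans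
      (+ᴹ-congˡ (≈ᴹ-trans (-‿involutive x) (≈ᴹ-sym (*ₗ-identityˡ x))))
      (≈ᴹ-trans (≈ᴹ-sym (*ₗ-distribʳ x _ _)) (≈ᴹ-trans (*ₗ-congʳ (K.-‿inverseˡ K.1#)) (*ₗ-zeroˡ x))))
      where open AbelianGroupₚ +ᴹ-abelianGroup renaming (⁻¹-involutive to -‿involutive)
    neg-sub : ∀ x y → (-ᴹ x) -ᴹ (-ᴹ y) ≈ᴹ (K.- K.1#) *ₗ (x -ᴹ y)
    neg-sub x y = ≈ᴹ-trans (-ᴹ-cong (≈ᴹ-sym (-1*x≈-x x)) (≈ᴹ-sym (-1*x≈-x y))) (≈ᴹ-sym (*ₗ-distribˡ-- _ x y))
    symᴺ : ∀ {x y} → N (x -ᴹ y) → N (y -ᴹ x)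
    symᴺ {x} {y} p = N-resp (≈ᴹ-trans (≈ᴹ-sym (⁻¹-anti-homo‿- x y)) (≈ᴹ-sym (-1*x≈-x (x -ᴹ y)))) (N-* (K.- K.1#) p)
      where open AbelianGroupₚ +ᴹ-abelianGroup
    transᴺ : ∀ {x y z} → N (x -ᴹ y) → N (y -ᴹ z) → N (x -ᴹ z)
    transᴺ {x} {y} {z} p q = N-resp (begin
      x -ᴹ z                    ≈⟨ -ᴹ-cong (x-y+y≈x x y) ≈ᴹ-refl ⟨
      ((x -ᴹ y) +ᴹ y) -ᴹ z      ≈⟨ +ᴹ-assoc _ _ _ ⟩
      (x -ᴹ y) +ᴹ (y -ᴹ z)      ∎) (N-+ p q)
      where open ≈ᴹ-Reasoning

  pullback : ∀ {b} {B : Set b} (ι : B → Carrierᴹ) (_⊕_ : B → B → B) (_⊙_ : K → B → B) (𝟘 : B) (⊖_ : B → B) →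
    (∀ x y → ι (x ⊕ y) ≈ᴹ ι x +ᴹ ι y) → (∀ k x → ι (k ⊙ x) ≈ᴹ k *ₗ ι x) → ι 𝟘 ≈ᴹ 0ᴹ → (∀ x → ι (⊖ x) ≈ᴹ -ᴹ ι x) →
    LeftModule R b ℓa
  pullback {B = B} ι _⊕_ _⊙_ 𝟘 ⊖_ ι-+ ι-* ι-0 ι-neg = record
    { Carrierᴹ     = B
    ; _≈ᴹ_         = Wrap (λ x y → ι x ≈ᴹ ι y)
    ; _+ᴹ_         = _⊕_
    ; _*ₗ_         = _⊙_
    ; 0ᴹ           = 𝟘
    ; -ᴹ_          = ⊖_
    ; isLeftModule = record
      { isLeftSemimodule = record
        { +ᴹ-isCommutativeMonoid = record
          { isMonoid = record
            { isSemigroup = record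
              { isMagma = record
                { isEquivalence = record { refl  = wrap ≈ᴹ-refl
                  ; sym   = λ (wrap p) → wrap (≈ᴹ-sym p)
                  ; trans = λ (wrap p) (wrap q) → wrap (≈ᴹ-trans p q)
                  }
                ; ∙-cong = λ (wrap p) (wrap q) → via (ι-+ _ _) (+ᴹ-cong p q) (ι-+ _ _)
                }
              ; assoc = λ x y z → via (≈ᴹ-trans (ι-+ _ _) (+ᴹ-congʳ (ι-+ x y))) (+ᴹ-assoc _ _ _)
                                      (≈ᴹ-trans (ι-+ _ _) (+ᴹ-congˡ (ι-+ y z)))
              }
            ; identity = (λ x → wrap (≈ᴹ-trans (ι-+ 𝟘 x) (0+≈ ι-0))) , (λ x → wrap (≈ᴹ-trans (ι-+ x 𝟘) (+0≈ ι-0)))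
            }
          ; comm = λ x y → via (ι-+ x y) (+ᴹ-comm _ _) (ι-+ y x)
          }
        ; isPreleftSemimodule = record
          { *ₗ-cong      = λ k≈l (wrap p) → via (ι-* _ _) (*ₗ-cong k≈l p) (ι-* _ _)
          ; *ₗ-zeroˡ     = λ x → via (ι-* _ x) (*ₗ-zeroˡ (ι x)) ι-0
          ; *ₗ-distribʳ  = λ x k l → via (ι-* _ x) (*ₗ-distribʳ (ι x) k l)
              (≈ᴹ-trans (ι-+ _ _) (+ᴹ-cong (ι-* k x) (ι-* l x)))
          ; *ₗ-identityˡ = λ x → wrap (≈ᴹ-trans (ι-* _ x) (*ₗ-identityˡ (ι x)))
          ; *ₗ-assoc     = λ k l x → via (ι-* _ x) (*ₗ-assoc k l (ι x)) (≈ᴹ-trans (ι-* k _) (*ₗ-congˡ (ι-* l x)))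
          ; *ₗ-zeroʳ     = λ k → via (ι-* k 𝟘) (*0≈0 ι-0) ι-0
          ; *ₗ-distribˡ  = λ k x y → via (≈ᴹ-trans (ι-* k _) (*ₗ-congˡ (ι-+ x y))) (*ₗ-distribˡ k (ι x) (ι y))
              (≈ᴹ-trans (ι-+ _ _) (+ᴹ-cong (ι-* k x) (ι-* k y)))
          }
        }
      ; -ᴹ‿cong    = λ (wrap p) → via (ι-neg _) (-ᴹ‿cong p) (ι-neg _)
      ; -ᴹ‿inverse = (λ x → via (≈ᴹ-trans (ι-+ _ x) (+ᴹ-congʳ (ι-neg x))) (-ᴹ‿inverseˡ (ι x)) ι-0)
                   , (λ x → via (≈ᴹ-trans (ι-+ x _) (+ᴹ-congˡ (ι-neg x))) (-ᴹ‿inverseʳ (ι x)) ι-0)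
      }
    }
    where
    via : ∀ {x y u v} → ι x ≈ᴹ u → u ≈ᴹ v → ι y ≈ᴹ v → Wrap (λ x y → ι x ≈ᴹ ι y) x y
    via p q r = wrap (≈ᴹ-trans p (≈ᴹ-trans q (≈ᴹ-sym r)))

-- From the relations of A(Γ) to parallel paths

module ParallelPaths {c ℓ a ℓa : Level} (F : Field c ℓ) (Γ : Graph) (X : LeftModule (Field.ring F) a ℓa)
    (edge : Fin (Graph.nE Γ) → Endo X)
    (edge-linear : ∀ e → IsLinear (Field.ring F) X X (edge e)) where
  open GraphLemmas Γ
  open Alg F Γ
  open ModuleLemmas X
  open Sequences X
  open Paths X edge edge-linear
  open TensorAction F Γ X edge edge-linear
  private
    S = power (Field.ring F) ℕ X
    module S = ModuleLemmas S

  -- The relations equate the coefficients below the leading one, which settles sequences living at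
  -- positions before N. On the remainder H both polynomials, being monic of the same degree, merely
  -- read term N.
  genT-kills⇒parallel : (∀ g x → act (genT g) x ≈ᴹ 0ᴹ) →
    ∀ {v w π₁ π₂} → IsPath v w π₁ → IsPath v w π₂ → ∀ f → Φ π₁ f ≈ᴹ Φ π₂ f
  genT-kills⇒parallel kills {v} {w} {π₁} {π₂} p₁ p₂ f = begin
    Φ π₁ f ≈⟨ Φ₁.resp (S.x-y+y≈x f (truncate N)) ⟨
    Φ π₁ (H S.+ᴹ truncate N)             ≈⟨ Φ₁.+-homo H (truncate N) ⟩
    Φ π₁ H +ᴹ Φ π₁ (truncate N) ≈⟨ +ᴹ-cong leading (on-truncate N ℕₚ.≤-refl) ⟩
    Φ π₂ H +ᴹ Φ π₂ (truncate N)          ≈⟨ Φ₂.+-homo H (truncate N) ⟨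
    Φ π₂ (H S.+ᴹ truncate N) ≈⟨ Φ₂.resp (S.x-y+y≈x f (truncate N)) ⟩
    Φ π₂ f                               ∎
    where
    open ≈ᴹ-Reasoning
    module Φ₁ = IsLinear (Φ-linear π₁)
    module Φ₂ = IsLinear (Φ-linear π₂)
    N = length π₁
    N≡ : N ≡ length π₂
    N≡ = parallel-length p₁ p₂
    truncate : ℕ → Seq
    truncate m i with i ℕ.<? m
    ... | yes _ = f i
    ... | no  _ = 0ᴹ
    H = f S.-ᴹ truncate N
    H-low : ∀ i → i < N → H i ≈ᴹ 0ᴹ
    H-low i i<N with i ℕ.<? N
    ... | yes _   = x-x≈0 (f i)
    ... | no  i≮N = ⊥-elim (i≮N i<N)
    leading : Φ π₁ H ≈ᴹ Φ π₂ H
    leading = begin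
      Φ π₁ H          ≈⟨ Φ-monic π₁ H-low ⟩
      H N             ≡⟨ cong H N≡ ⟩
      H (length π₂) ≈⟨ Φ-monic π₂ (λ i i<N → H-low i (subst (i <_) (sym N≡) i<N)) ⟨
      Φ π₂ H          ∎
    truncate-suc : ∀ m → truncate (suc m) S.≈ᴹ truncate m S.+ᴹ single m (f m)
    truncate-suc m i with i ℕ.<? suc m | i ℕ.<? m
    ... | yes _    | yes i<m = ≈ᴹ-sym (+0≈ (single-≢ m i (f m) (ℕₚ.<⇒≢ i<m)))
    ... | no  i≮1+m | yes i<m = ⊥-elim (i≮1+m (ℕₚ.m≤n⇒m≤1+n i<m))
    ... | no  i≮1+m | no  _   = ≈ᴹ-sym (0+0≈0 ≈ᴹ-refl (single-≢ m i (f m) (λ { refl → i≮1+m ℕₚ.≤-refl })))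
    ... | yes i<1+m | no  i≮m with ℕₚ.≤-antisym (ℕₚ.≤-pred i<1+m) (ℕₚ.≮⇒≥ i≮m)
    ...   | refl = ≈ᴹ-sym (≈ᴹ-trans (+ᴹ-identityˡ _) (single-≡ i (f i)))
    on-single : ∀ m x → m < N → Φ π₁ (single m x) ≈ᴹ Φ π₂ (single m x)
    on-single m x m<N = begin
      Φ π₁ (single m x) ≡⟨ cong (λ j → Φ π₁ (single j x)) (ℕₚ.m∸[m∸n]≡n (ℕₚ.<⇒≤ m<N)) ⟨
      Φ π₁ (single (N ∸ (N ∸ m)) x)          ≈⟨ act-eπ π₁ (N ∸ m) x ⟨
      act (eπ π₁ (N ∸ m)) x ≈⟨ x-y≈0⇒x≈y (≈ᴹ-trans (+ᴹ-congˡ (≈ᴹ-sym (act-negT (eπ π₂ (N ∸ m)) x)))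
          (≈ᴹ-trans (≈ᴹ-sym (act-+T (eπ π₁ (N ∸ m)) _ x)) (kills gen x))) ⟩
      act (eπ π₂ (N ∸ m)) x                  ≈⟨ act-eπ π₂ (N ∸ m) x ⟩
      Φ π₂ (single (length π₂ ∸ (N ∸ m)) x) ≡⟨ cong (λ j → Φ π₂ (single j x))
          (trans (cong (_∸ (N ∸ m)) (sym N≡)) (ℕₚ.m∸[m∸n]≡n (ℕₚ.<⇒≤ m<N))) ⟩
      Φ π₂ (single m x)                      ∎
      where
      gen : Gen
      -- The coefficient of τ^m is e(π, N ∸ m); m < N makes this index at least 1, as a generator of
      -- R requires.
      gen = record { path₁ = p₁ ; path₂ = p₂ ; 1≤k = ℕₚ.m<n⇒0<n∸m m<N ; k≤len = ℕₚ.m∸n≤m N m }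
    on-truncate : ∀ m → m ≤ N → Φ π₁ (truncate m) ≈ᴹ Φ π₂ (truncate m)
    on-truncate zero    _   = ≈ᴹ-trans (Φ₁.≈0-homo (λ _ → ≈ᴹ-refl)) (≈ᴹ-sym (Φ₂.≈0-homo (λ _ → ≈ᴹ-refl)))
    on-truncate (suc m) m<N = begin
      Φ π₁ (truncate (suc m)) ≈⟨ Φ₁.resp (truncate-suc m) ⟩
      Φ π₁ (truncate m S.+ᴹ single m (f m)) ≈⟨ Φ₁.+-homo _ _ ⟩
      Φ π₁ (truncate m) +ᴹ Φ π₁ (single m (f m)) ≈⟨ +ᴹ-cong (on-truncate m (ℕₚ.<⇒≤ m<N)) (on-single m (f m) m<N) ⟩
      Φ π₂ (truncate m) +ᴹ Φ π₂ (single m (f m)) ≈⟨ Φ₂.+-homo _ _ ⟨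
      Φ π₂ (truncate m S.+ᴹ single m (f m)) ≈⟨ Φ₂.resp (truncate-suc m) ⟨
      Φ π₂ (truncate (suc m))                             ∎

-- Power series over a representation

module DelayedModule {r ℓr a ℓa : Level} {R : Ring r ℓr} (X : LeftModule R a ℓa) {nE : ℕ}
    (edge : Fin nE → Endo X)
    (edge-linear : ∀ e → IsLinear R X X (edge e)) where
  open ModuleLemmas X
  private
    S = power R ℕ X
    module S = ModuleLemmas S
    module Φ = Paths X edge edge-linear
    module Sq = Sequences X

  -- Sequences in X are read as power series in t with coefficients in X, and the edge e acts as t
  -- e. The degree of a word thus becomes visible even if X itself carries no grading.
  delayedEdge : Fin nE → S.Carrierᴹ → S.Carrierᴹ
  delayedEdge e x zero    = 0ᴹ
  delayedEdge e x (suc d) = edge e (x d)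

  delayedEdge-linear : ∀ e → IsLinear R S S (delayedEdge e)
  delayedEdge-linear e = pointwise-linear R S X λ
    { zero    → zero-linear R S X
    ; (suc d) → ∘-linear R S X X (edge-linear e) (eval-linear R X d) }

  open Paths S delayedEdge delayedEdge-linear

  -- The terms of degree d ∸ (L ∸ i), the only ones contributing to the degree d part of Φ π f for a path π
  -- of length L; the term is 0 when that degree would be negative.
  slice : ℕ → ℕ → (ℕ → S.Carrierᴹ) → Sq.Seq
  slice L d f i with L ℕ.≤? d ℕ.+ i
  ... | yes _ = f i (d ℕ.+ i ∸ L)
  ... | no  _ = 0ᴹ

  private
    slice-shift : ∀ L d f → Sq.shift 1 (slice (suc L) d f) S.≈ᴹ slice L d (λ i → f (suc i))
    slice-shift L d f i with suc L ℕ.≤? d ℕ.+ suc i | L ℕ.≤? d ℕ.+ i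
    ... | yes _ | yes _ = ≈ᴹ-reflexive (cong (λ n → f (suc i) (n ∸ suc L)) (ℕₚ.+-suc d i))
    ... | no  _ | no  _ = ≈ᴹ-refl
    ... | yes p | no ¬q = ⊥-elim (¬q (ℕₚ.≤-pred (subst (suc L ≤_) (ℕₚ.+-suc d i) p)))
    ... | no ¬p | yes q = ⊥-elim (¬p (subst (suc L ≤_) (sym (ℕₚ.+-suc d i)) (s≤s q)))

    slice-suc : ∀ L d f → slice (suc L) (suc d) f S.≈ᴹ slice L d f
    slice-suc L d f i with suc L ℕ.≤? suc d ℕ.+ i | L ℕ.≤? d ℕ.+ i
    ... | yes _ | yes _ = ≈ᴹ-refl
    ... | no  _ | no  _ = ≈ᴹ-refl
    ... | yes p | no ¬q = ⊥-elim (¬q (ℕₚ.≤-pred p))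
    ... | no ¬p | yes q = ⊥-elim (¬p (s≤s q))

    slice-low : ∀ L f i → i < L → slice L 0 f i ≈ᴹ 0ᴹ
    slice-low L f i i<L with L ℕ.≤? i
    ... | yes L≤i = ⊥-elim (ℕₚ.<⇒≱ i<L L≤i)
    ... | no  _   = ≈ᴹ-refl

  Φ-slice : ∀ π f d → Φ π f d ≈ᴹ Φ.Φ π (slice (length π) d f)
  Φ-slice []      f d = ≈ᴹ-reflexive (cong (f 0) (sym (ℕₚ.+-identityʳ d)))
  Φ-slice (e ∷ π) f d = -ᴹ-cong
    (≈ᴹ-trans (Φ-slice π (λ i → f (suc i)) d) (IsLinear.resp (Φ.Φ-linear π) (S.≈ᴹ-sym (slice-shift (length π) d f))))
    (delayed d)
    where
    L = length π
    delayed : ∀ d → delayedEdge e (Φ π f) d ≈ᴹ edge e (Φ.Φ π (slice (suc L) d f))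
    delayed zero    = ≈ᴹ-sym (IsLinear.≈0-homo (edge-linear e)
      (≈ᴹ-trans (Φ.Φ-monic π (λ i i<L → slice-low (suc L) f i (ℕₚ.m≤n⇒m≤1+n i<L))) (slice-low (suc L) f L ℕₚ.≤-refl)))
    delayed (suc d) = IsLinear.resp (edge-linear e)
      (≈ᴹ-trans (Φ-slice π f d) (IsLinear.resp (Φ.Φ-linear π) (S.≈ᴹ-sym (slice-suc L d f))))

  private
    slice-vanishing : ∀ L d f i → i < L → (∀ d′ → d′ < d → f i d′ ≈ᴹ 0ᴹ) → slice L d f i ≈ᴹ 0ᴹ
    slice-vanishing L d f i i<L z with L ℕ.≤? d ℕ.+ i
    ... | no  _ = ≈ᴹ-refl
    ... | yes p = z _ (subst (d ℕ.+ i ∸ L <_) (ℕₚ.m+n∸n≡m d L) (ℕₚ.∸-monoˡ-< (ℕₚ.+-monoʳ-< d i<L) p))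

    slice-top : ∀ L d f → slice L d f L ≈ᴹ f L d
    slice-top L d f with L ℕ.≤? d ℕ.+ L
    ... | yes _ = ≈ᴹ-reflexive (cong (f L) (ℕₚ.m+n∸n≡m d L))
    ... | no ≰  = ⊥-elim (≰ (ℕₚ.m≤n+m L d))

    slice-none : ∀ L d f i → d ℕ.+ i < L → slice L d f i ≈ᴹ 0ᴹ
    slice-none L d f i d+i<L with L ℕ.≤? d ℕ.+ i
    ... | yes p = ⊥-elim (ℕₚ.<⇒≱ d+i<L p)
    ... | no  _ = ≈ᴹ-refl

    slice-some : ∀ L D f i → i ≤ L → slice L (L ∸ i ℕ.+ D) f i ≈ᴹ f i D
    slice-some L D f i i≤L with L ℕ.≤? L ∸ i ℕ.+ D ℕ.+ i
    ... | yes _ = ≈ᴹ-reflexive (cong (f i) (trans (cong (_∸ L) arith) (ℕₚ.m+n∸m≡n L D)))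
      where
      arith : L ∸ i ℕ.+ D ℕ.+ i ≡ L ℕ.+ D
      arith = trans (ℕₚ.+-assoc (L ∸ i) D i) (trans (cong (L ∸ i ℕ.+_) (ℕₚ.+-comm D i))
        (trans (sym (ℕₚ.+-assoc (L ∸ i) i D)) (cong (ℕ._+ D) (ℕₚ.m∸n+n≡m i≤L))))
    ... | no ≰  = ⊥-elim (≰ (ℕₚ.≤-trans (ℕₚ.≤-reflexive (sym (ℕₚ.m∸n+n≡m i≤L))) (ℕₚ.+-monoˡ-≤ i (ℕₚ.m≤m+n (L ∸ i) D))))

    slice-0 : ∀ L d f i → (∀ d → f i d ≈ᴹ 0ᴹ) → slice L d f i ≈ᴹ 0ᴹ
    slice-0 L d f i z with L ℕ.≤? d ℕ.+ i
    ... | yes _ = z _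
    ... | no  _ = ≈ᴹ-refl

  module _ (y : S.Carrierᴹ) where
    private
      module SqS = Sequences S
      s = λ i → SqS.single i y

    slice-single : ∀ L D i → i ≤ L → slice L (L ∸ i ℕ.+ D) (s i) S.≈ᴹ Sq.single i (y D)
    slice-single L D i i≤L j with j ℕ.≟ i
    ... | yes refl = ≈ᴹ-trans (slice-some L D (s i) i i≤L) (SqS.single-≡ i y D)
    ... | no  j≢i    = slice-0 L _ (s i) j (SqS.single-≢ i j y j≢i)

    slice-single-0 : ∀ L d i → i ≤ L → (∀ D → L ∸ i ℕ.+ D ≡ d → y D ≈ᴹ 0ᴹ) → slice L d (s i) S.≈ᴹ S.0ᴹ
    slice-single-0 L d i i≤L z j with j ℕ.≟ i
    ... | no  j≢i    = slice-0 L _ (s i) j (SqS.single-≢ i j y j≢i)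
    ... | yes refl with ℕₚ.<-≤-connex (d ℕ.+ i) L
    ...   | inj₁ d+i<L = slice-none L d (s i) i d+i<L
    ...   | inj₂ L≤d+i = ≈ᴹ-trans (≈ᴹ-reflexive (cong (λ d → slice L d (s i) i) (sym arith)))
      (≈ᴹ-trans (slice-some L D (s i) i i≤L) (≈ᴹ-trans (SqS.single-≡ i y D) (z D arith)))
      where
      D = d ∸ (L ∸ i)
      arith : L ∸ i ℕ.+ D ≡ d
      arith = ℕₚ.m+[n∸m]≡n (ℕₚ.m≤n+o⇒m∸n≤o L i (subst (L ≤_) (ℕₚ.+-comm d i) L≤d+i))

  -- Every coefficient of P_π except the leading one contains an edge, so it moves terms of order at
  -- least k to order at least k + 1.
  Φ-top : ∀ π k f → (∀ i d → d < k → f i d ≈ᴹ 0ᴹ) → ∀ d → d < suc k → Φ π f d ≈ᴹ f (length π) d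
  Φ-top π k f z d (s≤s d≤k) = begin
    Φ π f d                          ≈⟨ Φ-slice π f d ⟩
    Φ.Φ π (slice (length π) d f) ≈⟨ Φ.Φ-monic π (λ i i<L → slice-vanishing (length π) d f i i<L
        (λ d′ d′<d → z i d′ (ℕₚ.<-≤-trans d′<d d≤k))) ⟩
    slice (length π) d f (length π)  ≈⟨ slice-top (length π) d f ⟩
    f (length π) d                   ∎
    where open ≈ᴹ-Reasoning

module Equivariant {c ℓ a ℓa b ℓb : Level} (F : Field c ℓ) (Γ : Graph)
    (X : LeftModule (Field.ring F) a ℓa)
    (edgeX : Fin (Graph.nE Γ) → Endo X)
    (edgeX-linear : ∀ e → IsLinear (Field.ring F) X X (edgeX e))
    (Y : LeftModule (Field.ring F) b ℓb)
    (edgeY : Fin (Graph.nE Γ) → Endo Y)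
    (edgeY-linear : ∀ e → IsLinear (Field.ring F) Y Y (edgeY e))
    (f : LeftModule.Carrierᴹ X → LeftModule.Carrierᴹ Y)
    (f-linear : IsLinear (Field.ring F) X Y f)
    (f-edge : ∀ e x → LeftModule._≈ᴹ_ Y (f (edgeX e x)) (edgeY e (f x))) where
  private
    module X  = ModuleLemmas X
    module Y  = ModuleLemmas Y
    module f  = IsLinear f-linear
    module AX = TensorAction F Γ X edgeX edgeX-linear
    module AY = TensorAction F Γ Y edgeY edgeY-linear
    module PX = Paths X edgeX edgeX-linear
    module PY = Paths Y edgeY edgeY-linear

  word-equivariant : ∀ u x → f (AX.word u x) Y.≈ᴹ AY.word u (f x)
  word-equivariant []      x = Y.≈ᴹ-refl
  word-equivariant (e ∷ u) x = Y.≈ᴹ-trans (f-edge e (AX.word u x)) (IsLinear.resp (edgeY-linear e) (word-equivariant u x))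

  act-equivariant : ∀ p x → f (AX.act p x) Y.≈ᴹ AY.act p (f x)
  act-equivariant p x = Y.≈ᴹ-trans (f.∑-homo p _)
    (Y.∑-cong p λ (k , u) → Y.≈ᴹ-trans (f.*-homo k (AX.word u x)) (Y.*ₗ-congˡ (word-equivariant u x)))

  Φ-equivariant : ∀ π s → f (PX.Φ π s) Y.≈ᴹ PY.Φ π (λ i → f (s i))
  Φ-equivariant []      s = Y.≈ᴹ-refl
  Φ-equivariant (e ∷ π) s = Y.≈ᴹ-trans (f.-‿homo (PX.Φ π (λ i → s (suc i))) (edgeX e (PX.Φ π s)))
    (Y.-ᴹ-cong (Φ-equivariant π (λ i → s (suc i)))
      (Y.≈ᴹ-trans (f-edge e (PX.Φ π s)) (IsLinear.resp (edgeY-linear e) (Φ-equivariant π s))))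

-- T(E) and A(Γ) as modules

module TensorAlgebra {c ℓ : Level} (F : Field c ℓ) (Γ : Graph) where
  open GraphLemmas Γ
  open Alg F Γ
  private
    module F = Field F
    R = F.ring
    𝔽 = TensorUnit.leftModule {R = R}

  coeff-+T : ∀ p q w → coeff (p +T q) w F.≈ coeff p w F.+ coeff q w
  coeff-+T []            q w = F.sym (F.+-identityˡ _)
  coeff-+T ((k , u) ∷ p) q w with u ≟W w
  ... | yes _ = F.trans (F.+-congˡ (coeff-+T p q w)) (F.sym (F.+-assoc k (coeff p w) (coeff q w)))
  ... | no  _ = coeff-+T p q w

  coeff-scaleT : ∀ k p w → coeff (scaleT k p) w F.≈ k F.* coeff p w
  coeff-scaleT k []            w = F.sym (F.zeroʳ k)
  coeff-scaleT k ((l , u) ∷ p) w with u ≟W w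
  ... | yes _ = F.trans (F.+-congˡ (coeff-scaleT k p w)) (F.sym (F.distribˡ k l (coeff p w)))
  ... | no  _ = coeff-scaleT k p w

  𝕋 : LeftModule R c ℓ
  𝕋 = pullback R (power R Word 𝔽) coeff _+T_ scaleT 0T negT coeff-+T coeff-scaleT (λ _ → F.refl)
    (λ p w → F.trans (coeff-scaleT (F.- F.1#) p w) (Ringₚ.-1*x≈-x R (coeff p w)))

  open ModuleLemmas 𝕋

  scaleT-wordT : ∀ k u p → scaleT k (wordT u) +T p ≈ᴹ (k , u) ∷ p
  scaleT-wordT k u p = wrap at
    where
    at : (scaleT k (wordT u) +T p) ≈T ((k , u) ∷ p)
    at w with u ≟W w
    ... | yes _ = F.+-congʳ (F.*-identityʳ k)
    ... | no  _ = F.refl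

  -- Left multiplication by e. With these edge operators the product of T(E) becomes the action of
  -- T(E) on itself.
  cons : Edge → TE → TE
  cons e = map (λ (k , u) → k , e ∷ u)

  private
    coeff-≡ : ∀ k u p → coeff ((k , u) ∷ p) u ≡ k F.+ coeff p u
    coeff-≡ k u p with u ≟W u
    ... | yes _ = refl
    ... | no ≢  = ⊥-elim (≢ refl)

    coeff-≢ : ∀ k u p w → u ≢ w → coeff ((k , u) ∷ p) w ≡ coeff p w
    coeff-≢ k u p w u≢w with u ≟W w
    ... | yes u≡w = ⊥-elim (u≢w u≡w)
    ... | no  _   = refl

    coeff-cons-≡ : ∀ e p w → coeff (cons e p) (e ∷ w) F.≈ coeff p w
    coeff-cons-≡ e []            w = F.refl
    coeff-cons-≡ e ((k , u) ∷ p) w = at (u ≟W w)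
      where
      at : Dec (u ≡ w) → coeff (cons e ((k , u) ∷ p)) (e ∷ w) F.≈ coeff ((k , u) ∷ p) w
      at (yes refl) = F.trans (F.reflexive (coeff-≡ k (e ∷ u) (cons e p)))
        (F.trans (F.+-congˡ (coeff-cons-≡ e p u)) (F.reflexive (sym (coeff-≡ k u p))))
      at (no u≢w)     = F.trans (F.reflexive (coeff-≢ k (e ∷ u) (cons e p) (e ∷ w) (λ eq → u≢w (Listₚ.∷-injectiveʳ eq))))
        (F.trans (coeff-cons-≡ e p w) (F.reflexive (sym (coeff-≢ k u p w u≢w))))

    coeff-cons-≢ : ∀ e p w → (∀ u → e ∷ u ≢ w) → coeff (cons e p) w F.≈ F.0#
    coeff-cons-≢ e []            w ≢ = F.refl
    coeff-cons-≢ e ((k , u) ∷ p) w ≢ with (e ∷ u) ≟W w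
    ... | yes eq = ⊥-elim (≢ u eq)
    ... | no  _  = coeff-cons-≢ e p w ≢

    cons-cong : ∀ e {p q} → p ≈T q → cons e p ≈T cons e q
    cons-cong e {p} {q} p≈q []       = F.trans (coeff-cons-≢ e p [] (λ _ ())) (F.sym (coeff-cons-≢ e q [] (λ _ ())))
    cons-cong e {p} {q} p≈q (e′ ∷ w) with e ≟F e′
    ... | yes refl = F.trans (coeff-cons-≡ e p w) (F.trans (p≈q w) (F.sym (coeff-cons-≡ e q w)))
    ... | no  e≢e′   = F.trans (coeff-cons-≢ e p (e′ ∷ w) ≢) (F.sym (coeff-cons-≢ e q (e′ ∷ w) ≢))
      where
      ≢ : ∀ u → e ∷ u ≢ e′ ∷ w
      ≢ u p = e≢e′ (Listₚ.∷-injectiveˡ p)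

  cons-linear : ∀ e → IsLinear R 𝕋 𝕋 (cons e)
  cons-linear e = record
    { resp   = λ {p} {q} (wrap p≈q) → wrap (cons-cong e {p} {q} p≈q)
    ; +-homo = λ p q → ≈ᴹ-reflexive (Listₚ.map-++ _ p q)
    ; *-homo = λ k p → ≈ᴹ-reflexive (trans (sym (Listₚ.map-∘ p)) (Listₚ.map-∘ p))
    }

  open TensorAction F Γ 𝕋 cons cons-linear

  private
    scaleT-word : ∀ k u q → scaleT k (word u q) ≡ map (λ (l , w) → k F.* l , u ++ w) q
    scaleT-word k u []            = cong (scaleT k) (word-[] u)
      where
      word-[] : ∀ u → word u [] ≡ []
      word-[] []      = refl
      word-[] (e ∷ u) = cong (cons e) (word-[] u)
    scaleT-word k u ((l , w) ∷ q) = trans (cong (scaleT k) (word-∷ u)) (cong (_ ∷_) (scaleT-word k u q))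
      where
      word-∷ : ∀ u → word u ((l , w) ∷ q) ≡ (l , u ++ w) ∷ word u q
      word-∷ []      = refl
      word-∷ (e ∷ u) = cong (cons e) (word-∷ u)

    *T≡act : ∀ p q → p *T q ≡ act p q
    *T≡act []            q = refl
    *T≡act ((k , u) ∷ p) q = cong₂ _++_ (sym (scaleT-word k u q)) (*T≡act p q)

    Term : Set c
    Term = F.Carrier × Word × Gen × Word

    term : Term → TE
    term (k , u , g , w) = scaleT k (word u (act (genT g) (wordT w)))

    -- The ideal R expressed by module sums and the action; its closure properties become operations
    -- on the lists of terms.
    Generated : TE → Set (c ⊔ ℓ)
    Generated p = Σ (List Term) λ L → p ≈ᴹ ∑ L term

    *T-term : ∀ k u g w → scaleT k (wordT u *T (genT g *T wordT w)) ≈ᴹ term (k , u , g , w)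
    *T-term k u g w = *ₗ-congˡ (begin
      wordT u *T (genT g *T wordT w) ≡⟨ *T≡act (wordT u) (genT g *T wordT w) ⟩
      act (wordT u) (genT g *T wordT w) ≈⟨ act-wordT u (genT g *T wordT w) ⟩
      word u (genT g *T wordT w) ≡⟨ cong (word u) (*T≡act (genT g) (wordT w)) ⟩
      word u (act (genT g) (wordT w))       ∎)
      where open ≈ᴹ-Reasoning

    concatMap≈∑ : ∀ (f : Term → TE) L → (∀ t → f t ≈ᴹ term t) → concatMap f L ≈ᴹ ∑ L term
    concatMap≈∑ f []      f≈ = ≈ᴹ-refl
    concatMap≈∑ f (t ∷ L) f≈ = +ᴹ-cong (f≈ t) (concatMap≈∑ f L f≈)

    InR⇒Generated : ∀ {p} → InR p → Generated p
    InR⇒Generated {p} (L , p≈) = L , via _ L p≈ λ (k , u , g , w) → *T-term k u g w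
      where
      via : ∀ (f : Term → TE) L → p ≈T concatMap f L → (∀ t → f t ≈ᴹ term t) → p ≈ᴹ ∑ L term
      via f L p≈ f≈ = ≈ᴹ-trans (wrap p≈) (concatMap≈∑ f L f≈)

    Generated⇒InR : ∀ {p} → Generated p → InR p
    Generated⇒InR {p} (L , p≈) = L , via _ L p≈ λ (k , u , g , w) → *T-term k u g w
      where
      via : ∀ (f : Term → TE) L → p ≈ᴹ ∑ L term → (∀ t → f t ≈ᴹ term t) → p ≈T concatMap f L
      via f L p≈ f≈ = unwrap (≈ᴹ-trans p≈ (≈ᴹ-sym (concatMap≈∑ f L f≈)))

    generated-resp : ∀ {p q} → p ≈ᴹ q → Generated q → Generated p
    generated-resp p≈q (L , q≈) = L , ≈ᴹ-trans p≈q q≈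

    generated-+ : ∀ {p q} → Generated p → Generated q → Generated (p +T q)
    generated-+ (L , p≈) (L′ , q≈) = L ++ L′ , ≈ᴹ-trans (+ᴹ-cong p≈ q≈) (≈ᴹ-sym (∑-++ L L′ term))

    generated-map : ∀ (f : TE → TE) → IsLinear R 𝕋 𝕋 f → (g : Term → Term) → (∀ t → f (term t) ≈ᴹ term (g t)) →
      ∀ {p} → Generated p → Generated (f p)
    generated-map f f-linear g f≈g {p} (L , p≈) = map g L , (begin
      f p                          ≈⟨ f.resp p≈ ⟩
      f (∑ L term)                 ≈⟨ f.∑-homo L term ⟩
      ∑ L (λ t → f (term t))       ≈⟨ ∑-cong L f≈g ⟩
      ∑ L (λ t → term (g t))       ≈⟨ ∑-map g L term ⟨
      ∑ (map g L) term             ∎)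
      where
      module f = IsLinear f-linear
      open ≈ᴹ-Reasoning

    generated-* : ∀ k {p} → Generated p → Generated (scaleT k p)
    generated-* k {p} = generated-map (scaleT k) (scale-linear k) (λ (l , t) → k F.* l , t)
      (λ (l , u , g , w) → ≈ᴹ-sym (*ₗ-assoc k l (word u (act (genT g) (wordT w))))) {p}

    generated-cons : ∀ e {p} → Generated p → Generated (cons e p)
    generated-cons e {p} = generated-map (cons e) (cons-linear e) (λ (l , u , t) → l , e ∷ u , t)
      (λ (l , u , g , w) → IsLinear.*-homo (cons-linear e) l (word u (act (genT g) (wordT w)))) {p}

    -- The terms allow only a word as right factor, so a general right factor is split into its
    -- words by linearity.
    generated-gen : ∀ g q → Generated (act (genT g) q)
    generated-gen g []            = [] , IsLinear.0-homo (act-linear (genT g))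
    generated-gen g ((k , w) ∷ q) = generated-resp
      (begin
        A ((k , w) ∷ q) ≈⟨ A.resp (≈ᴹ-sym (scaleT-wordT k w q)) ⟩
        A (scaleT k (wordT w) +T q) ≈⟨ A.+-homo (scaleT k (wordT w)) q ⟩
        A (scaleT k (wordT w)) +T A q ≈⟨ +ᴹ-congʳ (A.*-homo k (wordT w)) ⟩
        term (k , [] , g , w) +T A q  ∎)
      (generated-+ ((k , [] , g , w) ∷ [] , ≈ᴹ-sym (+ᴹ-identityʳ (term (k , [] , g , w)))) (generated-gen g q))
      where
      open ≈ᴹ-Reasoning
      A = act (genT g)
      module A = IsLinear (act-linear (genT g))

  InR-resp : ∀ {p q} → p ≈ᴹ q → InR q → InR p
  InR-resp {p} {q} p≈q r = Generated⇒InR {p} (generated-resp p≈q (InR⇒Generated {q} r))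

  InR-+ : ∀ p q → InR p → InR q → InR (p +T q)
  InR-+ p q r s = Generated⇒InR {p +T q} (generated-+ (InR⇒Generated {p} r) (InR⇒Generated {q} s))

  InR-* : ∀ k p → InR p → InR (scaleT k p)
  InR-* k p r = Generated⇒InR {scaleT k p} (generated-* k (InR⇒Generated {p} r))

  InR-cons : ∀ e p → InR p → InR (cons e p)
  InR-cons e p r = Generated⇒InR {cons e p} (generated-cons e (InR⇒Generated {p} r))

  InR-gen : ∀ g q → InR (act (genT g) q)
  InR-gen g q = Generated⇒InR {act (genT g) q} (generated-gen g q)

  InR-0 : InR 0T
  InR-0 = [] , λ _ → F.refl

  -- Only the vector space A(Γ); its multiplication enters through the operators `cons e`.
  𝔸 : LeftModule R c (c ⊔ ℓ)
  𝔸 = quotient R 𝕋 InR InR-resp InR-0 (λ {p} {q} → InR-+ p q) (λ k {p} → InR-* k p)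

  private module 𝔸 = ModuleLemmas 𝔸

  ≈T⇒≈𝔸 : ∀ {p q} → p ≈ᴹ q → p 𝔸.≈ᴹ q
  ≈T⇒≈𝔸 p≈q = wrap (InR-resp (x≈y⇒x-y≈0 p≈q) InR-0)

  InR⇒≈0 : ∀ p → InR p → p 𝔸.≈ᴹ 0T
  InR⇒≈0 p r = wrap (InR-resp (x-0≈x p) r)

  ≈0⇒InR : ∀ {p} → p 𝔸.≈ᴹ 0T → InR p
  ≈0⇒InR {p} (wrap r) = InR-resp (≈ᴹ-sym (x-0≈x p)) r

  cons-linear-𝔸 : ∀ e → IsLinear R 𝔸 𝔸 (cons e)
  cons-linear-𝔸 e = record
    { resp   = λ {p} {q} (wrap r) → wrap (InR-resp (≈ᴹ-sym (cons.-‿homo p q)) (InR-cons e (p -ᴹ q) r))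
    ; +-homo = λ p q → ≈T⇒≈𝔸 (cons.+-homo p q)
    ; *-homo = λ k p → ≈T⇒≈𝔸 (cons.*-homo k p)
    }
    where module cons = IsLinear (cons-linear e)

  id-linear-𝔸 : IsLinear R 𝕋 𝔸 (λ p → p)
  id-linear-𝔸 = record
    { resp = ≈T⇒≈𝔸 ; +-homo = λ _ _ → 𝔸.≈ᴹ-refl ; *-homo = λ _ _ → 𝔸.≈ᴹ-refl }

  module Act𝔸 = TensorAction F Γ 𝔸 cons cons-linear-𝔸

  private
    act-genT-𝔸 : ∀ g q → Act𝔸.act (genT g) q 𝔸.≈ᴹ 0T
    act-genT-𝔸 g q = 𝔸.≈ᴹ-trans
      (𝔸.≈ᴹ-sym (Equivariant.act-equivariant F Γ 𝕋 cons cons-linear 𝔸 cons cons-linear-𝔸 (λ p → p) id-linear-𝔸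
        (λ _ _ → 𝔸.≈ᴹ-refl) (genT g) q))
      (InR⇒≈0 (act (genT g) q) (InR-gen g q))

  module Φ𝔸 = Paths 𝔸 cons cons-linear-𝔸

  Φ-parallel-𝔸 : ∀ {v w π₁ π₂} → IsPath v w π₁ → IsPath v w π₂ → ∀ f → Φ𝔸.Φ π₁ f 𝔸.≈ᴹ Φ𝔸.Φ π₂ f
  Φ-parallel-𝔸 = ParallelPaths.genT-kills⇒parallel F Γ 𝔸 cons cons-linear-𝔸 act-genT-𝔸

  private
    act-1T : ∀ p → act p 1T ≈ᴹ p
    act-1T []            = ≈ᴹ-refl
    act-1T ((k , u) ∷ p) = ≈ᴹ-trans
      (+ᴹ-cong (≈ᴹ-reflexive (cong (scaleT k) (word-1T u))) (act-1T p)) (scaleT-wordT k u p)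
      where
      word-1T : ∀ u → word u 1T ≡ wordT u
      word-1T []      = refl
      word-1T (e ∷ u) = cong (cons e) (word-1T u)

  act-1T-𝔸 : ∀ p → Act𝔸.act p 1T 𝔸.≈ᴹ p
  act-1T-𝔸 p = 𝔸.≈ᴹ-trans
    (𝔸.≈ᴹ-sym (Equivariant.act-equivariant F Γ 𝕋 cons cons-linear 𝔸 cons cons-linear-𝔸 (λ p → p) id-linear-𝔸
      (λ _ _ → 𝔸.≈ᴹ-refl) p 1T))
    (≈T⇒≈𝔸 (act-1T p))

-- A system of paths to a common vertex turns a representation in which parallel paths act equally
-- into a family of recurrences indexed by the vertices.
module PathFamily {r ℓr a ℓa : Level} {R : Ring r ℓr} (Γ : Graph) (X : LeftModule R a ℓa)
    (edge : Fin (Graph.nE Γ) → Endo X)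
    (edge-linear : ∀ e → IsLinear R X X (edge e))
    (star : GraphNotions.Vert Γ) (star-level : Graph.level Γ star ≡ 0)
    (toStar : ∀ v → Σ (List (Fin (Graph.nE Γ))) (GraphNotions.IsPath Γ v star))
    (parallel : ∀ {v w π₁ π₂} → GraphNotions.IsPath Γ v w π₁ → GraphNotions.IsPath Γ v w π₂ →
      ∀ f → LeftModule._≈ᴹ_ X (Paths.Φ X edge edge-linear π₁ f) (Paths.Φ X edge edge-linear π₂ f)) where
  open GraphLemmas Γ
  open ModuleLemmas X
  open Sequences X
  open Paths X edge edge-linear

  path : Vert → List Edge
  path v = proj₁ (toStar v)

  path-isPath : ∀ v → IsPath v star (path v)
  path-isPath v = proj₂ (toStar v)

  path-length : ∀ v → length (path v) ≡ level v
  path-length v = sym (trans (path-level (path v) (path-isPath v))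
    (trans (cong (length (path v) ℕ.+_) star-level) (ℕₚ.+-identityʳ _)))

  pathRecurrence : ∀ v → Recurrence (level v)
  pathRecurrence v = record
    { Ψ        = Φ (path v)
    ; Ψ-linear = Φ-linear (path v)
    ; Ψ-monic  = λ {f} z → ≈ᴹ-trans
        (Φ-monic (path v) (λ i i<n → z i (subst (i <_) (path-length v) i<n)))
        (≈ᴹ-reflexive (cong f (path-length v)))
    }

  module Rec (v : Vert) = Recurrence (pathRecurrence v)

  Rec-mono : ∀ {u v} → v >V u → ∀ f → Rec.Solution u f → Rec.Ψ v f ≈ᴹ 0ᴹ
  Rec-mono {u} {v} (σ , _ , σ-path) f s = begin
    Φ (path v) f ≈⟨ parallel (path-isPath v) (path-++ σ (path u) σ-path (path-isPath u)) f ⟩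
    Φ (σ ++ path u) f                        ≈⟨ Φ-++ σ (path u) f ⟩
    Φ σ (λ i → Φ (path u) (shift i f)) ≈⟨ IsLinear.≈0-homo (Φ-linear σ) s ⟩
    0ᴹ                                       ∎
    where open ≈ᴹ-Reasoning

  Rec-edge : ∀ e f → Rec.Ψ (tl e) f ≈ᴹ Rec.Ψ (hd e) (shift 1 f) -ᴹ edge e (Rec.Ψ (hd e) f)
  Rec-edge e = parallel (path-isPath (tl e)) (refl , path-isPath (hd e))

-- From functions on words to power series over A(Γ)

module Spanning {c ℓ a ℓa : Level} (F : Field c ℓ) (Γ : Graph)
    (_>?_ : Decidable₂ (GraphNotions._>V_ Γ))
    (star : GraphNotions.Vert Γ) (star-level : Graph.level Γ star ≡ 0)
    (toStar : ∀ v → Σ (List (Fin (Graph.nE Γ))) (GraphNotions.IsPath Γ v star))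
    (A : LeftModule (Field.ring F) a ℓa)
    (edge : Fin (Graph.nE Γ) → Endo A)
    (edge-linear : ∀ e → IsLinear (Field.ring F) A A (edge e))
    (parallel : ∀ {v w π₁ π₂} → GraphNotions.IsPath Γ v w π₁ → GraphNotions.IsPath Γ v w π₂ →
      ∀ f → LeftModule._≈ᴹ_ A (Paths.Φ A edge edge-linear π₁ f) (Paths.Φ A edge edge-linear π₂ f))
    (𝟙 : LeftModule.Carrierᴹ A) where
  open GraphLemmas Γ
  open NormalWords Γ _>?_
  open WordModule F Γ _>?_
  open NormalForms F Γ _>?_
  open NormalSupport F Γ _>?_
  private
    module F = Field F
    module M = ModuleLemmas M
    module S = ModuleLemmas S
    module A = ModuleLemmas A
    module SqM = Sequences M
    module Φᴬ = Paths A edge edge-linear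

  open DelayedModule A edge edge-linear public

  Â : LeftModule R a ℓa
  Â = power R ℕ A

  private
    SX = power R ℕ Â
    module Â = ModuleLemmas Â
    module SX = ModuleLemmas SX
    module ΦX = Paths Â delayedEdge delayedEdge-linear

  Φ-parallel-Â : ∀ {v w π₁ π₂} → IsPath v w π₁ → IsPath v w π₂ → ∀ f → ΦX.Φ π₁ f Â.≈ᴹ ΦX.Φ π₂ f
  Φ-parallel-Â {v} {w} {π₁} {π₂} p₁ p₂ f d = begin
    ΦX.Φ π₁ f d                          ≈⟨ Φ-slice π₁ f d ⟩
    Φᴬ.Φ π₁ (slice (length π₁) d f) ≈⟨ parallel p₁ p₂ (slice (length π₁) d f) ⟩
    Φᴬ.Φ π₂ (slice (length π₁) d f) ≡⟨ cong (λ L → Φᴬ.Φ π₂ (slice L d f)) length≡ ⟩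
    Φᴬ.Φ π₂ (slice (length π₂) d f)      ≈⟨ Φ-slice π₂ f d ⟨
    ΦX.Φ π₂ f d                          ∎
    where
    open A.≈ᴹ-Reasoning
    length≡ : length π₁ ≡ length π₂
    length≡ = ℕₚ.+-cancelʳ-≡ (level w) _ _ (trans (sym (path-level π₁ p₁)) (path-level π₂ p₂))

  open PathFamily Γ Â delayedEdge delayedEdge-linear star star-level toStar Φ-parallel-Â public
  open Sequences Â using (shift; single; single-≢; single-≡; single-linear)

  one : Â.Carrierᴹ
  one zero    = 𝟙
  one (suc _) = A.0ᴹ

  Vanishing : ℕ → Â.Carrierᴹ → Set ℓa
  Vanishing k x = ∀ d → d < k → x d A.≈ᴹ A.0ᴹ

  -- `next` lacks the leading coefficient, so each remaining one carries at least one edge and hence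
  -- a factor t. This contraction is what makes the letter by letter expansion converge.
  next-raises : ∀ v k f → (∀ i → Vanishing k (f i)) → Vanishing (suc k) (Rec.next v f)
  next-raises v k f z d d≤k = A.x≈y⇒x-y≈0 (A.≈ᴹ-sym (A.≈ᴹ-trans (Φ-top (path v) k f z d d≤k)
    (A.≈ᴹ-reflexive (cong (λ n → f n d) (path-length v)))))

  Agree : ℕ → Â.Carrierᴹ → Â.Carrierᴹ → Set ℓa
  Agree k x y = ∀ d → d < k → x d A.≈ᴹ y d

  next-agree : ∀ v k f g → (∀ i → Agree k (f i) (g i)) → Agree (suc k) (Rec.next v f) (Rec.next v g)
  next-agree v k f g p d d≤k = A.x-y≈0⇒x≈y (A.≈ᴹ-trans
    (A.≈ᴹ-sym (IsLinear.-‿homo (Rec.next-linear v) f g d))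
    (next-raises v k (f SX.-ᴹ g) (λ i d d<k → A.x≈y⇒x-y≈0 (p i d d<k)) d d≤k))

  ∑-agree : ∀ {i} {I : Set i} (is : List I) k (f g : I → Â.Carrierᴹ) → (∀ j → Agree k (f j) (g j)) →
    Agree k (Â.∑ is f) (Â.∑ is g)
  ∑-agree []       k f g p d d<k = A.≈ᴹ-refl
  ∑-agree (i ∷ is) k f g p d d<k = A.+ᴹ-cong (p i d d<k) (∑-agree is k f g p d d<k)

  -- The image of a function on words is expanded letter by letter; the degree d part is correct after d + 1 rounds.
  approx : ℕ → M.Carrierᴹ → Â.Carrierᴹ
  approx zero    m = Â.0ᴹ
  approx (suc k) m = (m [] Â.*ₗ one) Â.+ᴹ Â.∑ vertices (λ v → Rec.next v (λ i → approx k (part v m i)))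

  map-linear : ∀ {f : M.Carrierᴹ → Â.Carrierᴹ} → IsLinear R M Â f → IsLinear R S SX (λ s i → f (s i))
  map-linear f-linear = pointwise-linear R S Â
    (λ i → ∘-linear R S M Â f-linear (eval-linear R M i))

  approx-linear : ∀ k → IsLinear R M Â (approx k)
  approx-linear zero    = zero-linear R M Â
  approx-linear (suc k) = add-linear R M Â
    (record
      { resp   = λ p → Â.*ₗ-congʳ {one} (p [])
      ; +-homo = λ x y → Â.*ₗ-distribʳ one (x []) (y [])
      ; *-homo = λ l x → Â.*ₗ-assoc l (x []) one
      })
    (∑-linear R M Â vertices (λ v →
      ∘-linear R M SX Â (Rec.next-linear v)
        (∘-linear R M S SX (map-linear (approx-linear k)) (part-linear v))))

  approx-suc : ∀ k m → Agree k (approx k m) (approx (suc k) m)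
  approx-suc (suc k) m d d<1+k = A.+ᴹ-congˡ
    (∑-agree vertices (suc k) _ _ (λ v → next-agree v k _ _ (λ i → approx-suc k (part v m i))) d d<1+k)

  approx-+ : ∀ j k m → Agree k (approx k m) (approx (j ℕ.+ k) m)
  approx-+ zero    k m d d<k = A.≈ᴹ-refl
  approx-+ (suc j) k m d d<k =
    A.≈ᴹ-trans (approx-+ j k m d d<k) (approx-suc (j ℕ.+ k) m d (ℕₚ.<-≤-trans d<k (ℕₚ.m≤n+m k j)))

  ρ : M.Carrierᴹ → Â.Carrierᴹ
  ρ m d = approx (suc d) m d

  ρ-approx : ∀ k m → Agree k (ρ m) (approx k m)
  ρ-approx k m d d<k = A.≈ᴹ-trans (approx-+ (k ∸ suc d) (suc d) m d ℕₚ.≤-refl)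
    (A.≈ᴹ-reflexive (cong (λ j → approx j m d) (ℕₚ.m∸n+n≡m d<k)))

  ρ-linear : IsLinear R M Â ρ
  ρ-linear = pointwise-linear R M A
    (λ d → ∘-linear R M Â A (eval-linear R A d) (approx-linear (suc d)))

  private module ρ = IsLinear ρ-linear

  ρ-expand : ∀ m → ρ m Â.≈ᴹ (m [] Â.*ₗ one) Â.+ᴹ Â.∑ vertices (λ v → Rec.next v (λ i → ρ (part v m i)))
  ρ-expand m d = A.+ᴹ-congˡ
    (∑-agree vertices (suc d) _ _
      (λ v → next-agree v d _ _ (λ i d′ d′<d → A.≈ᴹ-sym (ρ-approx d (part v m i) d′ d′<d))) d ℕₚ.≤-refl)

  ρ-prepend : ∀ v f → ρ (prepend v f) Â.≈ᴹ Rec.next v (λ i → ρ (f i))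
  ρ-prepend v f = begin
    ρ (prepend v f) ≈⟨ ρ-expand (prepend v f) ⟩
    (F.0# Â.*ₗ one) Â.+ᴹ Â.∑ vertices t ≈⟨ Â.0+≈ {y = Â.∑ vertices t} (Â.*ₗ-zeroˡ one) ⟩
    Â.∑ vertices t ≈⟨ Â.∑-single vertices (Uniqueₚ.allFin⁺ nV) (∈ₚ.∈-allFin v) t other ⟩
    t v ≈⟨ Rec.next-local v (λ i i<n → ρ.resp (part-prepend-≡ v f i i<n)) ⟩
    Rec.next v (λ i → ρ (f i))                     ∎
    where
    open Â.≈ᴹ-Reasoning
    t : Vert → Â.Carrierᴹ
    t u = Rec.next u (λ i → ρ (part u (prepend v f) i))
    other : ∀ u → u ≢ v → t u Â.≈ᴹ Â.0ᴹ
    other u u≢v = IsLinear.≈0-homo (Rec.next-linear u) (λ i → ρ.≈0-homo (part-prepend-≢ u≢v f i))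

  private
    -- By induction ρ takes solutions for u < v to solutions of the path recurrence of u, and
    -- `Rec-mono` makes `Rec.Ψ v` kill these. So f may be replaced by its reduction g, for which the
    -- recurrence on words only prepends letters, and `ρ-prepend` translates that.
    ρ-Ψ-below : ∀ b {v} → level v < b → ∀ f → Rec.Ψ v (λ i → ρ (f i)) Â.≈ᴹ ρ (T.Ψ v f)
    ρ-Ψ-below (suc b) {v} (s≤s n≤b) f = begin
      Rec.Ψ v (ρ∘ f) ≈⟨ reduce-invariant L-linear (down v) kills f ⟨
      Rec.Ψ v (ρ∘ g) ≈⟨ Â.x-[x-y]≈y (ρ (g n)) (Rec.Ψ v (ρ∘ g)) ⟨
      ρ (g n) Â.-ᴹ Rec.next v (ρ∘ g) ≈⟨ Â.-ᴹ-cong (Â.≈ᴹ-refl {ρ (g n)}) (ρ-prepend v g) ⟨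
      ρ (g n) Â.-ᴹ ρ (prepend v g) ≈⟨ ρ.-‿homo (g n) (prepend v g) ⟨
      ρ (g n M.-ᴹ prepend v g) ≈⟨ ρ.resp (family-Ψ v f) ⟨
      ρ (T.Ψ v f)                                      ∎
      where
      open Â.≈ᴹ-Reasoning
      ρ∘ : SqM.Seq → ℕ → Â.Carrierᴹ
      ρ∘ s i = ρ (s i)
      n = level v
      g = reduce (down v) f
      L-linear : IsLinear R S Â (λ s → Rec.Ψ v (ρ∘ s))
      L-linear = ∘-linear R S SX Â (Rec.Ψ-linear v) (map-linear ρ-linear)
      kills : ∀ {u} → u ∈ down v → ∀ h → Rec.Ψ v (ρ∘ (T.extend u h)) Â.≈ᴹ Â.0ᴹ
      kills {u} u∈ h = Rec-mono (∈-down⁻ u∈) (ρ∘ (T.extend u h)) (λ k → Â.≈ᴹ-trans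
        (ρ-Ψ-below b (ℕₚ.<-≤-trans (down-level u∈) n≤b) (SqM.shift k (T.extend u h)))
        (ρ.≈0-homo (T.extend-solution u h k)))

  ρ-Ψ : ∀ v f → Rec.Ψ v (λ i → ρ (f i)) Â.≈ᴹ ρ (T.Ψ v f)
  ρ-Ψ v = ρ-Ψ-below _ ℕₚ.≤-refl

  -- `edgeᴹ` was read off from P_v = (τ - e) P_w, which the path recurrences satisfy as well
  -- (`Rec-edge`); a map respecting all `Ψ` therefore respects the edges.
  ρ-edge : ∀ e x → ρ (edgeᴹ e x) Â.≈ᴹ delayedEdge e (ρ x)
  ρ-edge e x = begin
    ρ (T.Ψ w (SqM.shift 1 s) M.-ᴹ T.Ψ v s) ≈⟨ ρ.-‿homo (T.Ψ w (SqM.shift 1 s)) (T.Ψ v s) ⟩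
    ρ (T.Ψ w (SqM.shift 1 s)) Â.-ᴹ ρ (T.Ψ v s) ≈⟨ Â.-ᴹ-cong (ρ-Ψ w (SqM.shift 1 s)) (ρ-Ψ v s) ⟨
    Rec.Ψ w (shift 1 ρs) Â.-ᴹ Rec.Ψ v ρs ≈⟨ Â.-ᴹ-cong (Â.≈ᴹ-refl {Rec.Ψ w (shift 1 ρs)}) (Rec-edge e ρs) ⟩
    Rec.Ψ w (shift 1 ρs) Â.-ᴹ (Rec.Ψ w (shift 1 ρs) Â.-ᴹ delayedEdge e (Rec.Ψ w ρs))
        ≈⟨ Â.x-[x-y]≈y (Rec.Ψ w (shift 1 ρs)) (delayedEdge e (Rec.Ψ w ρs)) ⟩
    delayedEdge e (Rec.Ψ w ρs) ≈⟨ IsLinear.resp (delayedEdge-linear e) (Â.≈ᴹ-trans (ρ-Ψ w s) (ρ.resp Ψs)) ⟩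
    delayedEdge e (ρ x)                                ∎
    where
    open Â.≈ᴹ-Reasoning
    v = tl e
    w = hd e
    s = SqM.single (level w) x
    ρs : ℕ → Â.Carrierᴹ
    ρs i = ρ (s i)
    Ψs : T.Ψ w s M.≈ᴹ x
    Ψs = M.≈ᴹ-trans (T.Ψ-monic w (λ i i<m → SqM.single-≢ (level w) i x (ℕₚ.<⇒≢ i<m))) (SqM.single-≡ (level w) x)

  module ActM = TensorAction F Γ M edgeᴹ edgeᴹ-linear
  module ActX = TensorAction F Γ Â delayedEdge delayedEdge-linear

  vacuum : M.Carrierᴹ
  vacuum = δ []

  ρ-vacuum : ρ vacuum Â.≈ᴹ one
  ρ-vacuum = Â.≈ᴹ-trans (ρ-expand vacuum) (Â.≈ᴹ-trans
    (Â.+0≈ {x = vacuum [] Â.*ₗ one} (Â.∑-zero vertices (λ v → IsLinear.≈0-homo (Rec.next-linear v)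
      (λ i → ρ.≈0-homo (λ W → δ-≢ [] ((v , i) ∷ W) (λ ()))))))
    (Â.≈ᴹ-trans (Â.*ₗ-congʳ {one} (δ-≡ [])) (Â.*ₗ-identityˡ one)))

  ρ-act : ∀ p → ρ (ActM.act p vacuum) Â.≈ᴹ ActX.act p one
  ρ-act p = Â.≈ᴹ-trans (act-equivariant p vacuum) (IsLinear.resp (ActX.act-linear p) ρ-vacuum)
    where open Equivariant F Γ M edgeᴹ edgeᴹ-linear Â delayedEdge delayedEdge-linear ρ ρ-linear ρ-edge

  OfDegree : ℕ → Alg.TE F Γ → Set c
  OfDegree d = All (λ (_ , u) → length u ≡ d)

  private
    module Actᴬ = TensorAction F Γ A edge edge-linear

    word-one : ∀ u → ActX.word u one (length u) ≡ Actᴬ.word u 𝟙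
    word-one []      = refl
    word-one (e ∷ u) = cong (edge e) (word-one u)

  act-one : ∀ {d} p → OfDegree d p → ActX.act p one d A.≈ᴹ Actᴬ.act p 𝟙
  act-one []            []            = A.≈ᴹ-refl
  act-one ((k , u) ∷ p) (refl ∷ ps) =
    A.+ᴹ-cong (A.*ₗ-congˡ (A.≈ᴹ-reflexive (word-one u))) (act-one p ps)

  -- The product of the operators for which the letters stand, applied to 1. Taken among power
  -- series, it is concentrated in degree `degree W`.
  monomial : LWord → Â.Carrierᴹ
  monomial []            = one
  monomial ((v , i) ∷ W) = Rec.next v (single i (monomial W))

  approx-words : ∀ k m → approx k m Â.≈ᴹ Â.∑ (words k) (λ W → m W Â.*ₗ monomial W)
  approx-words zero    m = Â.≈ᴹ-refl
  approx-words (suc k) m = Â.≈ᴹ-trans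
    (Â.+ᴹ-congˡ {m [] Â.*ₗ one} (Â.∑-cong vertices by-vertex))
    (Â.≈ᴹ-sym (∑-words Â k (λ W → m W Â.*ₗ monomial W)))
    where
    open Â.≈ᴹ-Reasoning
    by-letter : Letter → Â.Carrierᴹ
    by-letter x = Â.∑ (words k) (λ W → m (x ∷ W) Â.*ₗ monomial (x ∷ W))
    by-vertex : ∀ v → Rec.next v (λ i → approx k (part v m i)) Â.≈ᴹ Â.∑ (upTo (level v)) (λ i → by-letter (v , i))
    by-vertex v = Â.≈ᴹ-trans (Rec.next-expand v f) (Â.∑-cong (upTo (level v)) at)
      where
      f : ℕ → Â.Carrierᴹ
      f i = approx k (part v m i)
      at : ∀ i → Rec.next v (single i (f i)) Â.≈ᴹ by-letter (v , i)
      at i = begin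
        L (f i) ≈⟨ L.resp (approx-words k (part v m i)) ⟩
        L (Â.∑ (words k) (λ W → m ((v , i) ∷ W) Â.*ₗ monomial W)) ≈⟨ L.∑-homo (words k) (λ W → m ((v , i) ∷ W) Â.*ₗ monomial W) ⟩
        Â.∑ (words k) (λ W → L (m ((v , i) ∷ W) Â.*ₗ monomial W)) ≈⟨ Â.∑-cong (words k) (λ W → L.*-homo (m ((v , i) ∷ W)) (monomial W)) ⟩
        by-letter (v , i)                                                ∎
        where
        L : Â.Carrierᴹ → Â.Carrierᴹ
        L x = Rec.next v (single i x)
        module L = IsLinear (∘-linear R Â SX Â (Rec.next-linear v) (single-linear i))

  ρ-words : ∀ m d → ρ m d A.≈ᴹ A.∑ (words (suc d)) (λ W → m W A.*ₗ monomial W d)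
  ρ-words m d = A.≈ᴹ-trans (approx-words (suc d) m d)
    (IsLinear.∑-homo (eval-linear R A d) (words (suc d)) (λ W → m W Â.*ₗ monomial W))

  private
    next-single : ∀ v i y d → i < level v → Rec.next v (single i y) d A.≈ᴹ
      A.0ᴹ A.-ᴹ Φᴬ.Φ (path v) (slice (level v) d (single i y))
    next-single v i y d i<n = A.-ᴹ-cong (single-≢ i (level v) y (λ p → ℕₚ.<-irrefl (sym p) i<n) d)
      (A.≈ᴹ-trans (Φ-slice (path v) (single i y) d)
        (A.≈ᴹ-reflexive (cong (λ L → Φᴬ.Φ (path v) (slice L d (single i y))) (path-length v))))

  monomial-degree : ∀ W d → degree W ≢ d → monomial W d A.≈ᴹ A.0ᴹ
  monomial-degree []            zero    ≢ = ⊥-elim (≢ refl)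
  monomial-degree []            (suc d) ≢ = A.≈ᴹ-refl
  monomial-degree ((v , i) ∷ W) d       ≢ with ℕₚ.<-≤-connex i (level v)
  -- Here (v , i) is not a letter: `next` never reads position i, so the monomial vanishes
  -- altogether.
  ... | inj₂ n≤i = A.≈ᴹ-trans
    (Rec.next-local v {g = SX.0ᴹ} (λ j j<n → single-≢ i j (monomial W) (ℕₚ.<⇒≢ (ℕₚ.<-≤-trans j<n n≤i))) d)
    (IsLinear.0-homo (Rec.next-linear v) d)
  ... | inj₁ i<n = A.≈ᴹ-trans (next-single v i (monomial W) d i<n) (A.0-0≈0 A.≈ᴹ-refl
    (IsLinear.≈0-homo (Φᴬ.Φ-linear (path v)) (slice-single-0 (monomial W) (level v) d i (ℕₚ.<⇒≤ i<n)
      (λ D p → monomial-degree W D (λ q → ≢ (trans (cong (level v ∸ i ℕ.+_) q) p))))))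

  -- A is abstract here and has no notion of degree. For A(Γ) the predicate will say that the
  -- representing list consists of words of length d.
  monomial-graded : ∀ {p} (P : ℕ → A.Carrierᴹ → Set p) → (∀ d → P d A.0ᴹ) →
    (∀ d {x y} → P d x → P d y → P d (x A.-ᴹ y)) → (∀ d e {x} → P d x → P (suc d) (edge e x)) → P 0 𝟙 →
    ∀ W d → P d (monomial W d)
  monomial-graded P P-0 P-- P-edge P-𝟙 = go
    where
    Φ-graded : ∀ π f → (∀ i d → P d (f i d)) → ∀ d → P d (ΦX.Φ π f d)
    Φ-graded []      f h d       = h 0 d
    Φ-graded (e ∷ π) f h zero    = P-- 0 (Φ-graded π _ (λ i → h (suc i)) 0) (P-0 0)
    Φ-graded (e ∷ π) f h (suc d) = P-- (suc d) (Φ-graded π _ (λ i → h (suc i)) (suc d)) (P-edge d e (Φ-graded π f h d))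
    single-graded : ∀ i y → (∀ d → P d (y d)) → ∀ j d → P d (single i y j d)
    single-graded i y h j d with j ℕ.≟ i
    ... | yes _ = h d
    ... | no  _ = P-0 d
    go : ∀ W d → P d (monomial W d)
    go []            zero    = P-𝟙
    go []            (suc d) = P-0 (suc d)
    go ((v , i) ∷ W) d       = P-- d (single-graded i (monomial W) (go W) (level v) d)
      (Φ-graded (path v) _ (single-graded i (monomial W) (go W)) d)

  -- The degree d part of p applied to the series 1 is p applied to `𝟙`, and ρ computes that series
  -- from the action on the empty word. In the resulting sum words that are not normal drop out by
  -- `act-supported`, words of another degree by `monomial-degree`.
  expansion : ∀ {d} p → OfDegree d p → Actᴬ.act p 𝟙 A.≈ᴹ
    A.∑ (normalWords d) (λ W → ActM.act p vacuum W A.*ₗ monomial W d)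
  expansion {d} p p-deg = begin
    Actᴬ.act p 𝟙 ≈⟨ act-one p p-deg ⟨
    ActX.act p one d ≈⟨ ρ-act p d ⟨
    ρ m d ≈⟨ ρ-words m d ⟩
    A.∑ (words (suc d)) (λ W → m W A.*ₗ monomial W d) ≈⟨ A.∑-filter (normalOfDegree? d) (words (suc d)) _ vanish ⟩
    A.∑ (normalWords d) (λ W → m W A.*ₗ monomial W d)              ∎
    where
    open A.≈ᴹ-Reasoning
    m = ActM.act p vacuum
    vanish : ∀ W → ¬ NormalOfDegree d W → m W A.*ₗ monomial W d A.≈ᴹ A.0ᴹ
    vanish W ¬nd with normal? W
    ... | yes nW = A.*0≈0 (monomial-degree W d (λ q → ¬nd (nW , q)))
    ... | no ¬nW = A.≈ᴹ-trans (A.*ₗ-congʳ (act-supported p (δ-supported tt) W ¬nW)) (A.*ₗ-zeroˡ _)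

  detect-zero : ∀ {d} p → OfDegree d p → (∀ {W} → W ∈ normalWords d → ActM.act p vacuum W F.≈ F.0#) →
    Actᴬ.act p 𝟙 A.≈ᴹ A.0ᴹ
  detect-zero {d} p p-deg z = A.≈ᴹ-trans (expansion p p-deg)
    (A.∑-zero-∈ (normalWords d) (λ {W} W∈ → A.≈ᴹ-trans (A.*ₗ-congʳ (z W∈)) (A.*ₗ-zeroˡ (monomial W d))))

  module Evaluation (θ : A.Carrierᴹ → M.Carrierᴹ) (θ-linear : IsLinear R A M θ)
                    (θ-edge : ∀ e x → θ (edge e x) M.≈ᴹ edgeᴹ e (θ x)) (θ-𝟙 : θ 𝟙 M.≈ᴹ δ []) where
    private module θ = IsLinear θ-linear
    open Equivariant F Γ A edge edge-linear M edgeᴹ edgeᴹ-linear θ θ-linear θ-edge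

    -- At the vertex of level 0 a monic recurrence is the polynomial 1, so P_v equals P_π for the
    -- chosen path π from v.
    Φ-path : ∀ v f → Φ (path v) f M.≈ᴹ T.Ψ v f
    Φ-path v f = M.≈ᴹ-trans
      (IsLinear.resp (Φ-linear (path v)) (λ i → M.≈ᴹ-sym (M.≈ᴹ-trans
        (T.Ψ-monic star (λ j j<0 → ⊥-elim (ℕₚ.n≮0 (subst (j <_) star-level j<0))))
        (M.≈ᴹ-reflexive (cong f (trans (cong (i ℕ.+_) star-level) (ℕₚ.+-identityʳ i)))))))
      (Φ-Ψ (path v) (path-isPath v) f)

    -- θ carries the coefficients of the path polynomial to those of the recurrence on words, where
    -- by `next-δ` a letter that fits is simply put in front.
    θ-monomial : ∀ W → Normal W → θ (monomial W (degree W)) M.≈ᴹ δ W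
    θ-monomial []            _  = θ-𝟙
    θ-monomial ((v , i) ∷ W) nW@(i<n , _ , nW′) = begin
      θ (monomial ((v , i) ∷ W) d) ≈⟨ θ.resp (next-single v i y d i<n) ⟩
      θ (A.0ᴹ A.-ᴹ Φᴬ.Φ (path v) (slice n d (single i y))) ≈⟨ θ.-‿homo A.0ᴹ (Φᴬ.Φ (path v) (slice n d (single i y))) ⟩
      θ A.0ᴹ M.-ᴹ θ (Φᴬ.Φ (path v) (slice n d (single i y))) ≈⟨ M.-ᴹ-cong θ.0-homo (M.≈ᴹ-trans
          (Φ-equivariant (path v) (slice n d (single i y)))
          (IsLinear.resp (Φ-linear (path v)) seq)) ⟩
      M.0ᴹ M.-ᴹ Φ (path v) (SqM.single i (δ W)) ≈⟨ M.-ᴹ-cong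
          (M.≈ᴹ-sym (SqM.single-≢ i n (δ W) (λ p → ℕₚ.<-irrefl (sym p) i<n)))
          (Φ-path v (SqM.single i (δ W))) ⟩
      T.next v (SqM.single i (δ W)) ≈⟨ next-δ v i W nW ⟩
      δ ((v , i) ∷ W)                                           ∎
      where
      open M.≈ᴹ-Reasoning
      n = level v
      y = monomial W
      d = n ∸ i ℕ.+ degree W
      seq : (λ j → θ (slice n d (single i y) j)) S.≈ᴹ SqM.single i (δ W)
      seq j = M.≈ᴹ-trans (θ.resp (slice-single y n (degree W) i (ℕₚ.<⇒≤ i<n) j)) (at (j ℕ.≟ i))
        where
        at : Dec (j ≡ i) → θ (Sequences.single A i (y (degree W)) j) M.≈ᴹ SqM.single i (δ W) j
        at (yes refl) = M.≈ᴹ-trans (θ.resp (Sequences.single-≡ A i (y (degree W))))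
          (M.≈ᴹ-trans (θ-monomial W nW′) (M.≈ᴹ-sym (SqM.single-≡ i (δ W))))
        at (no j≢i)     = M.≈ᴹ-trans (θ.≈0-homo (Sequences.single-≢ A i j (y (degree W)) j≢i))
          (M.≈ᴹ-sym (SqM.single-≢ i j (δ W) j≢i))

-- Dimensions

module LinearAlgebra {c ℓ : Level} (F : Field c ℓ) where
  private
    module F = Field F
    R = F.ring
    𝔽 = TensorUnit.leftModule {R = R}
  open ModuleLemmas 𝔽
  open F using (_*_; _+_; -_; 0#; 1#) renaming (Carrier to K)

  ∑-suc : ∀ m (f : Fin (suc m) → K) → ∑ (allFin (suc m)) f F.≈ f Fin.zero + ∑ (allFin m) (λ j → f (Fin.suc j))
  ∑-suc m f = F.+-congˡ (F.trans
    (F.reflexive (cong (λ js → ∑ js f) (sym (Listₚ.map-tabulate (λ j → j) Fin.suc))))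
    (∑-map Fin.suc (allFin m) f))

  Independent : ∀ {i} {I : Set i} {m} → List I → (Fin m → I → K) → Set (c ⊔ ℓ ⊔ i)
  Independent {m = m} cols B = (κ : Fin m → K) → (∀ {i} → i ∈ cols → ∑ (allFin m) (λ j → κ j * B j i) F.≈ 0#) → ∀ j → κ j F.≈ 0#

  -- The search for a pivot. Without decidable equality in F its outcome is available only under a
  -- double negation, which suffices because the bound to be proved is itself a negation.
  all-or-any : ∀ {i p} {I : Set i} (P : I → Set p) (is : List I) →
    ¬ ¬ ((∀ {i} → i ∈ is → P i) ⊎ (Σ I λ i → i ∈ is × ¬ P i))
  all-or-any P []       ¬goal = ¬goal (inj₁ λ ())
  all-or-any P (i ∷ is) ¬goal = all-or-any P is λ
    { (inj₂ (j , j∈ , ¬p)) → ¬goal (inj₂ (j , there j∈ , ¬p))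
    ; (inj₁ all)           → ¬goal (inj₂ (i , here refl , λ p →
        ¬goal (inj₁ λ { (here refl) → p ; (there j∈) → all j∈ }))) }

  private
    ∈-─ : ∀ {i} {I : Set i} {cols : List I} {k j} (k∈ : k ∈ cols) → j ∈ cols → j ≡ k ⊎ j ∈ (cols Any.─ k∈)
    ∈-─ (here refl) (here refl) = inj₁ refl
    ∈-─ (here refl) (there j∈)    = inj₂ j∈
    ∈-─ (there k∈)    (here p)      = inj₂ (here p)
    ∈-─ (there k∈)    (there j∈) with ∈-─ k∈ j∈
    ... | inj₁ p   = inj₁ p
    ... | inj₂ j∈′ = inj₂ (there j∈′)

  -- Gaussian elimination with pivot B 0 k.
  eliminate : ∀ {i} {I : Set i} {m cols} {B : Fin (suc m) → I → K} {k} (k∈ : k ∈ cols) (d : K) → B Fin.zero k * d F.≈ 1# →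
    Independent cols B →
    Independent (cols Any.─ k∈) (λ j i → B (Fin.suc j) i + - ((B (Fin.suc j) k * d) * B Fin.zero i))
  eliminate {I = I} {m} {cols} {B} {k} k∈ d inv indep κ zero′ j = indep κ′ annihilated (Fin.suc j)
    where
    open ≈ᴹ-Reasoning
    js = allFin m
    B′ : Fin m → I → K
    B′ j i = B (Fin.suc j) i + - ((B (Fin.suc j) k * d) * B Fin.zero i)
    y : K
    y = ∑ js (λ j → κ j * (B (Fin.suc j) k * d))
    κ′ : Fin (suc m) → K
    -- The total multiple of row 0 that elimination has subtracted, so that a combination of the new
    -- rows is a combination of the old ones.
    κ′ Fin.zero    = - y
    κ′ (Fin.suc j) = κ j
    combine : ∀ i → ∑ (allFin (suc m)) (λ j → κ′ j * B j i) F.≈ ∑ js (λ j → κ j * B′ j i)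
    combine i = begin
      ∑ (allFin (suc m)) (λ j → κ′ j * B j i)
        ≈⟨ ∑-suc m (λ j → κ′ j * B j i) ⟩
      - y * x + ∑ js (λ j → κ j * B (Fin.suc j) i)
        ≈⟨ F.+-comm (- y * x) (∑ js (λ j → κ j * B (Fin.suc j) i)) ⟩
      ∑ js (λ j → κ j * B (Fin.suc j) i) + - y * x
        ≈⟨ F.+-congˡ (F.trans (F.sym (Ringₚ.-‿distribˡ-* R y x)) (F.-‿cong (F.*-comm y x))) ⟩
      ∑ js (λ j → κ j * B (Fin.suc j) i) -ᴹ x * y
        ≈⟨ -ᴹ-cong F.refl (∑-* js x (λ j → κ j * (B (Fin.suc j) k * d))) ⟨
      ∑ js (λ j → κ j * B (Fin.suc j) i) -ᴹ ∑ js (λ j → x * (κ j * (B (Fin.suc j) k * d)))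
        ≈⟨ ∑-sub js (λ j → κ j * B (Fin.suc j) i) (λ j → x * (κ j * (B (Fin.suc j) k * d))) ⟨
      ∑ js (λ j → κ j * B (Fin.suc j) i -ᴹ x * (κ j * (B (Fin.suc j) k * d)))
        ≈⟨ ∑-cong js (λ j → F.sym (F.trans (*ₗ-distribˡ-- (κ j) (B (Fin.suc j) i) ((B (Fin.suc j) k * d) * x))
             (-ᴹ-cong F.refl (F.trans (F.sym (F.*-assoc (κ j) (B (Fin.suc j) k * d) x)) (F.*-comm (κ j * (B (Fin.suc j) k * d)) x))))) ⟩
      ∑ js (λ j → κ j * B′ j i)
        ∎
      where x = B Fin.zero i
    pivot : ∀ j → B′ j k F.≈ 0#
    pivot j = x≈y⇒x-y≈0 (begin
      b                              ≈⟨ F.*-identityʳ b ⟨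
      b * 1# ≈⟨ F.*-congˡ (F.trans (F.*-comm d (B Fin.zero k)) inv) ⟨
      b * (d * B Fin.zero k)         ≈⟨ F.*-assoc b d (B Fin.zero k) ⟨
      (b * d) * B Fin.zero k         ∎)
      where b = B (Fin.suc j) k
    annihilated : ∀ {i} → i ∈ cols → ∑ (allFin (suc m)) (λ j → κ′ j * B j i) F.≈ 0#
    annihilated {i} i∈ with ∈-─ k∈ i∈
    ... | inj₂ i∈′   = F.trans (combine i) (zero′ i∈′)
    ... | inj₁ refl = F.trans (combine i) (∑-zero js (λ j → F.trans (F.*-congˡ (pivot j)) (F.zeroʳ (κ j))))

  independent⇒≤ : ∀ {i} {I : Set i} {m} (cols : List I) (B : Fin m → I → K) → Independent cols B → ¬ length cols < m
  independent⇒≤ {m = suc m} cols B indep n<1+m = all-or-any (λ k → B Fin.zero k F.≈ 0#) cols λ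
    { (inj₁ all-zero)      → F.0≉1 (F.sym (indep unit (λ {i} i∈ → F.trans (unit-sum i) (all-zero i∈)) Fin.zero))
    ; (inj₂ (k , k∈ , ≉0)) → let d , inv = F.inverse (B Fin.zero k) ≉0 in
        independent⇒≤ (cols Any.─ k∈) _ (eliminate k∈ d inv indep)
          (ℕₚ.≤-pred (subst (_< suc m) (Listₚ.length-removeAt′ cols (Any.index k∈)) n<1+m)) }
    where
    unit : Fin (suc m) → K
    unit Fin.zero    = 1#
    unit (Fin.suc _) = 0#
    unit-sum : ∀ i → ∑ (allFin (suc m)) (λ j → unit j * B j i) F.≈ B Fin.zero i
    unit-sum i = F.trans (∑-suc m (λ j → unit j * B j i))
      (F.trans (F.+-cong (F.*-identityˡ _) (∑-zero (allFin m) (λ j → F.zeroˡ _))) (F.+-identityʳ _))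

lookup-injective : ∀ {a} {A : Set a} {xs : List A} → Unique xs → ∀ i j → lookup xs i ≡ lookup xs j → i ≡ j
lookup-injective (x∉ ∷ u) Fin.zero    Fin.zero    p = refl
lookup-injective (x∉ ∷ u) Fin.zero    (Fin.suc j) p = ⊥-elim (All.lookup x∉ (∈ₚ.∈-lookup j) p)
lookup-injective (x∉ ∷ u) (Fin.suc i) Fin.zero    p = ⊥-elim (All.lookup x∉ (∈ₚ.∈-lookup i) (sym p))
lookup-injective (x∉ ∷ u) (Fin.suc i) (Fin.suc j) p = cong Fin.suc (lookup-injective u i j p)

-- The dimension of A(Γ) in each degree

module Dimension {c ℓ : Level} (F : Field c ℓ) (Γ : Graph)
    (_>?_ : Decidable₂ (GraphNotions._>V_ Γ))
    (star : GraphNotions.Vert Γ) (star-level : Graph.level Γ star ≡ 0)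
    (toStar : ∀ v → Σ (List (Fin (Graph.nE Γ))) (GraphNotions.IsPath Γ v star)) where
  open GraphLemmas Γ
  open NormalWords Γ _>?_
  open WordModule F Γ _>?_ using (M; δ; δ-≡; δ-≢)
  open NormalForms F Γ _>?_ using (edgeᴹ; edgeᴹ-linear; Φ-parallel)
  open Alg F Γ
  open TensorAlgebra F Γ
  open Spanning F Γ _>?_ star star-level toStar 𝔸 cons cons-linear-𝔸 Φ-parallel-𝔸 1T
    using (OfDegree; monomial; monomial-graded; detect-zero; module Evaluation)
  open LinearAlgebra F
  private
    module F = Field F
    R = F.ring
    𝔽 = TensorUnit.leftModule {R = R}
    module M = ModuleLemmas M
    module 𝔸 = ModuleLemmas 𝔸
    module ActM = TensorAction F Γ M edgeᴹ edgeᴹ-linear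
    module K = ModuleLemmas 𝔽

  θ : TE → M.Carrierᴹ
  θ p = ActM.act p (δ [])

  θ-InR : ∀ p → InR p → θ p M.≈ᴹ M.0ᴹ
  θ-InR p r = ActM.act-InR (λ {_} {_} {π₁} {π₂} → Φ-parallel {π₁ = π₁} {π₂}) {p} r (δ [])

  θ-sub : ∀ p q → θ (p +T negT q) M.≈ᴹ θ p M.-ᴹ θ q
  θ-sub p q = M.≈ᴹ-trans (ActM.act-+T p (negT q) (δ [])) (M.+ᴹ-congˡ (ActM.act-negT q (δ [])))

  θ-linear : IsLinear R 𝔸 M θ
  θ-linear = record
    { resp   = λ {p} {q} (wrap r) → M.x-y≈0⇒x≈y (M.≈ᴹ-trans (M.≈ᴹ-sym (θ-sub p q)) (θ-InR (p +T negT q) r))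
    ; +-homo = λ p q → ActM.act-+T p q (δ [])
    ; *-homo = λ k p → ActM.act-scaleT k p (δ [])
    }

  θ-cons : ∀ e p → θ (cons e p) M.≈ᴹ edgeᴹ e (θ p)
  θ-cons e []            = M.≈ᴹ-sym (IsLinear.0-homo (edgeᴹ-linear e))
  θ-cons e ((k , u) ∷ p) = M.≈ᴹ-trans
    (M.+ᴹ-cong (M.≈ᴹ-sym (IsLinear.*-homo (edgeᴹ-linear e) k (ActM.word u (δ [])))) (θ-cons e p))
    (M.≈ᴹ-sym (IsLinear.+-homo (edgeᴹ-linear e) (k M.*ₗ ActM.word u (δ [])) (θ p)))

  open Evaluation θ θ-linear θ-cons (ActM.act-wordT [] (δ []))

  monomial-ofDegree : ∀ W d → OfDegree d (monomial W d)
  monomial-ofDegree = monomial-graded OfDegree (λ _ → [])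
    (λ d p q → Allₚ.++⁺ p (Allₚ.map⁺ q)) (λ d e p → Allₚ.map⁺ (All.map (cong suc) p)) (refl ∷ [])

  homogeneous : ∀ {d} p → OfDegree d p → Σ (HomT d) λ x → homToT x ≡ p
  homogeneous []            []            = [] , refl
  homogeneous ((k , u) ∷ p) (refl ∷ ps) =
    let x , x≡p = homogeneous p ps in
    (k , Vec.fromList u) ∷ x , cong₂ _∷_ (cong (k ,_) (Vecₚ.toList∘fromList u)) x≡p

  homToT-ofDegree : ∀ {d} (x : HomT d) → OfDegree d (homToT x)
  homToT-ofDegree []            = []
  homToT-ofDegree ((k , u) ∷ x) = Vecₚ.length-toList u ∷ homToT-ofDegree x

  detect-InR : ∀ {d} p → OfDegree d p → (∀ {W} → W ∈ normalWords d → θ p W F.≈ F.0#) → InR p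
  detect-InR p p-deg z = ≈0⇒InR {p} (𝔸.≈ᴹ-trans (𝔸.≈ᴹ-sym (act-1T-𝔸 p)) (detect-zero p p-deg z))

  module _ {d n : ℕ} (κ : Fin n → F.Carrier) (b : Fin n → HomT d) where
    θ-linComb : θ (linComb κ b) M.≈ᴹ M.∑ (allFin n) (λ j → κ j M.*ₗ θ (homToT (b j)))
    θ-linComb = M.≈ᴹ-trans (M.∑-concatMap (λ j → scaleT (κ j) (homToT (b j))) (allFin n) _)
      (M.∑-cong (allFin n) (λ j → ActM.act-scaleT (κ j) (homToT (b j)) (δ [])))

    linComb-ofDegree : OfDegree d (linComb κ b)
    linComb-ofDegree = Allₚ.concat⁺ (Allₚ.map⁺ (All.universal
      (λ j → Allₚ.map⁺ (homToT-ofDegree (b j))) (allFin n)))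

  module _ {d h : ℕ} (isDim : IsDimA d h) where
    private
      b = proj₁ isDim
      independent = proj₁ (proj₂ isDim)
      spanning = proj₂ (proj₂ isDim)
      n = length (normalWords d)

    -- The values of `θ` at the normal words of degree d serve as coordinates: by `detect-InR` a
    -- homogeneous element on which they all vanish lies in R.
    dim≤ : ¬ n < h
    dim≤ = independent⇒≤ (normalWords d) B indep
      where
      B : Fin h → LWord → F.Carrier
      B j W = θ (homToT (b j)) W
      indep : Independent (normalWords d) B
      indep κ zero′ = independent κ (detect-InR (linComb κ b) (linComb-ofDegree κ b) (λ {W} W∈ → F.trans (at W) (zero′ W∈)))
        where
        at : ∀ W → θ (linComb κ b) W F.≈ K.∑ (allFin h) (λ j → κ j F.* B j W)
        at W = F.trans (θ-linComb κ b W) (IsLinear.∑-homo (eval-linear R 𝔽 W)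
          (allFin h) (λ j → κ j M.*ₗ θ (homToT (b j))))

    -- Expand the monomials of normal words in the spanning family b. A dependency among their
    -- coordinate vectors passes through `θ` to one among the functions `δ (W j)`, and evaluation at
    -- `W j` isolates `κ j`.
    dim≥ : ¬ h < n
    dim≥ h<n = independent⇒≤ (allFin h) coords indep (subst (_< n) (sym (Listₚ.length-tabulate {n = h} (λ j → j))) h<n)
      where
      W : Fin n → LWord
      W = lookup (normalWords d)
      W-normal : ∀ j → NormalOfDegree d (W j)
      W-normal j = ∈-normalWords⁻ d (∈ₚ.∈-lookup j)
      hom : ∀ j → Σ (HomT d) λ x → homToT x ≡ monomial (W j) d
      hom j = homogeneous (monomial (W j) d) (monomial-ofDegree (W j) d)
      coords : Fin n → Fin h → F.Carrier
      coords j = proj₁ (spanning (proj₁ (hom j)))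
      θ-monomial′ : ∀ j → δ (W j) M.≈ᴹ M.∑ (allFin h) (λ i → coords j i M.*ₗ θ (homToT (b i)))
      θ-monomial′ j = begin
        δ (W j) ≈⟨ θ-monomial (W j) (proj₁ (W-normal j)) ⟨
        θ (monomial (W j) (degree (W j))) ≡⟨ cong (λ d → θ (monomial (W j) d)) (proj₂ (W-normal j)) ⟩
        θ (monomial (W j) d) ≡⟨ cong θ (proj₂ (hom j)) ⟨
        θ (homToT (proj₁ (hom j))) ≈⟨ M.x-y≈0⇒x≈y (M.≈ᴹ-trans (M.≈ᴹ-sym (θ-sub (homToT (proj₁ (hom j))) (linComb (coords j) b)))
            (θ-InR (homToT (proj₁ (hom j)) +T negT (linComb (coords j) b)) (proj₂ (spanning (proj₁ (hom j)))))) ⟩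
        θ (linComb (coords j) b) ≈⟨ θ-linComb (coords j) b ⟩
        M.∑ (allFin h) (λ i → coords j i M.*ₗ θ (homToT (b i))) ∎
        where open M.≈ᴹ-Reasoning
      indep : Independent (allFin h) coords
      indep κ zero′ j = begin
        κ j ≈⟨ F.*-identityʳ (κ j) ⟨
        κ j F.* F.1# ≈⟨ F.*-congˡ (δ-≡ (W j)) ⟨
        κ j F.* δ (W j) (W j) ≈⟨ K.∑-single (allFin n) (Uniqueₚ.allFin⁺ n) (∈ₚ.∈-allFin j) _
            (λ i i≢j → F.trans (F.*-congˡ (δ-≢ (W i) (W j)
              (λ p → i≢j (lookup-injective (normalWords-unique d) i j p)))) (F.zeroʳ (κ i))) ⟨
        K.∑ (allFin n) (λ i → κ i F.* δ (W i) (W j)) ≈⟨ IsLinear.∑-homo (eval-linear R 𝔽 (W j))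
            (allFin n) (λ i → κ i M.*ₗ δ (W i)) ⟨
        M.∑ (allFin n) (λ i → κ i M.*ₗ δ (W i)) (W j) ≈⟨ total (W j) ⟩
        F.0#                                                  ∎
        where
        open ≈-Reasoning F.setoid
        total : M.∑ (allFin n) (λ i → κ i M.*ₗ δ (W i)) M.≈ᴹ M.0ᴹ
        total = M.≈ᴹ-trans (M.∑-cong (allFin n) (λ i → M.*ₗ-congˡ {κ i} (θ-monomial′ i)))
          (M.≈ᴹ-trans (M.≈ᴹ-sym (M.∑-cong (allFin n)
            (λ i → M.∑-* (allFin h) (κ i) (λ k → coords i k M.*ₗ θ (homToT (b k))))))
          (M.≈ᴹ-trans (M.∑-swap (allFin n) (allFin h) (λ i k → κ i M.*ₗ (coords i k M.*ₗ θ (homToT (b k)))))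
            (M.∑-zero-∈ (allFin h) (λ {k} k∈ → column k (zero′ k∈)))))
          where
          column : ∀ k → K.∑ (allFin n) (λ i → κ i F.* coords i k) F.≈ F.0# →
            M.∑ (allFin n) (λ i → κ i M.*ₗ (coords i k M.*ₗ θ (homToT (b k)))) M.≈ᴹ M.0ᴹ
          column k z = M.≈ᴹ-trans (M.∑-cong (allFin n) (λ i → M.≈ᴹ-sym (M.*ₗ-assoc (κ i) (coords i k) x)))
            (M.≈ᴹ-trans (M.≈ᴹ-sym (IsLinear.∑-homo scalar (allFin n) (λ i → κ i F.* coords i k)))
              (IsLinear.≈0-homo scalar z))
            where
            x = θ (homToT (b k))
            scalar : IsLinear R 𝔽 M (M._*ₗ x)
            scalar = record
              { resp = λ p → M.*ₗ-congʳ {x} p ; +-homo = λ k l → M.*ₗ-distribʳ x k l ; *-homo = λ k l → M.*ₗ-assoc k l x }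

    dimension : h ≡ n
    dimension = ℕₚ.≤-antisym (ℕₚ.≮⇒≥ dim≤) (ℕₚ.≮⇒≥ dim≥)

-- Counting normal words and chains

module PowerSeries where
  Z : LeftModule ℤₚ.+-*-ring 0ℓ 0ℓ
  Z = TensorUnit.leftModule

  Zs : LeftModule ℤₚ.+-*-ring 0ℓ 0ℓ
  Zs = power ℤₚ.+-*-ring ℕ Z

  module Z = ModuleLemmas Z
  module Zs = ModuleLemmas Zs

  Series : Set
  Series = ℕ → ℤ

  private
    Linear : (Series → Series) → Set
    Linear = IsLinear ℤₚ.+-*-ring Zs Zs

  unit : Series
  unit zero    = 1ℤ
  unit (suc _) = 0ℤ

  τ : Series → Series
  τ s zero    = 0ℤ
  τ s (suc d) = s d

  τ-linear : Linear τ
  τ-linear = record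
    { resp   = λ { p zero → refl ; p (suc d) → p d }
    ; +-homo = λ { s t zero → refl ; s t (suc d) → refl }
    ; *-homo = λ { k s zero → sym (ℤₚ.*-zeroʳ k) ; k s (suc d) → refl }
    }

  τ^ : ℕ → Series → Series
  τ^ zero    s = s
  τ^ (suc m) s = τ (τ^ m s)

  τ^-linear : ∀ m → Linear (τ^ m)
  τ^-linear zero    = id-linear ℤₚ.+-*-ring Zs
  τ^-linear (suc m) = ∘-linear ℤₚ.+-*-ring Zs Zs Zs τ-linear (τ^-linear m)

  τ^-+ : ∀ m k s → τ^ (m ℕ.+ k) s ≡ τ^ m (τ^ k s)
  τ^-+ zero    k s = refl
  τ^-+ (suc m) k s = cong τ (τ^-+ m k s)

  τ^-τ : ∀ m s → τ^ m (τ s) ≡ τ (τ^ m s)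
  τ^-τ zero    s = refl
  τ^-τ (suc m) s = cong τ (τ^-τ m s)

  τ^-≥ : ∀ m s d → m ≤ d → τ^ m s d ≡ s (d ∸ m)
  τ^-≥ zero    s d       _         = refl
  τ^-≥ (suc m) s (suc d) (s≤s m≤d) = τ^-≥ m s d m≤d

  τ^-< : ∀ m s d → d < m → τ^ m s d ≡ 0ℤ
  τ^-< (suc m) s zero    _         = refl
  τ^-< (suc m) s (suc d) (s≤s d<m) = τ^-< m s d d<m

  indicator : ∀ {p} {P : Set p} → Dec P → ℤ
  indicator P? = if does P? then 1ℤ else 0ℤ

  indicator-yes : ∀ {p} {P : Set p} (P? : Dec P) → P → indicator P? ≡ 1ℤ
  indicator-yes (yes _) p = refl
  indicator-yes (no ¬p) p = ⊥-elim (¬p p)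

  indicator-no : ∀ {p} {P : Set p} (P? : Dec P) → ¬ P → indicator P? ≡ 0ℤ
  indicator-no (yes p) ¬p = ⊥-elim (¬p p)
  indicator-no (no _)  ¬p = refl

  indicator-⇔ : ∀ {p q} {P : Set p} {Q : Set q} (P? : Dec P) (Q? : Dec Q) → (P → Q) → (Q → P) → indicator P? ≡ indicator Q?
  indicator-⇔ (yes p) Q? f g = sym (indicator-yes Q? (f p))
  indicator-⇔ (no ¬p) Q? f g = sym (indicator-no Q? (λ q → ¬p (g q)))

  indicator-× : ∀ {p q} {P : Set p} {Q : Set q} (P? : Dec P) (Q? : Dec Q) →
    indicator (P? ×-dec Q?) ≡ indicator P? ℤ.* indicator Q?
  indicator-× (yes _) (yes _) = refl
  indicator-× (yes _) (no _)  = refl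
  indicator-× (no _)  (yes _) = refl
  indicator-× (no _)  (no _)  = refl

  indicator-¬ : ∀ {p} {P : Set p} (P? : Dec P) → indicator P? ℤ.+ indicator (¬? P?) ≡ 1ℤ
  indicator-¬ (yes _) = refl
  indicator-¬ (no _)  = refl

  length-filter : ∀ {a p} {A : Set a} {P : A → Set p} (P? : Decidable P) xs →
    ℤ.+ length (filter P? xs) ≡ Z.∑ xs (λ x → indicator (P? x))
  length-filter P? []       = refl
  length-filter P? (x ∷ xs) with P? x
  ... | yes _ = cong (λ z → 1ℤ ℤ.+ z) (length-filter P? xs)
  ... | no  _ = trans (length-filter P? xs) (sym (ℤₚ.+-identityˡ _))

  ∑-eval : ∀ {a} {A : Set a} (xs : List A) (f : A → Series) d → Zs.∑ xs f d ≡ Z.∑ xs (λ x → f x d)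
  ∑-eval xs f d = IsLinear.∑-homo (eval-linear ℤₚ.+-*-ring Z d) xs f

module Counting (Γ : Graph) (_>?_ : Decidable₂ (GraphNotions._>V_ Γ)) where
  open GraphLemmas Γ
  open NormalWords Γ _>?_
  open PowerSeries

  χ : ℕ → LWord → ℤ
  χ d W = indicator (normalOfDegree? d W)

  N : Series
  N d = Z.∑ (words (suc d)) (χ d)

  C : Vert → Series
  -- The first letter is split off from a word with fewer than `suc d` letters, which leaves fewer
  -- than d.
  C v d = Z.∑ (upTo (level v)) (λ i → Z.∑ (words d) (λ W → χ d ((v , i) ∷ W)))

  N-length : ∀ d → N d ≡ ℤ.+ length (normalWords d)
  N-length d = sym (length-filter (normalOfDegree? d) (words (suc d)))

  N-expand : N Zs.≈ᴹ unit Zs.+ᴹ Zs.∑ vertices C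
  N-expand d = trans (∑-words Z d (χ d)) (cong₂ ℤ._+_ (empty d) (sym (∑-eval vertices C d)))
    where
    empty : ∀ d → χ d [] ≡ unit d
    empty zero    = refl
    empty (suc _) = refl

  length≤degree : ∀ W → Normal W → length W ≤ degree W
  length≤degree []            _              = z≤n
  length≤degree ((v , i) ∷ W) (i<n , _ , nW) = ℕₚ.+-mono-≤ (ℕₚ.m<n⇒0<n∸m i<n) (length≤degree W nW)

  χ-long : ∀ d W → d < length W → χ d W ≡ 0ℤ
  χ-long d W d<l = indicator-no (normalOfDegree? d W)
    (λ { (nW , refl) → ℕₚ.<⇒≱ d<l (length≤degree W nW) })

  covers? : ∀ v i u → Dec (v >V u × level u ≡ i)
  covers? v i u = (v >? u) ×-dec (level u ℕ.≟ i)

  private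
    module _ (v : Vert) (i : ℕ) (i<n : i < level v) where
      m : ℕ
      m = level v ∸ i

      χ-cons-< : ∀ d W → d < m → χ d ((v , i) ∷ W) ≡ 0ℤ
      χ-cons-< d W d<m = indicator-no (normalOfDegree? d ((v , i) ∷ W))
        (λ { (_ , refl) → ℕₚ.<⇒≱ d<m (ℕₚ.m≤m+n m (degree W)) })

      χ-cons-≥ : ∀ d W → m ≤ d → χ d ((v , i) ∷ W) ≡ indicator (fits? (v , i) W) ℤ.* χ (d ∸ m) W
      χ-cons-≥ d W m≤d = trans
        (indicator-⇔ (normalOfDegree? d ((v , i) ∷ W)) (fits? (v , i) W ×-dec normalOfDegree? (d ∸ m) W)
          (λ { ((_ , f , nW) , refl) → f , nW , sym (ℕₚ.m+n∸m≡n m (degree W)) })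
          (λ { (f , nW , q) → (i<n , f , nW) , trans (cong (m ℕ.+_) q) (ℕₚ.m+[n∸m]≡n m≤d) }))
        (indicator-× (fits? (v , i) W) (normalOfDegree? (d ∸ m) W))

      -- Words beginning with (v , i) arise from all words by removing those whose first letter is covered.
      letter-count : ∀ d → Z.∑ (words d) (λ W → χ d ((v , i) ∷ W)) ℤ.+
        Z.∑ vertices (λ u → indicator (covers? v i u) ℤ.* τ^ m (C u) d) ≡ τ^ m N d
      letter-count d with ℕₚ.<-≤-connex d m
      ... | inj₁ d<m = trans
        (cong₂ ℤ._+_ (Z.∑-zero (words d) (λ W → χ-cons-< d W d<m))
          (Z.∑-zero vertices (λ u → trans (cong (indicator (covers? v i u) ℤ.*_) (τ^-< m (C u) d d<m))
            (ℤₚ.*-zeroʳ (indicator (covers? v i u))))))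
        (sym (τ^-< m N d d<m))
      ... | inj₂ m≤d = begin
        Z.∑ (words d) (λ W → χ d ((v , i) ∷ W)) ℤ.+ Z.∑ vertices (λ u → indicator (covers? v i u) ℤ.* τ^ m (C u) d)
          ≡⟨ cong₂ ℤ._+_ fitting covered ⟩
        Z.∑ (words (suc d′)) good ℤ.+ Z.∑ (words (suc d′)) bad
          ≡⟨ Z.∑-+ (words (suc d′)) good bad ⟨
        Z.∑ (words (suc d′)) (λ W → good W ℤ.+ bad W)
          ≡⟨ Z.∑-cong (words (suc d′)) (λ W → trans
               (sym (ℤₚ.*-distribʳ-+ (χ d′ W) (indicator (fits? (v , i) W)) (indicator (¬? (fits? (v , i) W)))))
               (trans (cong (ℤ._* χ d′ W) (indicator-¬ (fits? (v , i) W))) (ℤₚ.*-identityˡ (χ d′ W)))) ⟩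
        N d′
          ≡⟨ τ^-≥ m N d m≤d ⟨
        τ^ m N d ∎
        where
        open ≡.≡-Reasoning
        d′ = d ∸ m
        good bad : LWord → ℤ
        good W = indicator (fits? (v , i) W) ℤ.* χ d′ W
        bad W = indicator (¬? (fits? (v , i) W)) ℤ.* χ d′ W
        -- Because m is positive, `words d` contains all words short enough to have degree d′; the
        -- longer ones contribute nothing.
        d′<d : suc d′ ≤ d
        d′<d = ℕₚ.∸-monoʳ-< {d} {m} {0} (ℕₚ.m<n⇒0<n∸m i<n) m≤d
        fitting : Z.∑ (words d) (λ W → χ d ((v , i) ∷ W)) ≡ Z.∑ (words (suc d′)) good
        fitting = begin
          Z.∑ (words d) (λ W → χ d ((v , i) ∷ W)) ≡⟨ Z.∑-cong (words d) (λ W → χ-cons-≥ d W m≤d) ⟩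
          Z.∑ (words d) good ≡⟨ cong (λ k → Z.∑ (words k) good) (ℕₚ.m∸n+n≡m d′<d) ⟨
          Z.∑ (words (d ∸ suc d′ ℕ.+ suc d′)) good ≡⟨ ∑-words-stable Z (suc d′) good (λ W l → trans
              (cong (indicator (fits? (v , i) W) ℤ.*_) (χ-long d′ W l))
              (ℤₚ.*-zeroʳ (indicator (fits? (v , i) W)))) (d ∸ suc d′) ⟩
          Z.∑ (words (suc d′)) good                  ∎
        bad-∷ : ∀ u j W → bad ((u , j) ∷ W) ≡ indicator (covers? v i u) ℤ.* χ d′ ((u , j) ∷ W)
        bad-∷ u j W = cong (ℤ._* χ d′ ((u , j) ∷ W)) (double-¬ (covers? v i u))
          where
          double-¬ : ∀ {P : Set} (P? : Dec P) → indicator (¬? (¬? P?)) ≡ indicator P?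
          double-¬ (yes _) = refl
          double-¬ (no _)  = refl
        covered : Z.∑ vertices (λ u → indicator (covers? v i u) ℤ.* τ^ m (C u) d) ≡ Z.∑ (words (suc d′)) bad
        covered = begin
          Z.∑ vertices (λ u → indicator (covers? v i u) ℤ.* τ^ m (C u) d)
            ≡⟨ Z.∑-cong vertices (λ u → trans (cong (indicator (covers? v i u) ℤ.*_) (τ^-≥ m (C u) d m≤d)) (by-vertex u)) ⟩
          Z.∑ vertices (λ u → Z.∑ (upTo (level u)) (λ j → Z.∑ (words d′) (λ W → bad ((u , j) ∷ W))))
            ≡⟨ ℤₚ.+-identityˡ _ ⟨
          0ℤ ℤ.+ Z.∑ vertices (λ u → Z.∑ (upTo (level u)) (λ j → Z.∑ (words d′) (λ W → bad ((u , j) ∷ W))))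
            ≡⟨ ∑-words Z d′ bad ⟨
          Z.∑ (words (suc d′)) bad ∎
          where
          by-vertex : ∀ u → indicator (covers? v i u) ℤ.* C u d′ ≡
            Z.∑ (upTo (level u)) (λ j → Z.∑ (words d′) (λ W → bad ((u , j) ∷ W)))
          by-vertex u = sym (trans
            (Z.∑-cong (upTo (level u)) (λ j → trans (Z.∑-cong (words d′) (bad-∷ u j))
              (Z.∑-* (words d′) (indicator (covers? v i u)) (λ W → χ d′ ((u , j) ∷ W)))))
            (Z.∑-* (upTo (level u)) (indicator (covers? v i u)) (λ j → Z.∑ (words d′) (λ W → χ d′ ((u , j) ∷ W)))))

  lower : Vert → List Vert
  lower v = filter (v >?_) vertices

  tails : Vert → Series
  tails v = Zs.∑ (upTo (level v)) (λ i → τ^ (level v ∸ i) N)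

  -- `letter-count` summed over i < |v|. A vertex u below v is covered by exactly one of the letters
  -- (v , i), that with i = |u|, and |u| < |v| puts it within the range.
  vertex-count : ∀ v → C v Zs.+ᴹ Zs.∑ (lower v) (λ u → τ^ (level v ∸ level u) (C u)) Zs.≈ᴹ tails v
  vertex-count v d = begin
    C v d ℤ.+ Zs.∑ (lower v) (λ u → τ^ (level v ∸ level u) (C u)) d
      ≡⟨ cong (λ z → C v d ℤ.+ z) (trans (∑-eval (lower v) _ d) swap) ⟩
    C v d ℤ.+ Z.∑ (upTo n) (λ i → Z.∑ vertices (λ u → covered i u))
      ≡⟨ Z.∑-+ (upTo n) (λ i → Z.∑ (words d) (λ W → χ d ((v , i) ∷ W))) (λ i → Z.∑ vertices (λ u → covered i u)) ⟨
    Z.∑ (upTo n) (λ i → Z.∑ (words d) (λ W → χ d ((v , i) ∷ W)) ℤ.+ Z.∑ vertices (λ u → covered i u))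
      ≡⟨ Z.∑-cong-∈ (upTo n) (λ {i} i∈ → letter-count v i (∈ₚ.∈-upTo⁻ i∈) d) ⟩
    Z.∑ (upTo n) (λ i → τ^ (n ∸ i) N d)
      ≡⟨ ∑-eval (upTo n) (λ i → τ^ (n ∸ i) N) d ⟨
    tails v d ∎
    where
    open ≡.≡-Reasoning
    n = level v
    covered : ℕ → Vert → ℤ
    covered i u = indicator (covers? v i u) ℤ.* τ^ (n ∸ i) (C u) d
    at : Vert → ℤ
    at u = τ^ (n ∸ level u) (C u) d
    by-level : ∀ u → Z.∑ (upTo n) (λ i → covered i u) ≡ indicator (v >? u) ℤ.* at u
    by-level u with v >? u
    ... | no _    = trans (Z.∑-zero (upTo n) (λ i → refl)) refl
    ... | yes v>u = trans
      (Z.∑-single (upTo n) (Uniqueₚ.upTo⁺ n) (∈ₚ.∈-upTo⁺ (>V⇒level v>u))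
        (λ i → indicator (level u ℕ.≟ i) ℤ.* τ^ (n ∸ i) (C u) d)
        (λ i i≢ → cong (ℤ._* τ^ (n ∸ i) (C u) d) (indicator-no (level u ℕ.≟ i) (λ p → i≢ (sym p)))))
      (cong (ℤ._* at u) (indicator-yes (level u ℕ.≟ level u) refl))
    swap : Z.∑ (lower v) at ≡ Z.∑ (upTo n) (λ i → Z.∑ vertices (λ u → covered i u))
    swap = begin
      Z.∑ (lower v) at ≡⟨ filtered vertices ⟩
      Z.∑ vertices (λ u → indicator (v >? u) ℤ.* at u) ≡⟨ Z.∑-cong vertices by-level ⟨
      Z.∑ vertices (λ u → Z.∑ (upTo n) (λ i → covered i u)) ≡⟨ Z.∑-swap vertices (upTo n) (λ u i → covered i u) ⟩
      Z.∑ (upTo n) (λ i → Z.∑ vertices (λ u → covered i u))      ∎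
      where
      filtered : ∀ us → Z.∑ (filter (v >?_) us) at ≡ Z.∑ us (λ u → indicator (v >? u) ℤ.* at u)
      filtered []       = refl
      filtered (u ∷ us) with v >? u
      ... | yes _ = cong₂ ℤ._+_ (sym (ℤₚ.*-identityˡ (at u))) (filtered us)
      ... | no  _ = trans (filtered us) (sym (ℤₚ.+-identityˡ _))

  -- The reason for the factor 1 - t: it turns t + ⋯ + t^|v| into two terms, of which only the
  -- second depends on v.
  tails-telescope : ∀ v → tails v Zs.-ᴹ τ (tails v) Zs.≈ᴹ τ N Zs.-ᴹ τ^ (suc (level v)) N
  tails-telescope v = go (level v)
    where
    P : ℕ → Series
    P n = Zs.∑ (upTo n) (λ i → τ^ (n ∸ i) N)
    P-suc : ∀ n → P (suc n) Zs.≈ᴹ τ^ (suc n) N Zs.+ᴹ P n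
    P-suc n = Zs.+ᴹ-congˡ {τ^ (suc n) N} (Zs.≈ᴹ-trans
      (Zs.≈ᴹ-reflexive (cong (λ is → Zs.∑ is (λ i → τ^ (suc n ∸ i) N)) (sym (Listₚ.map-applyUpTo (λ i → i) suc n))))
      (Zs.∑-map suc (upTo n) (λ i → τ^ (suc n ∸ i) N)))
    go : ∀ n → P n Zs.-ᴹ τ (P n) Zs.≈ᴹ τ N Zs.-ᴹ τ^ (suc n) N
    go zero    = Zs.≈ᴹ-trans (Zs.x≈y⇒x-y≈0 {Zs.0ᴹ} (Zs.≈ᴹ-sym (IsLinear.0-homo τ-linear))) (Zs.≈ᴹ-sym (Zs.x-x≈0 (τ N)))
    go (suc n) d = begin
      P (suc n) d ℤ.- τ (P (suc n)) d ≡⟨ cong₂ ℤ._-_ (P-suc n d) (IsLinear.resp τ-linear (P-suc n) d) ⟩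
      (x ℤ.+ p) ℤ.- τ (τ^ (suc n) N Zs.+ᴹ P n) d ≡⟨ cong (λ z → (x ℤ.+ p) ℤ.- z) (IsLinear.+-homo τ-linear (τ^ (suc n) N) (P n) d) ⟩
      (x ℤ.+ p) ℤ.- (y ℤ.+ q) ≡⟨ solve 4 (λ x p y q → (x :+ p) :- (y :+ q) := (p :- q) :+ (x :- y)) refl x p y q ⟩
      (p ℤ.- q) ℤ.+ (x ℤ.- y) ≡⟨ cong (ℤ._+ (x ℤ.- y)) (go n d) ⟩
      (z ℤ.- x) ℤ.+ (x ℤ.- y) ≡⟨ solve 3 (λ x y z → (z :- x) :+ (x :- y) := z :- y) refl x y z ⟩
      z ℤ.- y                                                  ∎
      where
      open ≡.≡-Reasoning
      open ℤSolver.+-*-Solver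
      x = τ^ (suc n) N d
      y = τ^ (suc (suc n)) N d
      z = τ N d
      p = P n d
      q = τ (P n) d

-- Chains and the solution of the triangular system

module ChainCounting (Γ : Graph) (_>?_ : Decidable₂ (GraphNotions._>V_ Γ))
    (star : GraphNotions.Vert Γ) (star-level : Graph.level Γ star ≡ 0)
    (>star : ∀ v → v ≢ star → GraphNotions._>V_ Γ v star) where
  open GraphLemmas Γ
  open NormalWords Γ _>?_
  open PowerSeries
  open Counting Γ _>?_

  -- The number b bounds the length. Levels drop along a chain, so all chains from v are found as
  -- soon as b exceeds |v|.
  chainsFrom : ℕ → Vert → List (List Vert)
  chainsFrom zero    v = []
  chainsFrom (suc b) v = (v ∷ []) ∷ concatMap (λ u → map (v ∷_) (chainsFrom b u)) (lower v)

  ∈-lower⁻ : ∀ v {u} → u ∈ lower v → v >V u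
  ∈-lower⁻ v u∈ = proj₂ (∈ₚ.∈-filter⁻ (v >?_) {xs = vertices} u∈)

  ∈-lower⁺ : ∀ {v u} → v >V u → u ∈ lower v
  ∈-lower⁺ {v} {u} v>u = ∈ₚ.∈-filter⁺ (v >?_) (∈ₚ.∈-allFin u) v>u

  lower-unique : ∀ v → Unique (lower v)
  lower-unique v = Uniqueₚ.filter⁺ (v >?_) (Uniqueₚ.allFin⁺ nV)

  ChainAt : Vert → List Vert → Set
  ChainAt v ch = Σ (List Vert) λ vs → ch ≡ v ∷ vs × IsChainFrom v vs

  ∈-chainsFrom⁻ : ∀ b v {ch} → ch ∈ chainsFrom b v → ChainAt v ch
  ∈-chainsFrom⁻ (suc b) v (here refl) = [] , refl , tt
  ∈-chainsFrom⁻ (suc b) v (there ch∈)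
    with u , u∈ , ch∈u ← find (∈ₚ.∈-concatMap⁻ (λ u → map (v ∷_) (chainsFrom b u)) {xs = lower v} ch∈)
    with us , us∈ , refl ← ∈ₚ.∈-map⁻ (v ∷_) ch∈u
    with ws , refl , chain ← ∈-chainsFrom⁻ b u us∈ = u ∷ ws , refl , ∈-lower⁻ v u∈ , chain

  ∈-chainsFrom⁺ : ∀ b v vs → level v < b → IsChainFrom v vs → v ∷ vs ∈ chainsFrom b v
  ∈-chainsFrom⁺ (suc b) v []       _         _             = here refl
  ∈-chainsFrom⁺ (suc b) v (u ∷ us) (s≤s n≤b) (v>u , chain) = there
    (∈ₚ.∈-concatMap⁺ (λ u → map (v ∷_) (chainsFrom b u)) (lose (∈-lower⁺ v>u)
      (∈ₚ.∈-map⁺ (v ∷_) (∈-chainsFrom⁺ b u us (ℕₚ.<-≤-trans (>V⇒level v>u) n≤b) chain))))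

  chainsFrom-head : ∀ {b b′ u v ch} → ch ∈ chainsFrom b u → ch ∈ chainsFrom b′ v → u ≡ v
  chainsFrom-head {b} {b′} {u} {v} ch∈u ch∈v with ∈-chainsFrom⁻ b u ch∈u | ∈-chainsFrom⁻ b′ v ch∈v
  ... | _ , refl , _ | _ , refl , _ = refl

  chainsFrom-unique : ∀ b v → Unique (chainsFrom b v)
  chainsFrom-unique zero    v = []
  chainsFrom-unique (suc b) v = All.tabulate (λ ch∈ p → longer (lower v) (subst (_∈ _) (sym p) ch∈))
    ∷ concatMap-unique (lower-unique v) (λ u → Uniqueₚ.map⁺ Listₚ.∷-injectiveʳ (chainsFrom-unique b u)) same
    where
    same : ∀ {x y ch} → ch ∈ map (v ∷_) (chainsFrom b x) → ch ∈ map (v ∷_) (chainsFrom b y) → x ≡ y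
    same ch∈x ch∈y with ∈ₚ.∈-map⁻ (v ∷_) ch∈x | ∈ₚ.∈-map⁻ (v ∷_) ch∈y
    ... | _ , p∈ , p | _ , q∈ , q with Listₚ.∷-injectiveʳ (trans (sym p) q)
    ...   | refl = chainsFrom-head {b} {b} p∈ q∈
    longer : ∀ us → ¬ (v ∷ []) ∈ concatMap (λ u → map (v ∷_) (chainsFrom b u)) us
    longer (u ∷ us) ch∈ with ∈ₚ.∈-++⁻ (map (v ∷_) (chainsFrom b u)) ch∈
    ... | inj₂ p = longer us p
    ... | inj₁ p with ∈ₚ.∈-map⁻ (v ∷_) p
    ...   | _ , q∈ , refl with ∈-chainsFrom⁻ b u q∈
    ...     | _ , () , _

  allChains : List (List Vert)
  allChains = concatMap (λ v → chainsFrom (suc (level v)) v) vertices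

  allChains-unique : Unique allChains
  allChains-unique = concatMap-unique (Uniqueₚ.allFin⁺ nV) (λ v → chainsFrom-unique (suc (level v)) v)
    (λ {x} {y} → chainsFrom-head {suc (level x)} {suc (level y)})

  ∈-allChains⁻ : ∀ {ch} → ch ∈ allChains → IsChain ch
  ∈-allChains⁻ ch∈
    with v , _ , ch∈v ← find (∈ₚ.∈-concatMap⁻ (λ v → chainsFrom (suc (level v)) v) {xs = vertices} ch∈)
    with _ , refl , chain ← ∈-chainsFrom⁻ (suc (level v)) v ch∈v = chain

  ∈-allChains⁺ : ∀ {ch} → IsChain ch → ch ∈ allChains
  ∈-allChains⁺ {v ∷ vs} chain = ∈ₚ.∈-concatMap⁺ (λ v → chainsFrom (suc (level v)) v)
    (lose (∈ₚ.∈-allFin v) (∈-chainsFrom⁺ (suc (level v)) v vs ℕₚ.≤-refl chain))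

  span : Vert → List Vert → ℕ
  span v vs = (level v ∸ level (lastOr v vs)) ℕ.+ 1

  sign : List Vert → ℤ
  sign ch = -1ℤ ℤ.^ length ch

  -- The contribution (-1)^ℓ t^(|v₁| - |v_ℓ| + 1) of a chain, multiplied by the series N.
  value : List Vert → Series
  value []       = Zs.0ᴹ
  value (v ∷ vs) = sign (v ∷ vs) Zs.*ₗ τ^ (span v vs) N

  lastOr-level : ∀ v vs → IsChainFrom v vs → level (lastOr v vs) ≤ level v
  lastOr-level v []       _             = ℕₚ.≤-refl
  lastOr-level v (u ∷ us) (v>u , chain) = ℕₚ.≤-trans (lastOr-level u us chain) (ℕₚ.<⇒≤ (>V⇒level v>u))

  value-∷ : ∀ v u us → IsChainFrom v (u ∷ us) →
    value (v ∷ u ∷ us) Zs.≈ᴹ -1ℤ Zs.*ₗ τ^ (level v ∸ level u) (value (u ∷ us))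
  value-∷ v u us (v>u , chain) = Zs.≈ᴹ-trans
    (Zs.*ₗ-assoc -1ℤ (sign (u ∷ us)) (τ^ (span v (u ∷ us)) N))
    (Zs.*ₗ-congˡ { -1ℤ} {sign (u ∷ us) Zs.*ₗ τ^ (span v (u ∷ us)) N} (Zs.≈ᴹ-trans
      (Zs.≈ᴹ-reflexive (cong (sign (u ∷ us) Zs.*ₗ_) (trans (cong (λ m → τ^ m N) arith) (τ^-+ (level v ∸ level u) (span u us) N))))
      (Zs.≈ᴹ-sym (IsLinear.*-homo (τ^-linear (level v ∸ level u)) (sign (u ∷ us)) (τ^ (span u us) N)))))
    where
    l = level (lastOr u us)
    arith : (level v ∸ l) ℕ.+ 1 ≡ (level v ∸ level u) ℕ.+ ((level u ∸ l) ℕ.+ 1)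
    arith = trans (cong (ℕ._+ 1) (trans (cong (_∸ l) (sym (ℕₚ.m∸n+n≡m (ℕₚ.<⇒≤ (>V⇒level v>u)))))
        (ℕₚ.+-∸-assoc (level v ∸ level u) (lastOr-level u us chain))))
      (ℕₚ.+-assoc (level v ∸ level u) (level u ∸ l) 1)

  X : ℕ → Vert → Series
  X b v = Zs.∑ (chainsFrom b v) value

  drop-by : Vert → Vert → Series → Series
  drop-by v u s = -1ℤ Zs.*ₗ τ^ (level v ∸ level u) s

  -- Sorting chains by their second vertex u: removing v from the front reverses the sign and lowers
  -- the exponent by |v| - |u|.
  X-suc : ∀ b v → X (suc b) v Zs.≈ᴹ -1ℤ Zs.*ₗ τ N Zs.+ᴹ Zs.∑ (lower v) (λ u → drop-by v u (X b u))
  X-suc b v = Zs.+ᴹ-cong {value (v ∷ [])} { -1ℤ Zs.*ₗ τ N}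
    (Zs.≈ᴹ-reflexive (cong (λ m → -1ℤ Zs.*ₗ τ^ (m ℕ.+ 1) N) (ℕₚ.n∸n≡0 (level v))))
    (Zs.≈ᴹ-trans (Zs.∑-concatMap (λ u → map (v ∷_) (chainsFrom b u)) (lower v) value)
      (Zs.∑-cong-∈ (lower v) by-second))
    where
    by-second : ∀ {u} → u ∈ lower v → Zs.∑ (map (v ∷_) (chainsFrom b u)) value Zs.≈ᴹ drop-by v u (X b u)
    by-second {u} u∈ = Zs.≈ᴹ-trans (Zs.∑-map (v ∷_) (chainsFrom b u) value)
      (Zs.≈ᴹ-trans (Zs.∑-cong-∈ (chainsFrom b u) by-chain)
      (Zs.≈ᴹ-trans (Zs.∑-* (chainsFrom b u) -1ℤ (λ ch → τ^ (level v ∸ level u) (value ch)))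
        (Zs.*ₗ-congˡ { -1ℤ} (Zs.≈ᴹ-sym (IsLinear.∑-homo (τ^-linear (level v ∸ level u)) (chainsFrom b u) value)))))
      where
      by-chain : ∀ {ch} → ch ∈ chainsFrom b u → value (v ∷ ch) Zs.≈ᴹ drop-by v u (value ch)
      by-chain ch∈ with ∈-chainsFrom⁻ b u ch∈
      ... | us , refl , chain = value-∷ v u us (∈-lower⁻ v u∈ , chain)

  at-star : Vert → ℤ
  at-star v = indicator (v ≟F star)

  -- The closed form of the chain sum from v. Multiplied by t - 1, the system for the series `C` has
  -- right side - t N + t^(|v|+1) N, while chain sums require - t N. The extra term at `star`
  -- cancels the surplus, since `star` lies below every other vertex.
  Y : Vert → Series
  Y v = (τ (C v) Zs.-ᴹ C v) Zs.-ᴹ at-star v Zs.*ₗ τ N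

  private
    S E : Vert → Series
    S v = Zs.∑ (lower v) (λ u → τ^ (level v ∸ level u) (C u))
    E v = Zs.∑ (lower v) (λ u → at-star u Zs.*ₗ τ^ (level v ∸ level u) (τ N))

    ∑-drop-Y : ∀ v → Zs.∑ (lower v) (λ u → drop-by v u (Y u)) Zs.≈ᴹ (S v Zs.-ᴹ τ (S v)) Zs.+ᴹ E v
    ∑-drop-Y v = Zs.≈ᴹ-trans (Zs.∑-cong (lower v) one)
      (Zs.≈ᴹ-trans (Zs.∑-+ (lower v) (λ u → c u Zs.-ᴹ τ (c u)) e)
        (Zs.+ᴹ-congʳ {E v} (Zs.≈ᴹ-trans (Zs.∑-sub (lower v) c (λ u → τ (c u)))
          (Zs.-ᴹ-cong {S v} (λ _ → refl) (Zs.≈ᴹ-sym (IsLinear.∑-homo τ-linear (lower v) c))))))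
      where
      c e : Vert → Series
      c u = τ^ (level v ∸ level u) (C u)
      e u = at-star u Zs.*ₗ τ^ (level v ∸ level u) (τ N)
      one : ∀ u → drop-by v u (Y u) Zs.≈ᴹ (c u Zs.-ᴹ τ (c u)) Zs.+ᴹ e u
      one u d = begin
        -1ℤ ℤ.* τ^ m (Y u) d
          ≡⟨ cong (-1ℤ ℤ.*_) (L.-‿homo (τ (C u) Zs.-ᴹ C u) (at-star u Zs.*ₗ τ N) d) ⟩
        -1ℤ ℤ.* (τ^ m (τ (C u) Zs.-ᴹ C u) d ℤ.- τ^ m (at-star u Zs.*ₗ τ N) d)
          ≡⟨ cong₂ (λ x y → -1ℤ ℤ.* (x ℤ.- y)) (L.-‿homo (τ (C u)) (C u) d) (L.*-homo (at-star u) (τ N) d) ⟩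
        -1ℤ ℤ.* ((τ^ m (τ (C u)) d ℤ.- c u d) ℤ.- e u d)
          ≡⟨ cong (λ s → -1ℤ ℤ.* ((s d ℤ.- c u d) ℤ.- e u d)) (τ^-τ m (C u)) ⟩
        -1ℤ ℤ.* ((τ (c u) d ℤ.- c u d) ℤ.- e u d)
          ≡⟨ solve 3 (λ x y z → con -1ℤ :* ((x :- y) :- z) := (y :- x) :+ z) refl (τ (c u) d) (c u d) (e u d) ⟩
        (c u d ℤ.- τ (c u) d) ℤ.+ e u d ∎
        where
        open ≡.≡-Reasoning
        open ℤSolver.+-*-Solver
        m = level v ∸ level u
        module L = IsLinear (τ^-linear m)

    E-≢ : ∀ v → v ≢ star → E v Zs.≈ᴹ τ^ (suc (level v)) N
    E-≢ v v≢ = Zs.≈ᴹ-trans (Zs.∑-single (lower v) (lower-unique v) (∈-lower⁺ (>star v v≢))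
        (λ u → at-star u Zs.*ₗ τ^ (level v ∸ level u) (τ N))
        (λ u u≢ d → cong (ℤ._* τ^ (level v ∸ level u) (τ N) d) (indicator-no (u ≟F star) u≢)))
      (Zs.≈ᴹ-trans (λ d → trans (cong (ℤ._* τ^ (level v ∸ level star) (τ N) d) (indicator-yes (star ≟F star) refl))
          (ℤₚ.*-identityˡ (τ^ (level v ∸ level star) (τ N) d)))
        (Zs.≈ᴹ-reflexive (trans (cong (λ l → τ^ (level v ∸ l) (τ N)) star-level) (τ^-τ (level v) N))))

    lower-star : ∀ (f : Vert → Series) → Zs.∑ (lower star) f Zs.≈ᴹ Zs.0ᴹ
    lower-star f = Zs.∑-zero-∈ (lower star)
      (λ {u} u∈ → ⊥-elim (ℕₚ.n≮0 (subst (level u <_) star-level (>V⇒level (∈-lower⁻ star u∈)))))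

    C-star : C star Zs.≈ᴹ Zs.0ᴹ
    C-star d = cong (λ n → Z.∑ (upTo n) (λ i → Z.∑ (words d) (λ W → χ d ((star , i) ∷ W)))) star-level

    step : ∀ v → -1ℤ Zs.*ₗ τ N Zs.+ᴹ Zs.∑ (lower v) (λ u → drop-by v u (Y u)) Zs.≈ᴹ Y v
    step v d = at (v ≟F star)
      where
      open ≡.≡-Reasoning
      open ℤSolver.+-*-Solver
      n = τ N d
      at : Dec (v ≡ star) → -1ℤ ℤ.* n ℤ.+ Zs.∑ (lower v) (λ u → drop-by v u (Y u)) d ≡ Y v d
      at (yes refl) = begin
        -1ℤ ℤ.* n ℤ.+ Zs.∑ (lower v) (λ u → drop-by v u (Y u)) d
          ≡⟨ cong (λ z → -1ℤ ℤ.* n ℤ.+ z) (lower-star (λ u → drop-by v u (Y u)) d) ⟩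
        -1ℤ ℤ.* n ℤ.+ 0ℤ
          ≡⟨ solve 1 (λ n → con -1ℤ :* n :+ con 0ℤ := (con 0ℤ :- con 0ℤ) :- con 1ℤ :* n) refl n ⟩
        (0ℤ ℤ.- 0ℤ) ℤ.- 1ℤ ℤ.* n
          ≡⟨ cong₂ ℤ._-_ (cong₂ ℤ._-_ (IsLinear.≈0-homo τ-linear C-star d) (C-star d))
               (cong (ℤ._* n) (indicator-yes (v ≟F star) refl)) ⟨
        Y v d ∎
      at (no v≢) = begin
        -1ℤ ℤ.* n ℤ.+ Zs.∑ (lower v) (λ u → drop-by v u (Y u)) d
          ≡⟨ cong (λ z → -1ℤ ℤ.* n ℤ.+ z) (∑-drop-Y v d) ⟩
        -1ℤ ℤ.* n ℤ.+ ((s ℤ.- τs) ℤ.+ E v d)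
          ≡⟨ cong (λ z → -1ℤ ℤ.* n ℤ.+ ((s ℤ.- τs) ℤ.+ z)) (E-≢ v v≢ d) ⟩
        -1ℤ ℤ.* n ℤ.+ ((s ℤ.- τs) ℤ.+ top)
          ≡⟨ solve 6 (λ n s τs top c τc → con -1ℤ :* n :+ ((s :- τs) :+ top)
               := ((c :+ s) :- (τc :+ τs)) :- (n :- top) :+ (τc :- c)) refl n s τs top c τc ⟩
        ((c ℤ.+ s) ℤ.- (τc ℤ.+ τs)) ℤ.- (n ℤ.- top) ℤ.+ (τc ℤ.- c)
          ≡⟨ cong (λ z → z ℤ.- (n ℤ.- top) ℤ.+ (τc ℤ.- c)) telescoped ⟩
        (n ℤ.- top) ℤ.- (n ℤ.- top) ℤ.+ (τc ℤ.- c)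
          ≡⟨ solve 4 (λ n top c τc → (n :- top) :- (n :- top) :+ (τc :- c) := (τc :- c) :- con 0ℤ :* n) refl n top c τc ⟩
        (τc ℤ.- c) ℤ.- 0ℤ ℤ.* n
          ≡⟨ cong (λ z → (τc ℤ.- c) ℤ.- z ℤ.* n) (indicator-no (v ≟F star) v≢) ⟨
        Y v d ∎
        where
        s = S v d
        τs = τ (S v) d
        c = C v d
        τc = τ (C v) d
        top = τ^ (suc (level v)) N d
        telescoped : (c ℤ.+ s) ℤ.- (τc ℤ.+ τs) ≡ n ℤ.- top
        telescoped = trans (cong₂ ℤ._-_ (vertex-count v d)
          (trans (sym (IsLinear.+-homo τ-linear (C v) (S v) d)) (IsLinear.resp τ-linear (vertex-count v) d)))
          (tails-telescope v d)

  X≈Y : ∀ b v → level v < b → X b v Zs.≈ᴹ Y v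
  X≈Y (suc b) v (s≤s n≤b) = Zs.≈ᴹ-trans (X-suc b v) (Zs.≈ᴹ-trans
    (Zs.+ᴹ-congˡ { -1ℤ Zs.*ₗ τ N} (Zs.∑-cong-∈ (lower v) (λ {u} u∈ →
      Zs.*ₗ-congˡ { -1ℤ} (IsLinear.resp (τ^-linear (level v ∸ level u))
        (X≈Y b u (ℕₚ.<-≤-trans (>V⇒level (∈-lower⁻ v u∈)) n≤b))))))
    (step v))

  -- By `X≈Y` all chains together contribute (t - 1) ΣC - t N; inserting N = 1 + ΣC leaves 1 - t.
  allChains-value : N Zs.+ᴹ Zs.∑ allChains value Zs.≈ᴹ unit Zs.-ᴹ τ unit
  allChains-value d = begin
    N d ℤ.+ Zs.∑ allChains value d
      ≡⟨ cong (λ z → N d ℤ.+ z) (total d) ⟩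
    N d ℤ.+ ((τ ΣC d ℤ.- ΣC d) ℤ.- τ N d)
      ≡⟨ cong₂ (λ x y → x ℤ.+ ((τ ΣC d ℤ.- ΣC d) ℤ.- y)) (N-expand d)
           (trans (IsLinear.resp τ-linear N-expand d) (IsLinear.+-homo τ-linear unit ΣC d)) ⟩
    (unit d ℤ.+ ΣC d) ℤ.+ ((τ ΣC d ℤ.- ΣC d) ℤ.- (τ unit d ℤ.+ τ ΣC d))
      ≡⟨ solve 4 (λ u c τc τu → (u :+ c) :+ ((τc :- c) :- (τu :+ τc)) := u :- τu) refl (unit d) (ΣC d) (τ ΣC d) (τ unit d) ⟩
    unit d ℤ.- τ unit d ∎
    where
    open ≡.≡-Reasoning
    open ℤSolver.+-*-Solver
    ΣC : Series
    ΣC = Zs.∑ vertices C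
    stars : Zs.∑ vertices (λ v → at-star v Zs.*ₗ τ N) Zs.≈ᴹ τ N
    stars = Zs.≈ᴹ-trans (Zs.∑-single vertices (Uniqueₚ.allFin⁺ nV) (∈ₚ.∈-allFin star) (λ v → at-star v Zs.*ₗ τ N)
        (λ v v≢ d → cong (ℤ._* τ N d) (indicator-no (v ≟F star) v≢)))
      (λ d → trans (cong (ℤ._* τ N d) (indicator-yes (star ≟F star) refl)) (ℤₚ.*-identityˡ (τ N d)))
    total : Zs.∑ allChains value Zs.≈ᴹ (τ ΣC Zs.-ᴹ ΣC) Zs.-ᴹ τ N
    total = Zs.≈ᴹ-trans (Zs.∑-concatMap (λ v → chainsFrom (suc (level v)) v) vertices value)
      (Zs.≈ᴹ-trans (Zs.∑-cong vertices (λ v → X≈Y (suc (level v)) v ℕₚ.≤-refl))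
      (Zs.≈ᴹ-trans (Zs.∑-sub vertices (λ v → τ (C v) Zs.-ᴹ C v) (λ v → at-star v Zs.*ₗ τ N))
        (Zs.-ᴹ-cong {_} {τ ΣC Zs.-ᴹ ΣC} (Zs.≈ᴹ-trans (Zs.∑-sub vertices (λ v → τ (C v)) C)
          (Zs.-ᴹ-cong {_} {τ ΣC} {ΣC} (Zs.≈ᴹ-sym (IsLinear.∑-homo τ-linear vertices C)) (λ _ → refl))) stars)))

  private
    if-yes : ∀ {P : Set} (P? : Dec P) (s : ℤ) → P → (if does P? then s else 0ℤ) ≡ s
    if-yes (yes _) s p = refl
    if-yes (no ¬p) s p = ⊥-elim (¬p p)

    if-no : ∀ {P : Set} (P? : Dec P) (s : ℤ) → ¬ P → (if does P? then s else 0ℤ) ≡ 0ℤ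
    if-no (yes p) s ¬p = ⊥-elim (¬p p)
    if-no (no _)  s ¬p = refl

    convolve-single : ∀ k s (h : Series) M → Z.∑ (upTo (suc M)) (λ j → (if does (k ℕ.≟ j) then s else 0ℤ) ℤ.* h (M ∸ j)) ≡
      s ℤ.* τ^ k h M
    convolve-single k s h M with ℕₚ.<-≤-connex M k
    ... | inj₁ M<k = trans
      (Z.∑-zero-∈ (upTo (suc M)) (λ {j} j∈ → cong (ℤ._* h (M ∸ j))
        (if-no (k ℕ.≟ j) s (λ { refl → ℕₚ.<⇒≱ M<k (ℕₚ.≤-pred (∈ₚ.∈-upTo⁻ j∈)) }))))
      (sym (trans (cong (s ℤ.*_) (τ^-< k h M M<k)) (ℤₚ.*-zeroʳ s)))
    ... | inj₂ k≤M = trans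
      (Z.∑-single (upTo (suc M)) (Uniqueₚ.upTo⁺ (suc M)) (∈ₚ.∈-upTo⁺ (s≤s k≤M))
        (λ j → (if does (k ℕ.≟ j) then s else 0ℤ) ℤ.* h (M ∸ j))
        (λ j j≢k → cong (ℤ._* h (M ∸ j)) (if-no (k ℕ.≟ j) s (λ k≡j → j≢k (sym k≡j)))))
      (cong₂ ℤ._*_ (if-yes (k ℕ.≟ k) s refl) (sym (τ^-≥ k h M k≤M)))

    chainTerm-if : ∀ v vs j → chainTerm (v ∷ vs) j ≡ (if does (span v vs ℕ.≟ j) then sign (v ∷ vs) else 0ℤ)
    chainTerm-if v vs j with span v vs ℕ.≟ j
    ... | yes p = sym (if-yes (span v vs ℕ.≟ j) (sign (v ∷ vs)) p)
    ... | no ¬p = sym (if-no (span v vs ℕ.≟ j) (sign (v ∷ vs)) ¬p)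

  chainTerm-value : ∀ ch M → Z.∑ (upTo (suc M)) (λ j → chainTerm ch j ℤ.* N (M ∸ j)) ≡ value ch M
  chainTerm-value []       M = Z.∑-zero (upTo (suc M)) (λ j → refl)
  chainTerm-value (v ∷ vs) M = trans
    (Z.∑-cong (upTo (suc M)) (λ j → cong (ℤ._* N (M ∸ j)) (chainTerm-if v vs j)))
    (convolve-single (span v vs) (sign (v ∷ vs)) N M)

  sumℤ-map : ∀ {a} {A : Set a} (f : A → ℤ) xs → sumℤ (map f xs) ≡ Z.∑ xs f
  sumℤ-map f []       = refl
  sumℤ-map f (x ∷ xs) = cong (λ z → f x ℤ.+ z) (sumℤ-map f xs)

  chainPolyCoeff-split : ∀ Cs j → chainPolyCoeff Cs j ≡ unit j ℤ.+ Z.∑ Cs (λ ch → chainTerm ch j)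
  chainPolyCoeff-split Cs zero    = cong (λ z → 1ℤ ℤ.+ z) (sumℤ-map (λ ch → chainTerm ch 0) Cs)
  chainPolyCoeff-split Cs (suc j) = cong (λ z → 0ℤ ℤ.+ z) (sumℤ-map (λ ch → chainTerm ch (suc j)) Cs)

  unit-τ : ∀ d → unit d ℤ.- τ unit d ≡ oneMinusT d
  unit-τ zero          = refl
  unit-τ (suc zero)    = refl
  unit-τ (suc (suc d)) = refl

  convolution : ∀ (Cs : List (List Vert)) → Unique Cs → (∀ ch → (ch ∈ Cs → IsChain ch) × (IsChain ch → ch ∈ Cs)) →
    ∀ M → sumℤ (map (λ j → chainPolyCoeff Cs j ℤ.* N (M ∸ j)) (upTo (suc M))) ≡ oneMinusT M
  convolution Cs Cs-unique Cs-complete M = begin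
    sumℤ (map (λ j → chainPolyCoeff Cs j ℤ.* N (M ∸ j)) js)
      ≡⟨ sumℤ-map (λ j → chainPolyCoeff Cs j ℤ.* N (M ∸ j)) js ⟩
    Z.∑ js (λ j → chainPolyCoeff Cs j ℤ.* N (M ∸ j))
      ≡⟨ Z.∑-cong js (λ j → trans (cong (ℤ._* N (M ∸ j)) (chainPolyCoeff-split Cs j))
           (ℤₚ.*-distribʳ-+ (N (M ∸ j)) (unit j) (Z.∑ Cs (λ ch → chainTerm ch j)))) ⟩
    Z.∑ js (λ j → unit j ℤ.* N (M ∸ j) ℤ.+ Z.∑ Cs (λ ch → chainTerm ch j) ℤ.* N (M ∸ j))
      ≡⟨ Z.∑-+ js (λ j → unit j ℤ.* N (M ∸ j)) (λ j → Z.∑ Cs (λ ch → chainTerm ch j) ℤ.* N (M ∸ j)) ⟩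
    Z.∑ js (λ j → unit j ℤ.* N (M ∸ j)) ℤ.+ Z.∑ js (λ j → Z.∑ Cs (λ ch → chainTerm ch j) ℤ.* N (M ∸ j))
      ≡⟨ cong₂ ℤ._+_ units chains ⟩
    N M ℤ.+ Zs.∑ allChains value M
      ≡⟨ allChains-value M ⟩
    unit M ℤ.- τ unit M
      ≡⟨ unit-τ M ⟩
    oneMinusT M ∎
    where
    open ≡.≡-Reasoning
    js = upTo (suc M)
    units : Z.∑ js (λ j → unit j ℤ.* N (M ∸ j)) ≡ N M
    units = trans (Z.∑-single js (Uniqueₚ.upTo⁺ (suc M)) (∈ₚ.∈-upTo⁺ (s≤s z≤n)) (λ j → unit j ℤ.* N (M ∸ j))
        (λ { zero ≢ → ⊥-elim (≢ refl) ; (suc j) _ → refl }))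
      (ℤₚ.*-identityˡ (N M))
    factor : ∀ j → Z.∑ Cs (λ ch → chainTerm ch j) ℤ.* N (M ∸ j) ≡ Z.∑ Cs (λ ch → chainTerm ch j ℤ.* N (M ∸ j))
    factor j = trans (ℤₚ.*-comm (Z.∑ Cs (λ ch → chainTerm ch j)) (N (M ∸ j)))
      (trans (sym (Z.∑-* Cs (N (M ∸ j)) (λ ch → chainTerm ch j)))
        (Z.∑-cong Cs (λ ch → ℤₚ.*-comm (N (M ∸ j)) (chainTerm ch j))))
    -- Two duplicate-free lists with the same members are permutations of each other, so the given
    -- enumeration of chains may be exchanged for the recursive one.
    Cs↭allChains : Cs ↭ allChains
    Cs↭allChains = ∼bag⇒↭ (unique∧set⇒bag Cs-unique allChains-unique (λ {ch} →
      mk⇔ (λ ch∈ → ∈-allChains⁺ (proj₁ (Cs-complete ch) ch∈)) (λ ch∈ → proj₂ (Cs-complete ch) (∈-allChains⁻ ch∈))))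
    chains : Z.∑ js (λ j → Z.∑ Cs (λ ch → chainTerm ch j) ℤ.* N (M ∸ j)) ≡ Zs.∑ allChains value M
    chains = begin
      Z.∑ js (λ j → Z.∑ Cs (λ ch → chainTerm ch j) ℤ.* N (M ∸ j)) ≡⟨ Z.∑-cong js factor ⟩
      Z.∑ js (λ j → Z.∑ Cs (λ ch → chainTerm ch j ℤ.* N (M ∸ j))) ≡⟨ Z.∑-swap js Cs (λ j ch → chainTerm ch j ℤ.* N (M ∸ j)) ⟩
      Z.∑ Cs (λ ch → Z.∑ js (λ j → chainTerm ch j ℤ.* N (M ∸ j))) ≡⟨ Z.∑-cong Cs (λ ch → chainTerm-value ch M) ⟩
      Z.∑ Cs (λ ch → value ch M) ≡⟨ ∑-eval Cs value M ⟨
      Zs.∑ Cs value M ≡⟨ Zs.∑-↭ Cs↭allChains value M ⟩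
      Zs.∑ allChains value M                                            ∎

-- Paths to the minimal vertex and the conclusion

module DistinguishedPaths (Γ : Graph) (star : GraphNotions.Vert Γ)
    (star-unique : ∀ v → Graph.level Γ v ≡ 0 → v ≡ star)
    (outgoing : ∀ v → 1 ≤ Graph.level Γ v → Σ (GraphNotions.Edge Γ) (λ e → Graph.tl Γ e ≡ v)) where
  open GraphLemmas Γ

  private
    descend : ∀ n v → level v ≡ n → Σ (List Edge) (IsPath v star)
    descend zero    v p = [] , star-unique v p
    descend (suc n) v p with outgoing v (subst (1 ≤_) (sym p) (s≤s z≤n))
    ... | e , refl with descend n (hd e) (ℕₚ.suc-injective (trans (sym (layered e)) p))
    ...   | π , π-path = e ∷ π , refl , π-path

  toStar : ∀ v → Σ (List Edge) (IsPath v star)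
  toStar v = descend (level v) v refl

  >star : ∀ v → v ≢ star → v >V star
  >star v v≢star with toStar v
  ... | []    , v≡star = ⊥-elim (v≢star v≡star)
  ... | e ∷ π , p      = e ∷ π , s≤s z≤n , p

theorem2 : ∀ {c ℓ} (F : Field c ℓ) (Γ : Graph) →
    let open GraphNotions Γ in
    (star : Vert) → level star ≡ 0 → (∀ v → level v ≡ 0 → v ≡ star) →
    (∀ v → 1 ≤ level v → Σ Edge (λ e → tl e ≡ v)) →
    (h : ℕ → ℕ) → (∀ i → Alg.IsDimA F Γ i (h i)) →
    (C : List (List Vert)) → Unique C → (∀ ch → (ch ∈ C → IsChain ch) × (IsChain ch → ch ∈ C)) →
    ∀ N → sumℤ (map (λ j → chainPolyCoeff C j ℤ.* ℤ.+ (h (N ∸ j))) (upTo (suc N))) ≡ oneMinusT N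
theorem2 F Γ star star-level star-unique outgoing h isDim C C-unique C-complete N =
  trans
    (cong sumℤ (Listₚ.map-cong (λ j → cong (chainPolyCoeff C j ℤ.*_) (dim-series (N ∸ j))) (upTo (suc N))))
    (ChainCounting.convolution Γ _>?_ star star-level >star C C-unique C-complete N)
  where
  open GraphNotions Γ
  open DistinguishedPaths Γ star star-unique outgoing

  -- The complete list of chains decides reachability: v > w exactly when the chain of the two
  -- vertices occurs in it, and membership in a list of vertex lists is decidable.
  _>?_ : ∀ v w → Dec (v >V w)
  v >? w = map′ (λ ch∈ → proj₁ (proj₁ (C-complete (v ∷ w ∷ [])) ch∈)) (λ v>w → proj₂ (C-complete (v ∷ w ∷ [])) (v>w , tt))
    ((v ∷ w ∷ []) ∈? C)
    where open DecMembership (Listₚ.≡-dec _≟F_) using (_∈?_)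

  dim-series : ∀ d → ℤ.+ h d ≡ Counting.N Γ _>?_ d
  dim-series d = trans
    (cong ℤ.+_ (Dimension.dimension F Γ _>?_ star star-level toStar (isDim d)))
    (sym (Counting.N-length Γ _>?_ d))
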